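{- For each $r\in(\mathbb{N}\setminus\{0\})\cup\{\infty\}$, $\mathbf{PQSym}^{*r}$ is a graded Hopf subalgebra of $\mathbf{PQSym}^*$, and these form an infinite chain of nested graded Hopf subalgebras $$\mathbf{PQSym}^*=\mathbf{PQSym}^{*1}\supseteq\mathbf{PQSym}^{*2}\supseteq\dots\supseteq\mathbf{PQSym}^{*r}\supseteq\dots\supseteq\mathbf{PQSym}^{*\infty},$$ which are noncommutative and noncocommutative, except $\mathbf{PQSym}^{*\infty}$ which is cocommutative.
   Context: Words are finite words on $\mathbb{N}\setminus\{0\}$. A word $u=u_1\dots u_n$ is a parking function if its nondecreasing rearrangement $u'$ satisfies $u'_i\le i$ for all $i$; prime if moreover $u'_i<i$ for $i\ge2$. Parkization: for $w=w_1\dots w_n$ let $d(w)=\min\{i\ge1:\#\{j:w_j\le i\}<i\}$; if $d(w)=n+1$ then $\mathrm{Park}(w)=w$, otherwise $\mathrm{Park}(w)=\mathrm{Park}(w')$ with $w'$ obtained by decreasing by one all letters greater than $d(w)$. $\mathbf{PQSym}^*$ is the span over a field $\mathbb{K}$ of characteristic $0$ of $\mathbf{G}_u=\sum_{\mathrm{Park}(w)=u}w$, $u$ parking function, graded by the length of $u$, with product $\mathbf{G}_u\mathbf{G}_v=\sum \mathbf{G}_w$ over parking functions $w=a\cdot b$ (concatenation) with $\mathrm{Park}(a)=u$, $\mathrm{Park}(b)=v$, and coproduct $\Delta\mathbf{G}_u=\sum\mathbf{G}_a\otimes\mathbf{G}_b$ over pairs of parking functions $(a,b)$ such that $u$ is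 a shuffle of $a$ with the word obtained from $b$ by adding $|a|$ to each letter. $\mathrm{BW}$ is the set of infinite sequences of columns $(L_i,M_i)_{i\ge1}$, $L_i$ finite sets of positive integers, $M_i$ words, such that the nonempty $L_i$ in order form a set composition of $[n]$ ($n$ = length) and each $M_i$ is a prime parking function of length $|L_i|$; columns with $L_i=\emptyset$ are empty. With $\|L\|=|L|$ for $L\neq\emptyset$ and $\|\emptyset\|=1$, the bijection $\Phi:\mathrm{BW}\to$ words sends $m$ to the word $w$ with $w_p=(t\text{ -th letter of }M_j)+\sum_{q<j}\|L_q\|$ whenever $p$ is the $t$-th smallest element of $L_j$; words are identified with elements of $\mathrm{BW}$ via $\Phi$. For $r\in(\mathbb{N}\setminus\{0\})\cup\{\infty\}$, the $r$-parking quasi-symmetrizing action of $\mathfrak{S}_\infty=\langle s_i=(i,i+1)\rangle$ on $\mathrm{BW}$ (hence on words, extended linearly): $s_i$ swaps the $i$-th and $(i+1)$-st columns if one of them has words of length strictly smaller than $r$, and does nothing otherwise. $\mathbf{PQSym}^{*r}$ is the subspace of elements of $\mathbf{PQSym}^*$ invariant under the $r$-action. -}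

module Defs where

open import Level using (Level; _⊔_) renaming (suc to lsuc)
open import Data.Bool using (Bool; true; false; _∧_; _∨_; not; if_then_else_; T)
open import Data.Nat using (ℕ; zero; suc; _∸_; _≤ᵇ_; _<ᵇ_; _≡ᵇ_; _≤_; NonZero)
open import Data.Nat.Properties using (≤-decTotalOrder)
import Data.Nat as ℕ
open import Data.List using (List; []; _∷_; _++_; map; concat; concatMap; filterᵇ; length; foldr; take; drop; upTo; applyUpTo; zip; cartesianProduct; null)
open import Data.List.Properties using (≡-dec)
open import Data.List.Relation.Unary.All using (All)
open import Data.List.Relation.Unary.Linked using (Linked)
open import Data.List.Relation.Binary.Permutation.Propositional using (_↭_)
open import Data.Product using (Σ; ∃; ∃₂; _×_; _,_; proj₁; proj₂; swap)
open import Relation.Nullary using (¬_; does)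
open import Algebra.Bundles using (CommutativeRing)
import Data.List.Sort.MergeSort.Base as Sort
open import Data.Nat.ListAction using (sum)

natK : ∀ {c ℓ} (R : CommutativeRing c ℓ) → ℕ → CommutativeRing.Carrier R
natK R zero    = CommutativeRing.0# R
natK R (suc n) = CommutativeRing._+_ R (CommutativeRing.1# R) (natK R n)

record Field (c ℓ : Level) : Set (lsuc (c ⊔ ℓ)) where
  field
    commutativeRing : CommutativeRing c ℓ
  open CommutativeRing commutativeRing public
  field
    1≉0     : ¬ (1# ≈ 0#)
    inverse : ∀ x → ¬ (x ≈ 0#) → ∃ λ y → (x * y) ≈ 1#
    char0   : ∀ n → ¬ (natK commutativeRing (suc n) ≈ 0#)

-- words on ℕ∖{0}: lists of naturals (positivity imposed where needed)
Word : Set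
Word = List ℕ

_==_ : Word → Word → Bool
u == v = does (≡-dec ℕ._≟_ u v)

sortW : Word → Word
sortW = Sort.sort ≤-decTotalOrder

allPos : Word → Bool
allPos []       = true
allPos (x ∷ xs) = (1 ≤ᵇ x) ∧ allPos xs

pfCheck : ℕ → Word → Bool
pfCheck i []       = true
pfCheck i (x ∷ xs) = (x ≤ᵇ i) ∧ pfCheck (suc i) xs

primeCheck : ℕ → Word → Bool
primeCheck i []       = true
primeCheck i (x ∷ xs) = (if i ≡ᵇ 1 then x ≤ᵇ 1 else x <ᵇ i) ∧ primeCheck (suc i) xs

isPF : Word → Bool
isPF u = allPos u ∧ pfCheck 1 (sortW u)

isPrimePF : Word → Bool
isPrimePF u = isPF u ∧ primeCheck 1 (sortW u)

IsPF : Word → Set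
IsPF u = T (isPF u)

IsPrimePF : Word → Set
IsPrimePF u = T (isPrimePF u)

countLe : ℕ → Word → ℕ
countLe i w = length (filterᵇ (λ a → a ≤ᵇ i) w)

dSearch : ℕ → ℕ → Word → ℕ
dSearch zero       i w = i
dSearch (suc fuel) i w = if countLe i w <ᵇ i then i else dSearch fuel (suc i) w

-- d(w) = min { i ≥ 1 : #{j : w_j ≤ i} < i }  (always ≤ n+1)
dPark : Word → ℕ
dPark w = dSearch (suc (length w)) 1 w

-- Park with fuel (the sum of letters strictly decreases at each step)
parkFuel : ℕ → Word → Word
parkFuel zero       w = w
parkFuel (suc fuel) w with dPark w ≡ᵇ suc (length w)
... | true  = w
... | false = parkFuel fuel (map (λ a → if dPark w <ᵇ a then a ∸ 1 else a) w)

Park : Word → Word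
Park w = parkFuel (suc (sum w)) w

wordsOver : ℕ → ℕ → List Word
wordsOver zero    k = [] ∷ []
wordsOver (suc n) k = concatMap (λ a → map (a ∷_) (wordsOver n k)) (applyUpTo suc k)

pfs : ℕ → List Word
pfs n = filterᵇ isPF (wordsOver n n)

isShuffle : Word → Word → Word → Bool
isShuffle []      a       b       = null a ∧ null b
isShuffle (z ∷ u) []      b       = (z ∷ u) == b
isShuffle (z ∷ u) (x ∷ a) []      = (z ∷ u) == (x ∷ a)
isShuffle (z ∷ u) (x ∷ a) (y ∷ b) =
  ((x ℕ.≡ᵇ z) ∧ isShuffle u a (y ∷ b)) ∨ ((y ℕ.≡ᵇ z) ∧ isShuffle u (x ∷ a) b)

shift : ℕ → Word → Word
shift k = map (k ℕ.+_)

-- a column (L , M): L a finite set of positive integers listed increasingly,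
-- M a word.  An element of BW is a finite list of columns, all further
-- columns being empty (L = ∅, M = ε).
Column : Set
Column = List ℕ × Word

emptyCol : Column
emptyCol = [] , []

cnorm : List ℕ → ℕ
cnorm []      = 1
cnorm (x ∷ L) = suc (length L)

ValidColumn : Column → Set
ValidColumn (L , M) = Linked ℕ._<_ L × All (λ p → 1 ≤ p) L × IsPrimePF M × length M ≡' length L
  where open import Relation.Binary.PropositionalEquality renaming (_≡_ to _≡'_)

-- the nonempty L_i, in order, form a set composition of [n] (n = length)
ValidBW : List Column → Set
ValidBW m = All ValidColumn m
          × concatMap proj₁ m ↭ applyUpTo suc (length (concatMap proj₁ m))

-- pairs (p , w_p) contributed by the columns, with running offset Σ_{q<j} ‖L_q‖
assoc : ℕ → List Column → List (ℕ × ℕ)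
assoc off []             = []
assoc off ((L , M) ∷ m)  = zip L (shift off M) ++ assoc (off ℕ.+ cnorm L) m

lookupAssoc : ℕ → List (ℕ × ℕ) → ℕ
lookupAssoc p []              = 0
lookupAssoc p ((q , v) ∷ xs)  = if p ℕ.≡ᵇ q then v else lookupAssoc p xs

Φ : List Column → Word
Φ m = map (λ p → lookupAssoc p (assoc 0 m)) (applyUpTo suc (length (concatMap proj₁ m)))

data Rank : Set where
  fin : (r : ℕ) → .{{NonZero r}} → Rank
  ∞   : Rank

short : Rank → Word → Bool
short (fin r) M = length M <ᵇ r
short ∞       M = true

colAt : List Column → ℕ → Column
colAt []      i       = emptyCol
colAt (c ∷ m) zero    = c
colAt (c ∷ m) (suc i) = colAt m i

-- swap the columns at (0-based) positions i and i+1, padding with empty columns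
swapCols : ℕ → List Column → List Column
swapCols i m = applyUpTo f (suc (suc i) ℕ.⊔ length m)
  where
  f : ℕ → Column
  f j = if j ℕ.≡ᵇ i then colAt m (suc i)
        else if j ℕ.≡ᵇ suc i then colAt m i
        else colAt m j

-- act r i m = s_{i+1} · m   (i.e. the generator s_{i+1} = (i+1, i+2) of 𝔖_∞)
act : Rank → ℕ → List Column → List Column
act r i m = if short r (proj₂ (colAt m i)) ∨ short r (proj₂ (colAt m (suc i)))
            then swapCols i m else m

module PQ {c ℓ} (F : Field c ℓ) where
  open Field F

  -- finite formal linear combinations Σ c_u G_u
  Elem : Set c
  Elem = List (Carrier × Word)

  InPQ : Elem → Set c
  InPQ x = All (λ e → IsPF (proj₂ e)) x

  sumK : List Carrier → Carrier
  sumK = foldr _+_ 0#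

  coeff : Elem → Word → Carrier
  coeff x u = sumK (map (λ e → if proj₂ e == u then proj₁ e else 0#) x)

  _≋_ : Elem → Elem → Set ℓ
  x ≋ y = ∀ u → coeff x u ≈ coeff y u

  scale : Carrier → Elem → Elem
  scale a = map (λ e → (a * proj₁ e , proj₂ e))

  unitE : Elem
  unitE = (1# , []) ∷ []

  prodBasis : Word → Word → List Word
  prodBasis u v = filterᵇ (λ w → (Park (take (length u) w) == u) ∧ (Park (drop (length u) w) == v))
                          (pfs (length u ℕ.+ length v))

  _⋆_ : Elem → Elem → Elem
  x ⋆ y = concatMap (λ e → concatMap (λ f →
            map (λ w → (proj₁ e * proj₁ f , w)) (prodBasis (proj₂ e) (proj₂ f))) y) x

  -- tensors: Σ c_{a,b} G_a ⊗ G_b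
  Elem₂ : Set c
  Elem₂ = List (Carrier × Word × Word)

  coeff₂ : Elem₂ → Word → Word → Carrier
  coeff₂ t a b = sumK (map (λ e → if (proj₁ (proj₂ e) == a) ∧ (proj₂ (proj₂ e) == b)
                                  then proj₁ e else 0#) t)

  _≋₂_ : Elem₂ → Elem₂ → Set ℓ
  s ≋₂ t = ∀ a b → coeff₂ s a b ≈ coeff₂ t a b

  _⊗_ : Elem → Elem → Elem₂
  x ⊗ y = concatMap (λ e → map (λ f → (proj₁ e * proj₁ f , proj₂ e , proj₂ f)) y) x

  flip₂ : Elem₂ → Elem₂
  flip₂ = map (λ e → (proj₁ e , swap (proj₂ e)))

  coprodPairs : Word → List (Word × Word)
  coprodPairs u = concatMap (λ k → filterᵇ (λ ab → isShuffle u (proj₁ ab) (shift k (proj₂ ab)))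
                                            (cartesianProduct (pfs k) (pfs (length u ∸ k))))
                            (upTo (suc (length u)))

  Δ : Elem → Elem₂
  Δ x = concatMap (λ e → map (λ ab → (proj₁ e , ab)) (coprodPairs (proj₂ e))) x

  -- antipode on the basis, by the recursion S(G_u) = - Σ_{(a,b), b ≠ ε} S(G_a) G_b
  antiFuel : ℕ → Word → Elem
  antiFuel _          []      = unitE
  antiFuel zero       (x ∷ u) = []
  antiFuel (suc fuel) (x ∷ u) =
    map (λ e → (- proj₁ e , proj₂ e))
        (concatMap (λ ab → antiFuel fuel (proj₁ ab) ⋆ ((1# , proj₂ ab) ∷ []))
                   (filterᵇ (λ ab → not (null (proj₂ ab))) (coprodPairs (x ∷ u))))

  S : Elem → Elem
  S x = concatMap (λ e → scale (proj₁ e) (antiFuel (length (proj₂ e)) (proj₂ e))) x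

  homog : ℕ → Elem → Elem
  homog n = filterᵇ (λ e → length (proj₂ e) ℕ.≡ᵇ n)

  -- x = Σ c_u G_u = Σ_w c_{Park w} w is invariant under the r-action of every
  -- s_{i+1}; since Φ is a bijection BW → words we quantify over BW.
  Invariant : Rank → Elem → Set ℓ
  Invariant r x = ∀ (i : ℕ) (m : List Column) → ValidBW m →
                  coeff x (Park (Φ (act r i m))) ≈ coeff x (Park (Φ m))

  PQr : Rank → Elem → Set (c ⊔ ℓ)
  PQr r x = InPQ x × Invariant r x

  InTensor : (Elem → Set (c ⊔ ℓ)) → Elem₂ → Set (c ⊔ ℓ)
  InTensor P t = Σ (List (Elem × Elem)) λ ps →
                   All (λ p → P (proj₁ p) × P (proj₂ p)) ps
                 × t ≋₂ concatMap (λ p → proj₁ p ⊗ proj₂ p) ps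

  IsGradedHopfSubalgebra : (Elem → Set (c ⊔ ℓ)) → Set (c ⊔ ℓ)
  IsGradedHopfSubalgebra P =
      P []
    × (∀ x y → P x → P y → P (x ++ y))
    × (∀ a x → P x → P (scale a x))
    × (∀ n x → P x → P (homog n x))
    × P unitE
    × (∀ x y → P x → P y → P (x ⋆ y))
    × (∀ x → P x → InTensor P (Δ x))
    × (∀ x → P x → P (S x))

  NonCommutative : (Elem → Set (c ⊔ ℓ)) → Set (c ⊔ ℓ)
  NonCommutative P = ∃₂ λ x y → P x × P y × ¬ ((x ⋆ y) ≋ (y ⋆ x))

  NonCocommutative : (Elem → Set (c ⊔ ℓ)) → Set (c ⊔ ℓ)
  NonCocommutative P = ∃ λ x → P x × ¬ (Δ x ≋₂ flip₂ (Δ x))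

  Cocommutative : (Elem → Set (c ⊔ ℓ)) → Set (c ⊔ ℓ)
  Cocommutative P = ∀ x → P x → Δ x ≋₂ flip₂ (Δ x)

{-# OPTIONS --safe #-}
module Submission where

-- The columns of a parking function u are cut out by its breaks, the i such that exactly i letters
-- of u are ≤ i, so swapping neighbouring columns exchanges two adjacent intervals of values delimited
-- by breaks.  An element is therefore r-invariant iff its coefficients do not change when two such
-- intervals, one of them of length < r, are exchanged; the intervals need not be single columns.
-- In this form invariance passes to the structure maps:
--   * Parkization moves a letter by an amount depending only on the counts of smaller letters.  An
--     interval exchange on w induces one on Park v for every factor v of w, with intervals that are not
--     longer, and the coefficient of w in a product is the sum over the cuts w = v v′ of the products
--     of the coefficients of Park v and Park v′.
--   * The coefficient of G_a ⊗ G_b in Δ x is the sum of the coefficients of x over the shuffles of a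
--     and b shifted by |a|.  An exchange on a or on b extends to all these shuffles, so that this
--     coefficient is constant on classes in each variable and Δ x is a combination of tensors of
--     orbit sums.  For r = ∞ the exchange of the values of a and of b gives cocommutativity.
--   * The antipode follows by induction from its recursion.

open import Defs
open import Level using (Level)
open import Data.Bool using (Bool; true; false; _∧_; _∨_; not; if_then_else_; T)
open import Data.Bool.Properties using (T-≡; T-∧; T-∨; T?; ∧-comm)
open import Data.Nat using (ℕ; zero; suc; _+_; _∸_; _⊓_; _⊔_; _≤_; _<_; _≤ᵇ_; _<ᵇ_; _≡ᵇ_; z≤n; s≤s; NonZero; >-nonZero⁻¹; _≤?_; _<?_)
open import Data.Nat.Properties
open import Data.Nat.ListAction using (sum)
open import Data.List using (List; []; _∷_; _++_; map; length; filterᵇ; take; drop; zip; applyUpTo; upTo; concatMap; concat; replicate; cartesianProduct; deduplicate; null)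
open import Data.List.Properties using (≡-dec; ∷-injective; length-map; length-filter; length-++; length-take; length-drop; length-applyUpTo; length-replicate; map-cong-local; map-id-local; map-∘; map-++; map-replicate; ++-assoc; ++-identityʳ; concatMap-++; filter-all; take-map; drop-map; take++drop≡id)
open import Data.List.Relation.Unary.All as All using (All; []; _∷_)
import Data.List.Relation.Unary.All.Properties as Allₚ
open import Data.List.Relation.Unary.Any using (here; there)
open import Data.List.Relation.Unary.Linked as Linked using (Linked; []; [-]; _∷_)
open import Data.List.Relation.Unary.Linked.Properties using () renaming (map⁺ to Linked-map⁺; filter⁺ to Linked-filter⁺; applyUpTo⁺₂ to Linked-applyUpTo⁺₂)
open import Data.List.Relation.Unary.Unique.Propositional using (Unique; []; _∷_)
import Data.List.Relation.Unary.Unique.Propositional.Properties as Uniqueₚ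
open import Data.List.Relation.Unary.Unique.DecPropositional.Properties using (deduplicate-!)
open import Data.List.Membership.Propositional using (_∈_; lose; find)
open import Data.List.Membership.Propositional.Properties using (∈-map⁺; ∈-map⁻; ∈-++⁺ˡ; ∈-++⁺ʳ; ∈-++⁻; ∈-concatMap⁺; ∈-concatMap⁻; ∈-applyUpTo⁺; ∈-upTo⁺; ∈-upTo⁻; ∈-filter⁺; ∈-filter⁻; ∈-deduplicate⁺; ∈-cartesianProduct⁺; ∈-cartesianProduct⁻)
open import Data.List.Membership.DecPropositional (≡-dec _≟_) using (_∈?_)
open import Data.List.Relation.Binary.Permutation.Propositional using (_↭_; ↭-sym; ↭-trans; ↭-reflexive; prep; swap; refl; trans; module PermutationReasoning)
open import Data.List.Relation.Binary.Permutation.Propositional.Properties using (↭-length; All-resp-↭; map⁺; ++⁺ˡ; ++⁺ʳ; ++⁺; ++-comm)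
open import Data.List.Sort.MergeSort.Properties ≤-decTotalOrder using (sort-↭; sort-↗)
open import Data.Product using (∃; _×_; _,_; proj₁; proj₂)
open import Data.Sum as Sum using (_⊎_; inj₁; inj₂)
open import Data.Empty using (⊥; ⊥-elim)
open import Data.Unit using (⊤; tt)
open import Function using (_∘_; Equivalence)
open import Relation.Nullary using (¬_; yes; no; Dec; contradiction)
open import Relation.Nullary.Decidable using (_×-dec_; _⊎-dec_; map′; dec-true; dec-false)
open import Relation.Binary.Bundles using (Setoid)
open import Relation.Binary.PropositionalEquality as ≡ using (_≡_; _≢_; refl; sym; cong; cong₂; subst; module ≡-Reasoning)
import Relation.Binary.Reasoning.Setoid as SetoidReasoning
import Algebra.Properties.CommutativeSemigroup as CommutativeSemigroupₚ
import Algebra.Properties.Ring as Ringₚ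
open CommutativeSemigroupₚ +-commutativeSemigroup using (interchange) renaming (xy∙z≈xz∙y to +-swap)

-- A factor of a parking function need not be a parking function, and neither need a word `Φ m`,
-- because of empty columns. Parkization shrinks such an interval to as many values as it holds
-- letters, which is why smallness is never lost. Intervals made of several columns cannot be
-- avoided: 112 is prime, but its factor 12 has two columns. A single basis element is rarely
-- invariant, so the induction for the antipode is run on its pairing with an arbitrary invariant
-- element, not on one word. For the coproduct explicit tensors have to be produced; as equality in
-- the field is not assumed decidable, the classes are computed from the words alone, up to a length
-- bound.

T⇒true : ∀ {b} → T b → b ≡ true
T⇒true = Equivalence.to T-≡

¬T⇒false : ∀ {b} → ¬ T b → b ≡ false
¬T⇒false {false} _ = refl
¬T⇒false {true}  h = ⊥-elim (h tt)

T-ext : ∀ {b c} → (T b → T c) → (T c → T b) → b ≡ c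
T-ext {false} {false} _ _ = refl
T-ext {false} {true}  _ g = ⊥-elim (g tt)
T-ext {true}  {false} f _ = ⊥-elim (f tt)
T-ext {true}  {true}  _ _ = refl

-- Counting letters in value intervals

-- The interval (o , o + t] is given by its start and its length, so that adjacent intervals are
-- joined by adding lengths and no subtraction occurs.
inInterval : ℕ → ℕ → ℕ → Bool
inInterval o t a = (o <ᵇ a) ∧ (a ≤ᵇ o + t)

InInterval : ℕ → ℕ → ℕ → Set
InInterval o t a = o < a × a ≤ o + t

inInterval-to : ∀ {o t a} → T (inInterval o t a) → InInterval o t a
inInterval-to {o} {t} {a} h with Equivalence.to T-∧ h
... | h₁ , h₂ = <ᵇ⇒< o a h₁ , ≤ᵇ⇒≤ a (o + t) h₂

inInterval-from : ∀ {o t a} → InInterval o t a → T (inInterval o t a)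
inInterval-from (h₁ , h₂) = Equivalence.from T-∧ (<⇒<ᵇ h₁ , ≤⇒≤ᵇ h₂)

inInterval-cong : ∀ {o t a o′ t′ a′} →
  (InInterval o t a → InInterval o′ t′ a′) → (InInterval o′ t′ a′ → InInterval o t a) →
  inInterval o t a ≡ inInterval o′ t′ a′
inInterval-cong f g = T-ext (inInterval-from ∘ f ∘ inInterval-to) (inInterval-from ∘ g ∘ inInterval-to)

bit : Bool → ℕ
bit true  = 1
bit false = 0

cnt : ℕ → ℕ → Word → ℕ
cnt o t []      = 0
cnt o t (a ∷ v) = bit (inInterval o t a) + cnt o t v

-- Isolated for a single letter because it serves twice: summed up it gives `cnt-split`, and in
-- `filter-split` it excludes the impossible combinations of tests.
bit-split : ∀ o s t a → bit (inInterval o (s + t) a) ≡ bit (inInterval o s a) + bit (inInterval (o + s) t a)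
bit-split o s t a with o <? a | a ≤? o + s
... | no o≮a | _
  rewrite ¬T⇒false {inInterval o (s + t) a} (o≮a ∘ proj₁ ∘ inInterval-to)
        | ¬T⇒false {inInterval o s a} (o≮a ∘ proj₁ ∘ inInterval-to)
        | ¬T⇒false {inInterval (o + s) t a} (λ h → o≮a (≤-<-trans (m≤m+n o s) (proj₁ (inInterval-to {o + s} {t} h)))) = refl
... | yes o<a | yes a≤
  rewrite T⇒true {inInterval o (s + t) a} (inInterval-from (o<a , ≤-trans a≤ (+-monoʳ-≤ o (m≤m+n s t))))
        | T⇒true {inInterval o s a} (inInterval-from (o<a , a≤))
        | ¬T⇒false {inInterval (o + s) t a} (λ h → <⇒≱ (proj₁ (inInterval-to {o + s} {t} h)) a≤) = refl
... | yes o<a | no a≰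
  rewrite ¬T⇒false {inInterval o s a} (a≰ ∘ proj₂ ∘ inInterval-to {o})
        | inInterval-cong {o} {s + t} {a} {o + s} {t} {a}
            (λ (_ , q) → ≰⇒> a≰ , subst (a ≤_) (sym (+-assoc o s t)) q)
            (λ (_ , q) → o<a , subst (a ≤_) (+-assoc o s t) q) = refl

cnt-split : ∀ o s t v → cnt o (s + t) v ≡ cnt o s v + cnt (o + s) t v
cnt-split o s t []      = refl
cnt-split o s t (a ∷ v) = begin
  bit (inInterval o (s + t) a) + cnt o (s + t) v
    ≡⟨ cong₂ _+_ (bit-split o s t a) (cnt-split o s t v) ⟩
  (bit (inInterval o s a) + bit (inInterval (o + s) t a)) + (cnt o s v + cnt (o + s) t v)
    ≡⟨ interchange (bit (inInterval o s a)) _ (cnt o s v) _ ⟩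
  cnt o s (a ∷ v) + cnt (o + s) t (a ∷ v) ∎
  where open ≡-Reasoning

cnt-mono : ∀ o {s t} v → s ≤ t → cnt o s v ≤ cnt o t v
cnt-mono o {s} {t} v s≤t = begin
  cnt o s v  ≤⟨ m≤m+n _ _ ⟩
  cnt o s v + cnt (o + s) (t ∸ s) v  ≡⟨ cnt-split o s (t ∸ s) v ⟨
  cnt o (s + (t ∸ s)) v  ≡⟨ cong (λ z → cnt o z v) (m+[n∸m]≡n s≤t) ⟩
  cnt o t v  ∎
  where open ≤-Reasoning

cnt-++ : ∀ o t v v′ → cnt o t (v ++ v′) ≡ cnt o t v + cnt o t v′
cnt-++ o t []      v′ = refl
cnt-++ o t (a ∷ v) v′ = ≡.trans (cong (bit (inInterval o t a) +_) (cnt-++ o t v v′))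
                                (sym (+-assoc (bit (inInterval o t a)) _ _))

cnt-↭ : ∀ o t {v v′} → v ↭ v′ → cnt o t v ≡ cnt o t v′
cnt-↭ o t refl = refl
cnt-↭ o t (prep x p) = cong (bit (inInterval o t x) +_) (cnt-↭ o t p)
cnt-↭ o t (swap {xs} {ys} x y p) = begin
  i + (j + cnt o t xs) ≡⟨ cong (λ z → i + (j + z)) (cnt-↭ o t p) ⟩
  i + (j + cnt o t ys) ≡⟨ sym (+-assoc i j _) ⟩
  i + j + cnt o t ys  ≡⟨ cong (_+ cnt o t ys) (+-comm i j) ⟩
  j + i + cnt o t ys  ≡⟨ +-assoc j i _ ⟩
  j + (i + cnt o t ys) ∎
  where
  open ≡-Reasoning
  i = bit (inInterval o t x)
  j = bit (inInterval o t y)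
cnt-↭ o t (trans p q) = ≡.trans (cnt-↭ o t p) (cnt-↭ o t q)

bit≤1 : ∀ b → bit b ≤ 1
bit≤1 true  = ≤-refl
bit≤1 false = z≤n

cnt≤length : ∀ o t v → cnt o t v ≤ length v
cnt≤length o t []      = z≤n
cnt≤length o t (a ∷ v) = +-mono-≤ (bit≤1 (inInterval o t a)) (cnt≤length o t v)

cnt-zero : ∀ o v → cnt o 0 v ≡ 0
cnt-zero o []      = refl
cnt-zero o (a ∷ v)
  rewrite ¬T⇒false {inInterval o 0 a} (λ h → let (p , q) = inInterval-to {o} {0} h in <⇒≱ p (subst (a ≤_) (+-identityʳ o) q)) = cnt-zero o v

cnt-∈ : ∀ {o t a v} → a ∈ v → InInterval o t a → 1 ≤ cnt o t v
cnt-∈ {o} {t} {v = a ∷ v} (here refl) h rewrite T⇒true (inInterval-from {o} {t} h) = s≤s z≤n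
cnt-∈ {o} {t} {v = b ∷ v} (there p) h = ≤-trans (cnt-∈ p h) (m≤n+m _ (bit (inInterval o t b)))

cnt-all : ∀ {o t} v → All (InInterval o t) v → cnt o t v ≡ length v
cnt-all [] [] = refl
cnt-all {o} {t} (a ∷ v) (h ∷ hs) rewrite T⇒true (inInterval-from {o} {t} h) = cong suc (cnt-all v hs)

cnt-full : ∀ {o t} v → cnt o t v ≡ length v → All (InInterval o t) v
cnt-full [] _ = []
cnt-full {o} {t} (a ∷ v) e with inInterval o t a in eq
... | true  = inInterval-to {o} {t} (subst T (sym eq) tt) ∷ cnt-full v (suc-injective e)
... | false = contradiction (cnt≤length o t v) (<⇒≱ (≤-reflexive (sym e)))

cnt-none : ∀ {o t} v → All (¬_ ∘ InInterval o t) v → cnt o t v ≡ 0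
cnt-none [] [] = refl
cnt-none {o} {t} (a ∷ v) (h ∷ hs) rewrite ¬T⇒false {inInterval o t a} (h ∘ inInterval-to) = cnt-none v hs

cnt-map : ∀ {o t o′ t′} (g : ℕ → ℕ) v →
  All (λ a → inInterval o t a ≡ inInterval o′ t′ (g a)) v → cnt o′ t′ (map g v) ≡ cnt o t v
cnt-map g []      []       = refl
cnt-map g (a ∷ v) (h ∷ hs) = cong₂ _+_ (cong bit (sym h)) (cnt-map g v hs)

Positive : Word → Set
Positive = All (1 ≤_)

-- Positivity matters here: `countLe` would count a letter 0, which lies outside (0 , i].
countLe-cnt : ∀ i v → Positive v → countLe i v ≡ cnt 0 i v
countLe-cnt i []          []      = refl
countLe-cnt i (suc a ∷ v) (_ ∷ h) with suc a ≤ᵇ i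
... | true  = cong suc (countLe-cnt i v h)
... | false = countLe-cnt i v h

-- Parking functions

-- The counting form of the definition. It does not mention the sorted word, so it is visibly stable
-- under rearrangement and can be compared with interval counts.
Parking : Word → Set
Parking u = Positive u × (∀ i → i ≤ length u → i ≤ cnt 0 i u)

allPos-to : ∀ v → T (allPos v) → Positive v
allPos-to []      _ = []
allPos-to (a ∷ v) h with Equivalence.to T-∧ h
... | p , q = ≤ᵇ⇒≤ 1 a p ∷ allPos-to v q

allPos-from : ∀ {v} → Positive v → T (allPos v)
allPos-from []       = tt
allPos-from (h ∷ hs) = Equivalence.from T-∧ (≤⇒≤ᵇ h , allPos-from hs)

All≤-sorted : ∀ {x xs} → Linked _≤_ (x ∷ xs) → All (x ≤_) xs
All≤-sorted [-]      = []
All≤-sorted (h ∷ hs) = h ∷ All.map (≤-trans h) (All≤-sorted hs)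

cnt-∷-≤ : ∀ {x i} xs → 1 ≤ x → x ≤ i → cnt 0 i (x ∷ xs) ≡ suc (cnt 0 i xs)
cnt-∷-≤ xs 1≤x x≤i rewrite T⇒true (inInterval-from {0} (1≤x , x≤i)) = refl

cnt-big : ∀ {x i} xs → All (x ≤_) xs → i < x → cnt 0 i xs ≡ 0
cnt-big xs h i<x = cnt-none xs (All.map (λ x≤a (_ , a≤i) → <⇒≱ i<x (≤-trans x≤a a≤i)) h)

-- For a sorted word whose j-th letter is compared with k + j, the letterwise test is a bound on counts.
pfCheck-to : ∀ k w → Positive w → T (pfCheck (suc k) w) →
  ∀ i → i ≤ length w → i ≤ cnt 0 (k + i) w
pfCheck-to k w pos h zero i≤ = z≤n
pfCheck-to k (x ∷ w) (1≤x ∷ pos) h (suc i) (s≤s i≤) with Equivalence.to T-∧ h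
... | p , q = begin
  suc i  ≤⟨ s≤s (pfCheck-to (suc k) w pos q i i≤) ⟩
  suc (cnt 0 (suc k + i) w)  ≡⟨ cong (λ z → suc (cnt 0 z w)) (sym (+-suc k i)) ⟩
  suc (cnt 0 (k + suc i) w)  ≡⟨ sym (cnt-∷-≤ w 1≤x (≤-trans (≤ᵇ⇒≤ x (suc k) p) (subst (suc k ≤_) (sym (+-suc k i)) (s≤s (m≤m+n k i))))) ⟩
  cnt 0 (k + suc i) (x ∷ w)  ∎
  where open ≤-Reasoning

pfCheck-from : ∀ k w → Positive w → Linked _≤_ w →
  (∀ i → i ≤ length w → i ≤ cnt 0 (k + i) w) → T (pfCheck (suc k) w)
pfCheck-from k []      pos sorted h = tt
pfCheck-from k (x ∷ w) (1≤x ∷ pos) sorted h = Equivalence.from T-∧ (≤⇒≤ᵇ x≤ , rest)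
  where
  x≤ : x ≤ suc k
  x≤ with x ≤? suc k
  ... | yes p = p
  ... | no ¬p = contradiction (h 1 (s≤s z≤n))
    (<⇒≱ (s≤s (≤-reflexive (cnt-big (x ∷ w) (≤-refl ∷ All≤-sorted sorted) (subst (_< x) (+-comm 1 k) (≰⇒> ¬p))))))
  rest : T (pfCheck (suc (suc k)) w)
  rest = pfCheck-from (suc k) w pos (Linked.tail sorted) λ i i≤ → ≤-pred (begin
    suc i  ≤⟨ h (suc i) (s≤s i≤) ⟩
    cnt 0 (k + suc i) (x ∷ w) ≡⟨ cnt-∷-≤ w 1≤x (≤-trans x≤ (subst (suc k ≤_) (sym (+-suc k i)) (s≤s (m≤m+n k i)))) ⟩
    suc (cnt 0 (k + suc i) w) ≡⟨ cong (λ z → suc (cnt 0 z w)) (+-suc k i) ⟩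
    suc (cnt 0 (suc k + i) w) ∎)
    where open ≤-Reasoning

IsPF⇒Parking : ∀ u → IsPF u → Parking u
IsPF⇒Parking u h with Equivalence.to T-∧ h
... | p , q = pos , λ i i≤ →
  subst (i ≤_) (cnt-↭ 0 i s) (pfCheck-to 0 (sortW u) (All-resp-↭ (↭-sym s) pos) q i (subst (i ≤_) (sym (↭-length s)) i≤))
  where
  pos = allPos-to u p
  s = sort-↭ u

Parking⇒IsPF : ∀ u → Parking u → IsPF u
Parking⇒IsPF u (pos , h) = Equivalence.from T-∧ (allPos-from pos ,
  pfCheck-from 0 (sortW u) (All-resp-↭ (↭-sym s) pos) (sort-↗ u)
    (λ i i≤ → subst (i ≤_) (sym (cnt-↭ 0 i s)) (h i (subst (i ≤_) (↭-length s) i≤))))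
  where
  s = sort-↭ u

-- Here `w` is what remains of a sorted word after its first k + 1 letters. More than k + 1 + i
-- letters of the whole word are ≤ k + 1 + i, and taking away the k + 1 removed ones leaves at least
-- i + 1; this is the hypothesis.
primeCheck-from : ∀ k w → Positive w → Linked _≤_ w →
  (∀ i → i < length w → suc i ≤ cnt 0 (suc k + i) w) → T (primeCheck (suc (suc k)) w)
primeCheck-from k []      pos sorted h = tt
primeCheck-from k (x ∷ w) (1≤x ∷ pos) sorted h = Equivalence.from T-∧ (<⇒<ᵇ (s≤s x≤) , rest)
  where
  x≤ : x ≤ suc k
  x≤ with x ≤? suc k
  ... | yes p = p
  ... | no ¬p = contradiction (h 0 (s≤s z≤n))
    (<⇒≱ (s≤s (≤-reflexive (cnt-big (x ∷ w) (≤-refl ∷ All≤-sorted sorted) (subst (_< x) (sym (+-identityʳ (suc k))) (≰⇒> ¬p))))))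
  rest : T (primeCheck (suc (suc (suc k))) w)
  rest = primeCheck-from (suc k) w pos (Linked.tail sorted) λ i i≤ → ≤-pred (begin
    suc (suc i)  ≤⟨ h (suc i) (s≤s i≤) ⟩
    cnt 0 (suc k + suc i) (x ∷ w)  ≡⟨ cnt-∷-≤ w 1≤x (≤-trans x≤ (m≤m+n (suc k) (suc i))) ⟩
    suc (cnt 0 (suc k + suc i) w)  ≡⟨ cong (λ z → suc (cnt 0 z w)) (+-suc (suc k) i) ⟩
    suc (cnt 0 (suc (suc k) + i) w) ∎)
    where open ≤-Reasoning

-- For i ≥ 1 the condition on the letter at place i + 1 of the sorted word says that this letter is
-- ≤ i, hence that more than i letters are ≤ i. A prime parking function is thus one without a break
-- strictly between 0 and its length.
Parking⇒IsPrimePF : ∀ u → Parking u → (∀ i → 1 ≤ i → i < length u → i < cnt 0 i u) → IsPrimePF u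
Parking⇒IsPrimePF u pu@(pos , _) h = Equivalence.from T-∧ (Parking⇒IsPF u pu ,
  sorted-prime (sortW u) (All-resp-↭ (↭-sym s) pos) (sort-↗ u)
    (pfCheck-head (sortW u) (proj₂ (Equivalence.to (T-∧ {allPos u}) (Parking⇒IsPF u pu))))
    (λ i 1≤i i< → subst (i <_) (sym (cnt-↭ 0 i s)) (h i 1≤i (subst (i <_) (↭-length s) i<))))
  where
  s = sort-↭ u
  -- At place 1 the prime test is not strict and comes from the parking test; the later places come
  -- from the counts.
  pfCheck-head : ∀ w → T (pfCheck 1 w) → All (_≤ 1) (take 1 w)
  pfCheck-head []      _ = []
  pfCheck-head (x ∷ w) h = ≤ᵇ⇒≤ x 1 (proj₁ (Equivalence.to T-∧ h)) ∷ []
  sorted-prime : ∀ w → Positive w → Linked _≤_ w → All (_≤ 1) (take 1 w) →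
    (∀ i → 1 ≤ i → i < length w → i < cnt 0 i w) → T (primeCheck 1 w)
  sorted-prime [] _ _ _ _ = tt
  sorted-prime (x ∷ w) (1≤x ∷ pos) sorted (x≤1 ∷ []) h = Equivalence.from T-∧ (≤⇒≤ᵇ x≤1 ,
    primeCheck-from 0 w pos (Linked.tail sorted) λ i i< → ≤-pred
      (subst (suc (suc i) ≤_) (cnt-∷-≤ w 1≤x (≤-trans x≤1 (s≤s z≤n))) (h (suc i) (s≤s z≤n) (s≤s i<))))

IsPrimePF⇒Parking : ∀ u → IsPrimePF u → Parking u
IsPrimePF⇒Parking u h = IsPF⇒Parking u (proj₁ (Equivalence.to T-∧ h))

-- At i = n the parking bound is an equality, which leaves no letter above n.
Parking⇒≤length : ∀ {u} → Parking u → All (InInterval 0 (length u)) u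
Parking⇒≤length {u} (_ , h) = cnt-full u (≤-antisym (cnt≤length 0 _ u) (h _ ≤-refl))

-- The parkization as a letter map

-- parked g t = min (t , min over s ≤ t of g s + (t ∸ s)).  If g counts the letters of a word up to a
-- value, this is the value to which the parkization moves a letter t.
parked : (ℕ → ℕ) → ℕ → ℕ
parked g zero    = 0
parked g (suc t) = suc (parked g t) ⊓ g (suc t)

parked-cong : ∀ {g h} t → (∀ s → s ≤ t → g s ≡ h s) → parked g t ≡ parked h t
parked-cong zero    e = refl
parked-cong (suc t) e = cong₂ (λ x y → suc x ⊓ y) (parked-cong t (λ s s≤ → e s (m≤n⇒m≤1+n s≤))) (e (suc t) ≤-refl)

parked≤ : ∀ g t → parked g t ≤ g t
parked≤ g zero    = z≤n
parked≤ g (suc t) = m⊓n≤n _ _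

parked-full : ∀ g t → (∀ s → s ≤ t → s ≤ g s) → parked g t ≡ t
parked-full g zero    h = refl
parked-full g (suc t) h rewrite parked-full g t (λ s s≤ → h s (m≤n⇒m≤1+n s≤)) = m≤n⇒m⊓n≡m (h (suc t) ≤-refl)

-- Since `g 0` is 0, the term s = 0 of the minimum is t itself, so a lower bound has to be tested
-- only on the terms `g s + u`. Writing `s + u ≡ t` avoids the difference t ∸ s.
parked-lower : ∀ {z} g t → g 0 ≡ 0 → (∀ s u → s + u ≡ t → z ≤ g s + u) → z ≤ parked g t
parked-lower {z} g zero g0 h = subst (z ≤_) (≡.trans (+-identityʳ (g 0)) g0) (h 0 0 refl)
parked-lower {z} g (suc t) g0 h = ⊓-glb
  (pred-bound⁻ (parked-lower g t g0 λ s u e → pred-bound s u (h s (suc u) (≡.trans (+-suc s u) (cong suc e)))))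
  (subst (z ≤_) (+-identityʳ _) (h (suc t) 0 (+-identityʳ (suc t))))
  where
  pred-bound : ∀ s u → z ≤ g s + suc u → z ∸ 1 ≤ g s + u
  pred-bound s u p = m≤n+o⇒m∸n≤o z 1 (subst (z ≤_) (+-suc (g s) u) p)
  pred-bound⁻ : ∀ {m} → z ∸ 1 ≤ m → z ≤ suc m
  pred-bound⁻ p = ≤-trans (m≤n+m∸n z 1) (s≤s p)

-- Once the recursion has reached its ceiling `g o`, it forgets how it got there: from then on it is
-- the recursion for the increments `h`, started anew at 0.
parked-split : ∀ g h o t → parked g o ≡ g o → (∀ s → g (o + s) ≡ g o + h s) →
  parked g (o + t) ≡ g o + parked h t
parked-split g h o zero    e split = ≡.trans (cong (parked g) (+-identityʳ o)) (≡.trans e (sym (+-identityʳ _)))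
parked-split g h o (suc t) e split = begin
  parked g (o + suc t)  ≡⟨ cong (parked g) (+-suc o t) ⟩
  suc (parked g (o + t)) ⊓ g (suc (o + t))  ≡⟨ cong₂ (λ x y → suc x ⊓ g y) (parked-split g h o t e split) (sym (+-suc o t)) ⟩
  suc (g o + parked h t) ⊓ g (o + suc t)  ≡⟨ cong₂ _⊓_ (sym (+-suc (g o) _)) (split (suc t)) ⟩
  (g o + suc (parked h t)) ⊓ (g o + h (suc t))  ≡⟨ sym (+-distribˡ-⊓ (g o) _ _) ⟩
  g o + parked h (suc t)  ∎
  where open ≡-Reasoning

-- The origin `o` allows the letters above `o` to be parked like a word of their own. Origin 0 is
-- the parkization itself, see `Park-letters`.
parkLetter : ℕ → Word → ℕ → ℕ
parkLetter o v = parked (λ s → cnt o s v)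

-- If the interval (o , o + l] is balanced, the parkization of the letters above o + l does not depend
-- on how those of the interval are distributed (parkLetter-split).
Balanced : Word → ℕ → ℕ → Set
Balanced v o l = ∀ s t → s + t ≡ l → cnt (o + s) t v ≤ t

-- Balance says that no final part (o + s , o + l] holds more letters than values. In the minimum
-- that defines `parked` the term s = l is therefore the least.
parkLetter-balanced : ∀ {v o l} → Balanced v o l → parkLetter o v l ≡ cnt o l v
parkLetter-balanced {v} {o} {l} b = ≤-antisym (parked≤ _ l) (parked-lower _ l (cnt-zero o v)
  λ { s u refl → subst (_≤ cnt o s v + u) (sym (cnt-split o s u v)) (+-monoʳ-≤ (cnt o s v) (b s u refl)) })

parkLetter-split : ∀ v q o t → Balanced v q o → parkLetter q v (o + t) ≡ cnt q o v + parkLetter (q + o) v t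
parkLetter-split v q o t b =
  parked-split _ _ o t (parkLetter-balanced {v} {q} {o} b) (λ s → cnt-split q o s v)

parkLetter-≤ : ∀ {v o t l} → t ≤ l → parkLetter o v t ≤ cnt o l v
parkLetter-≤ {v} {o} {t} t≤l = ≤-trans (parked≤ _ t) (cnt-mono o v t≤l)

-- A letter that occurs is counted itself, so parking cannot push it back into the preceding
-- interval.
parkLetter-≥1 : ∀ {v o t} → o + suc t ∈ v → 1 ≤ parkLetter o v (suc t)
parkLetter-≥1 {v} {o} {t} h = ⊓-glb (s≤s z≤n)
  (cnt-∈ h (subst (o <_) (sym (+-suc o t)) (s≤s (m≤m+n o t)) , ≤-refl))

-- Agreement of the recursive parkization with the letter map

module DSearch (w : Word) where

  record Spec (i d : ℕ) : Set where
    field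
      lower   : i ≤ d
      upper   : d ≤ suc (length w)
      below   : ∀ j → i ≤ j → j < d → j ≤ countLe j w
      deficit : countLe d w < d

  dSearch-spec : ∀ fuel i → fuel + i ≡ suc (length w) → Spec i (dSearch (suc fuel) i w)
  dSearch-spec fuel i e with countLe i w <ᵇ i in eq
  ... | true = record
    { lower = ≤-refl ; upper = subst (i ≤_) e (m≤n+m i fuel)
    ; below = λ j i≤j j<i → contradiction i≤j (<⇒≱ j<i)
    ; deficit = <ᵇ⇒< _ _ (subst T (sym eq) tt) }
  dSearch-spec fuel i e | false with ≮⇒≥ {countLe i w} {i} (λ lt → subst T eq (<⇒<ᵇ lt)) | fuel
  -- With the fuel used up, i is n + 1, and a word of length n cannot have n + 1 letters: the search
  -- has stopped before.
  ... | i≤ | zero = contradiction (length-filter _ w) (<⇒≱ (≤-trans (≤-reflexive (sym e)) i≤))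
  ... | i≤ | suc fuel′ = record
    { lower = <⇒≤ (Spec.lower rec) ; upper = Spec.upper rec ; below = below ; deficit = Spec.deficit rec }
    where
    rec : Spec (suc i) (dSearch (suc fuel′) (suc i) w)
    rec = dSearch-spec fuel′ (suc i) (≡.trans (+-suc fuel′ i) e)
    below : ∀ j → i ≤ j → j < dSearch (suc fuel′) (suc i) w → j ≤ countLe j w
    below j i≤j j<d with m≤n⇒m<n∨m≡n i≤j
    ... | inj₁ i<j  = Spec.below rec j i<j j<d
    ... | inj₂ refl = i≤

  dPark-spec : Spec 1 (dPark w)
  dPark-spec = dSearch-spec (length w) 1 (+-comm (length w) 1)

-- One step of the parkization, with d(w) = e + 1. The two bounds force exactly e letters ≤ e and no
-- letter e + 1, so `dec` closes an empty slot.
module ParkStep (w : Word) (pos : Positive w) (e : ℕ)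
  (below : ∀ j → j ≤ e → j ≤ cnt 0 j w) (deficit : cnt 0 (suc e) w ≤ e) where

  dec : ℕ → ℕ
  dec a = if suc e <ᵇ a then a ∸ 1 else a

  dec-> : ∀ {a} → e < a → dec (suc a) ≡ a
  dec-> {a} h rewrite T⇒true (<⇒<ᵇ (s≤s h)) = refl

  dec-≤ : ∀ {a} → a ≤ suc e → dec a ≡ a
  dec-≤ {a} h rewrite ¬T⇒false {suc e <ᵇ a} (λ p → <⇒≱ (<ᵇ⇒< _ _ p) h) = refl

  w′ : Word
  w′ = map dec w

  count-e : cnt 0 e w ≡ e
  count-e = ≤-antisym (≤-trans (cnt-mono 0 w (n≤1+n e)) deficit) (below e ≤-refl)

  empty-slot : cnt e 1 w ≡ 0
  empty-slot = n≤0⇒n≡0 (+-cancelˡ-≤ e _ 0 (begin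
    e + cnt e 1 w  ≡⟨ cong (_+ cnt e 1 w) (sym count-e) ⟩
    cnt 0 e w + cnt e 1 w  ≡⟨ sym (cnt-split 0 e 1 w) ⟩
    cnt 0 (e + 1) w  ≡⟨ cong (λ z → cnt 0 z w) (+-comm e 1) ⟩
    cnt 0 (suc e) w  ≤⟨ deficit ⟩
    e  ≡⟨ sym (+-identityʳ e) ⟩
    e + 0  ∎))
    where open ≤-Reasoning

  letter-cases : ∀ {a} → a ∈ w → a ≤ e ⊎ suc e < a
  letter-cases {a} h with a ≤? e | suc e <? a
  ... | yes p | _     = inj₁ p
  ... | no _  | yes q = inj₂ q
  ... | no ¬p | no ¬q = contradiction
    (cnt-∈ h (≰⇒> ¬p , subst (a ≤_) (+-comm 1 e) (≮⇒≥ ¬q))) (<⇒≱ (s≤s (≤-reflexive empty-slot)))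

  cnt-low : ∀ s → s ≤ e → cnt 0 s w′ ≡ cnt 0 s w
  cnt-low s s≤e = cnt-map dec w (All.tabulate λ {a} h → go (letter-cases h))
    where
    go : ∀ {a} → a ≤ e ⊎ suc e < a → inInterval 0 s a ≡ inInterval 0 s (dec a)
    go {a} (inj₁ p) = cong (inInterval 0 s) (sym (dec-≤ (m≤n⇒m≤1+n p)))
    go {suc a} (inj₂ (s≤s q)) rewrite dec-> q = inInterval-cong {0} {s} {suc a}
      (λ (_ , r) → contradiction (≤-trans r s≤e) (<⇒≱ (m≤n⇒m≤1+n q)))
      (λ (_ , r) → contradiction (≤-trans r s≤e) (<⇒≱ q))

  -- The letters above the empty slot move down together with the origin from which they are
  -- counted.
  cnt-high : ∀ s → cnt e s w′ ≡ cnt (suc e) s w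
  cnt-high s = cnt-map dec w (All.tabulate λ {a} h → go (letter-cases h))
    where
    go : ∀ {a} → a ≤ e ⊎ suc e < a → inInterval (suc e) s a ≡ inInterval e s (dec a)
    go {a} (inj₁ p) rewrite dec-≤ (m≤n⇒m≤1+n p) = inInterval-cong
      (λ (r , _) → contradiction p (<⇒≱ (<⇒≤ r)))
      (λ (r , _) → contradiction p (<⇒≱ r))
    go {suc a} (inj₂ (s≤s q)) rewrite dec-> q = inInterval-cong
      (λ { (_ , s≤s r) → q , r }) (λ (_ , r) → s≤s q , s≤s r)

  -- At most s + t letters lie below the end and at least s of them are ≤ s, which leaves at most t
  -- for the final part. The case t = 0 is separate because fullness is assumed only below l.
  full⇒balanced : ∀ v l → cnt 0 l v ≤ l → (∀ j → j < l → j ≤ cnt 0 j v) → Balanced v 0 l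
  full⇒balanced v l hl h s t refl with t
  ... | zero  = ≤-reflexive (cnt-zero s v)
  ... | suc t′ = +-cancelˡ-≤ s _ _ (begin
    s + cnt s (suc t′) v  ≤⟨ +-monoˡ-≤ _ (h s (subst (s <_) (sym (+-suc s t′)) (s≤s (m≤m+n s t′)))) ⟩
    cnt 0 s v + cnt s (suc t′) v  ≡⟨ sym (cnt-split 0 s (suc t′) v) ⟩
    cnt 0 (s + suc t′) v  ≤⟨ hl ⟩
    s + suc t′  ∎)
    where open ≤-Reasoning

  -- The parked value of a letter is an invariant of the step. Up to e nothing changes. Beyond, (0 ,
  -- e + 1] is balanced in `w` and (0 , e] in `w′`, both hold e letters, and the later counts agree,
  -- so `parkLetter-split` gives the same value on both sides.
  step : ∀ {a} → a ∈ w → parkLetter 0 w′ (dec a) ≡ parkLetter 0 w a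
  step {a} h = go (letter-cases h)
    where
    open ≡-Reasoning
    bal : Balanced w 0 (suc e)
    bal = full⇒balanced w (suc e) (m≤n⇒m≤1+n deficit) (λ { j (s≤s j≤) → below j j≤ })
    bal′ : Balanced w′ 0 e
    bal′ = full⇒balanced w′ e (≤-reflexive (≡.trans (cnt-low e ≤-refl) count-e))
             (λ j j< → subst (j ≤_) (sym (cnt-low j (<⇒≤ j<))) (below j (<⇒≤ j<)))
    go : ∀ {a} → a ≤ e ⊎ suc e < a → parkLetter 0 w′ (dec a) ≡ parkLetter 0 w a
    go {a} (inj₁ p) = ≡.trans (cong (parkLetter 0 w′) (dec-≤ (m≤n⇒m≤1+n p)))
      (parked-cong a (λ s s≤ → cnt-low s (≤-trans s≤ p)))
    go {suc a} (inj₂ (s≤s q)) with m≤n⇒∃[o]m+o≡n q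
    ... | t , refl = begin
      parkLetter 0 w′ (dec (suc (suc e + t)))  ≡⟨ cong (parkLetter 0 w′) (≡.trans (dec-> (s≤s (m≤m+n e t))) (sym (+-suc e t))) ⟩
      parkLetter 0 w′ (e + suc t)  ≡⟨ parkLetter-split w′ 0 e (suc t) bal′ ⟩
      cnt 0 e w′ + parkLetter e w′ (suc t)  ≡⟨ cong₂ _+_ (≡.trans (cnt-low e ≤-refl) count-e) (parked-cong (suc t) (λ s _ → cnt-high s)) ⟩
      e + parkLetter (suc e) w (suc t)  ≡⟨ cong (_+ parkLetter (suc e) w (suc t)) (sym count-suc) ⟩
      cnt 0 (suc e) w + parkLetter (suc e) w (suc t)  ≡⟨ sym (parkLetter-split w 0 (suc e) (suc t) bal) ⟩
      parkLetter 0 w (suc e + suc t)  ≡⟨ cong (parkLetter 0 w ∘ suc) (+-suc e t) ⟩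
      parkLetter 0 w (suc (suc e + t))  ∎
      where
      count-suc : cnt 0 (suc e) w ≡ e
      count-suc = ≤-antisym deficit (≤-trans (below e ≤-refl) (cnt-mono 0 w (n≤1+n e)))

  positive′ : Positive w′
  positive′ = Allₚ.map⁺ (All.map go pos)
    where
    go : ∀ {a} → 1 ≤ a → 1 ≤ dec a
    go {a} h with suc e <? a
    ... | yes (s≤s p) rewrite dec-> p = ≤-trans (s≤s z≤n) p
    ... | no ¬p rewrite dec-≤ (≮⇒≥ ¬p) = h

  -- Each letter above e + 1 loses one; adding one for every letter ≤ e + 1 makes the total loss the
  -- length of the word, without subtraction. It yields the measure that bounds the number of steps.
  sum-step : cnt 0 (suc e) w + sum w ≡ sum w′ + length w
  sum-step = go w pos
    where
    open ≡-Reasoning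
    letter : ∀ {a} → 1 ≤ a → bit (inInterval 0 (suc e) a) + a ≡ dec a + 1
    letter {suc a} h with suc a ≤? suc e
    ... | yes p rewrite T⇒true (inInterval-from {0} {suc e} (h , p)) | dec-≤ p = +-comm 1 (suc a)
    ... | no ¬p with ≰⇒> ¬p
    ...   | s≤s q rewrite ¬T⇒false {inInterval 0 (suc e) (suc a)} (¬p ∘ proj₂ ∘ inInterval-to {0} {suc e}) | dec-> q = +-comm 1 a
    go : ∀ v → Positive v → cnt 0 (suc e) v + sum v ≡ sum (map dec v) + length v
    go [] [] = refl
    go (a ∷ v) (h ∷ hs) = begin
      (bit (inInterval 0 (suc e) a) + cnt 0 (suc e) v) + (a + sum v)
        ≡⟨ interchange (bit (inInterval 0 (suc e) a)) _ a _ ⟩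
      (bit (inInterval 0 (suc e) a) + a) + (cnt 0 (suc e) v + sum v)
        ≡⟨ cong₂ _+_ (letter h) (go v hs) ⟩
      (dec a + 1) + (sum (map dec v) + length v)
        ≡⟨ interchange (dec a) 1 (sum (map dec v)) (length v) ⟩
      (dec a + sum (map dec v)) + suc (length v) ∎

  sum-decreases : e < length w → sum w′ < sum w
  sum-decreases e<n = +-cancelʳ-< (length w) _ _ (begin-strict
    sum w′ + length w  ≡⟨ sym sum-step ⟩
    cnt 0 (suc e) w + sum w  <⟨ +-monoˡ-< (sum w) (≤-<-trans deficit e<n) ⟩
    length w + sum w  ≡⟨ +-comm (length w) (sum w) ⟩
    sum w + length w  ∎)
    where open ≤-Reasoning

map-parkLetter-Parking : ∀ {w} → Parking w → map (parkLetter 0 w) w ≡ w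
map-parkLetter-Parking {w} pw@(_ , h) = map-id-local (All.map
  (λ {a} (_ , a≤n) → parked-full _ a (λ s s≤ → h s (≤-trans s≤ a≤n))) (Parking⇒≤length pw))

-- Induction along the steps, the sum of the letters being the measure: `step` keeps every parked
-- value, and the recursion ends at a parking function, which the letter map fixes.
parkFuel-spec : ∀ fuel w → Positive w → sum w < fuel →
  parkFuel fuel w ≡ map (parkLetter 0 w) w × Parking (parkFuel fuel w)
parkFuel-spec (suc fuel) w pos (s≤s lt) with dPark w ≡ᵇ suc (length w) in eq
... | true = sym (map-parkLetter-Parking park-w) , park-w
  where
  open DSearch w
  d≡ : dPark w ≡ suc (length w)
  d≡ = ≡ᵇ⇒≡ _ _ (subst T (sym eq) tt)
  bound : ∀ i → i ≤ length w → i ≤ cnt 0 i w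
  bound zero    _  = z≤n
  bound (suc i) i≤ = subst (suc i ≤_) (countLe-cnt (suc i) w pos)
    (Spec.below dPark-spec (suc i) (s≤s z≤n) (subst (suc i <_) (sym d≡) (s≤s i≤)))
  park-w : Parking w
  park-w = pos , bound
... | false with dPark w | DSearch.dPark-spec w
...   | zero  | spec = contradiction (DSearch.Spec.lower spec) λ ()
...   | suc e | spec = ≡.trans (proj₁ rec) (≡.trans (sym (map-∘ w)) (map-cong-local (All.tabulate step))) , proj₂ rec
  where
  open DSearch w
  bound : ∀ j → j ≤ e → j ≤ cnt 0 j w
  bound zero    _  = z≤n
  bound (suc j) j≤ = subst (suc j ≤_) (countLe-cnt (suc j) w pos) (Spec.below spec (suc j) (s≤s z≤n) (s≤s j≤))
  open ParkStep w pos e bound (≤-pred (subst (_< suc e) (countLe-cnt (suc e) w pos) (Spec.deficit spec)))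
  e<n : e < length w
  e<n = ≤∧≢⇒< (≤-pred (Spec.upper spec)) (λ { refl → subst T eq (≡⇒≡ᵇ (length w) (length w) refl) })
  rec = parkFuel-spec fuel w′ positive′ (<-≤-trans (sum-decreases e<n) lt)

Park-letters : ∀ {w} → Positive w → Park w ≡ map (parkLetter 0 w) w
Park-letters {w} pos = proj₁ (parkFuel-spec (suc (sum w)) w pos ≤-refl)

Park-parking : ∀ {w} → Positive w → Parking (Park w)
Park-parking {w} pos = proj₂ (parkFuel-spec (suc (sum w)) w pos ≤-refl)

Park-id : ∀ {w} → Parking w → Park w ≡ w
Park-id pw = ≡.trans (Park-letters (proj₁ pw)) (map-parkLetter-Parking pw)

length-Park : ∀ {w} → Positive w → length (Park w) ≡ length w
length-Park {w} pos = ≡.trans (cong length (Park-letters pos)) (length-map _ w)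

-- Exchanging two adjacent value intervals

-- Exchanges the intervals (o , o + p] and (o + p , o + p + q], increasingly on each of them.
blockSwap : ℕ → ℕ → ℕ → ℕ → ℕ
blockSwap o p q a =
  if a ≤ᵇ o then a else
  if a ≤ᵇ o + p then a + q else
  if a ≤ᵇ o + p + q then a ∸ p else a

module _ (o p q : ℕ) where

  -- Letters are presented as a boundary plus `suc t`, which turns each branch of `blockSwap` into
  -- an addition.
  data Location : ℕ → Set where
    low    : ∀ {a} → a ≤ o → Location a
    inFirst  : ∀ t → suc t ≤ p → Location (o + suc t)
    inSecond : ∀ t → suc t ≤ q → Location (o + p + suc t)
    high   : ∀ t → Location (o + p + q + suc t)

  <⇒+suc : ∀ {m n} → m < n → ∃ λ t → n ≡ m + suc t
  <⇒+suc {m} h with m≤n⇒∃[o]m+o≡n h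
  ... | t , refl = t , sym (+-suc m t)

  locate : ∀ a → Location a
  locate a with a ≤? o
  ... | yes h = low h
  ... | no h₀ with a ≤? o + p
  ...   | yes h with <⇒+suc (≰⇒> h₀)
  ...     | t , refl = inFirst t (+-cancelˡ-≤ o _ _ h)
  locate a | no h₀ | no h₁ with a ≤? o + p + q
  ...     | yes h with <⇒+suc (≰⇒> h₁)
  ...       | t , refl = inSecond t (+-cancelˡ-≤ (o + p) _ _ h)
  locate a | no h₀ | no h₁ | no h₂ with <⇒+suc (≰⇒> h₂)
  ...       | t , refl = high t

blockSwap-low : ∀ o p q {a} → a ≤ o → blockSwap o p q a ≡ a
blockSwap-low o p q {a} h rewrite T⇒true (≤⇒≤ᵇ h) = refl

blockSwap-first : ∀ o p q {t} → suc t ≤ p → blockSwap o p q (o + suc t) ≡ o + q + suc t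
blockSwap-first o p q {t} h
  rewrite ¬T⇒false {o + suc t ≤ᵇ o} (m+1+n≰m o ∘ ≤ᵇ⇒≤ _ _)
        | T⇒true (≤⇒≤ᵇ (+-monoʳ-≤ o h))
  = ≡.trans (+-assoc o (suc t) q) (≡.trans (cong (o +_) (+-comm (suc t) q)) (sym (+-assoc o q (suc t))))

blockSwap-second : ∀ o p q {t} → suc t ≤ q → blockSwap o p q (o + p + suc t) ≡ o + suc t
blockSwap-second o p q {t} h
  rewrite ¬T⇒false {o + p + suc t ≤ᵇ o} (λ x → m+1+n≰m (o + p) (≤-trans (≤ᵇ⇒≤ _ _ x) (m≤m+n o p)))
        | ¬T⇒false {o + p + suc t ≤ᵇ o + p} (m+1+n≰m (o + p) ∘ ≤ᵇ⇒≤ _ _)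
        | T⇒true (≤⇒≤ᵇ (+-monoʳ-≤ (o + p) h))
  = ≡.trans (cong (_∸ p) (≡.trans (+-assoc o p (suc t)) (≡.trans (cong (o +_) (+-comm p (suc t))) (sym (+-assoc o (suc t) p)))))
            (m+n∸n≡m (o + suc t) p)

blockSwap-high : ∀ o p q {t} → blockSwap o p q (o + p + q + suc t) ≡ o + p + q + suc t
blockSwap-high o p q {t}
  rewrite ¬T⇒false {o + p + q + suc t ≤ᵇ o} (λ x → m+1+n≰m (o + p + q) (≤-trans (≤ᵇ⇒≤ _ _ x) (≤-trans (m≤m+n o p) (m≤m+n (o + p) q))))
        | ¬T⇒false {o + p + q + suc t ≤ᵇ o + p} (λ x → m+1+n≰m (o + p + q) (≤-trans (≤ᵇ⇒≤ _ _ x) (m≤m+n (o + p) q)))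
        | ¬T⇒false {o + p + q + suc t ≤ᵇ o + p + q} (m+1+n≰m (o + p + q) ∘ ≤ᵇ⇒≤ _ _) = refl

blockSwap-high′ : ∀ o p q {t} → blockSwap o p q (o + q + p + suc t) ≡ o + q + p + suc t
blockSwap-high′ o p q {t} = subst (λ z → blockSwap o p q (z + suc t) ≡ z + suc t) (+-swap o p q) (blockSwap-high o p q)

blockSwap-involutive : ∀ o p q a → blockSwap o q p (blockSwap o p q a) ≡ a
blockSwap-involutive o p q a with locate o p q a
... | low h      = ≡.trans (cong (blockSwap o q p) (blockSwap-low o p q h)) (blockSwap-low o q p h)
... | inFirst t h  = ≡.trans (cong (blockSwap o q p) (blockSwap-first o p q h)) (blockSwap-second o q p h)
... | inSecond t h = ≡.trans (cong (blockSwap o q p) (blockSwap-second o p q h)) (blockSwap-first o q p h)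
... | high t     = ≡.trans (cong (blockSwap o q p) (blockSwap-high o p q)) (blockSwap-high′ o q p)

blockSwap-≥1 : ∀ o p q {a} → 1 ≤ a → 1 ≤ blockSwap o p q a
blockSwap-≥1 o p q {a} h with locate o p q a
... | low h′      = subst (1 ≤_) (sym (blockSwap-low o p q h′)) h
... | inFirst t h′  = subst (1 ≤_) (sym (blockSwap-first o p q h′)) (≤-trans (s≤s z≤n) (m≤n+m (suc t) (o + q)))
... | inSecond t h′ = subst (1 ≤_) (sym (blockSwap-second o p q h′)) (≤-trans (s≤s z≤n) (m≤n+m (suc t) o))
... | high t      = subst (1 ≤_) (sym (blockSwap-high o p q)) h

module _ (o p q : ℕ) where

  interval-low : ∀ {s t a} → s + t ≤ o → InInterval s t a → InInterval s t (blockSwap o p q a)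
  interval-low b (h₁ , h₂) rewrite blockSwap-low o p q (≤-trans h₂ b) = h₁ , h₂

  interval-first : ∀ {s t a} → s + t ≤ p → InInterval (o + s) t a → InInterval (o + q + s) t (blockSwap o p q a)
  interval-first {s} {t} b (h₁ , h₂) with <⇒+suc o p q (≤-<-trans (m≤m+n o s) h₁)
  ... | x , refl = go (+-cancelˡ-< o s (suc x) h₁) (+-cancelˡ-≤ o _ _ (subst (o + suc x ≤_) (+-assoc o s t) h₂))
    where
    go : s < suc x → suc x ≤ s + t → InInterval (o + q + s) t (blockSwap o p q (o + suc x))
    go k₁ k₂ rewrite blockSwap-first o p q (≤-trans k₂ b)
      = +-monoʳ-< (o + q) k₁ , subst (o + q + suc x ≤_) (sym (+-assoc (o + q) s t)) (+-monoʳ-≤ (o + q) k₂)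

  interval-second : ∀ {s t a} → s + t ≤ q → InInterval (o + p + s) t a → InInterval (o + s) t (blockSwap o p q a)
  interval-second {s} {t} b (h₁ , h₂) with <⇒+suc o p q (≤-<-trans (m≤m+n (o + p) s) h₁)
  ... | x , refl = go (+-cancelˡ-< (o + p) s (suc x) h₁) (+-cancelˡ-≤ (o + p) _ _ (subst (o + p + suc x ≤_) (+-assoc (o + p) s t) h₂))
    where
    go : s < suc x → suc x ≤ s + t → InInterval (o + s) t (blockSwap o p q (o + p + suc x))
    go k₁ k₂ rewrite blockSwap-second o p q (≤-trans k₂ b)
      = +-monoʳ-< o k₁ , subst (o + suc x ≤_) (sym (+-assoc o s t)) (+-monoʳ-≤ o k₂)

  interval-high : ∀ {s t a} → InInterval (o + p + q + s) t a → InInterval (o + p + q + s) t (blockSwap o p q a)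
  interval-high {s} {t} (h₁ , h₂) with <⇒+suc o p q (≤-<-trans (m≤m+n (o + p + q) s) h₁)
  ... | x , refl rewrite blockSwap-high o p q {x} = h₁ , h₂

module _ (o p q : ℕ) (v : Word) where

  private
    σ = blockSwap o p q
    -- The inclusions above, applied to the inverse exchange as well, become the equivalences that
    -- `cnt-map` asks for.
    back : ∀ {s t a} → InInterval s t (blockSwap o q p (σ a)) → InInterval s t a
    back {s} {t} {a} = subst (InInterval s t) (blockSwap-involutive o p q a)

  cnt-swap-low : ∀ s t → s + t ≤ o → cnt s t (map σ v) ≡ cnt s t v
  cnt-swap-low s t b = cnt-map σ v (All.universal (λ a → inInterval-cong {s} {t} {a}
    (interval-low o p q b) (back {s} {t} {a} ∘ interval-low o q p b)) v)

  cnt-swap-first : ∀ s t → s + t ≤ p → cnt (o + q + s) t (map σ v) ≡ cnt (o + s) t v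
  cnt-swap-first s t b = cnt-map σ v (All.universal (λ a → inInterval-cong {o + s} {t} {a}
    (interval-first o p q {s} b) (back {o + s} {t} {a} ∘ interval-second o q p {s} b)) v)

  cnt-swap-second : ∀ s t → s + t ≤ q → cnt (o + s) t (map σ v) ≡ cnt (o + p + s) t v
  cnt-swap-second s t b = cnt-map σ v (All.universal (λ a → inInterval-cong {o + p + s} {t} {a}
    (interval-second o p q {s} b) (back {o + p + s} {t} {a} ∘ interval-first o q p {s} b)) v)

  cnt-swap-high : ∀ s t → cnt (o + p + q + s) t (map σ v) ≡ cnt (o + p + q + s) t v
  cnt-swap-high s t = cnt-map σ v (All.universal (λ a → inInterval-cong {o + p + q + s} {t} {a}
    (interval-high o p q {s}) (back {o + p + q + s} {t} {a} ∘ subst (λ z → InInterval (z + s) t (blockSwap o q p (σ a))) (+-swap o q p) ∘ interval-high o q p {s} ∘ subst (λ z → InInterval (z + s) t (σ a)) (+-swap o p q))) v)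

  cnt-swap-first₀ : ∀ t → t ≤ p → cnt (o + q) t (map σ v) ≡ cnt o t v
  cnt-swap-first₀ t b = subst (λ z → cnt (o + q) t (map σ v) ≡ cnt z t v) (+-identityʳ o)
    (subst (λ z → cnt z t (map σ v) ≡ cnt (o + 0) t v) (+-identityʳ (o + q)) (cnt-swap-first 0 t b))

  cnt-swap-second₀ : ∀ t → t ≤ q → cnt o t (map σ v) ≡ cnt (o + p) t v
  cnt-swap-second₀ t b = subst (λ z → cnt o t (map σ v) ≡ cnt z t v) (+-identityʳ (o + p))
    (subst (λ z → cnt z t (map σ v) ≡ cnt (o + p + 0) t v) (+-identityʳ o) (cnt-swap-second 0 t b))

  cnt-swap-high₀ : ∀ t → cnt (o + p + q) t (map σ v) ≡ cnt (o + p + q) t v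
  cnt-swap-high₀ t = subst (λ z → cnt z t (map σ v) ≡ cnt z t v) (+-identityʳ (o + p + q)) (cnt-swap-high 0 t)

  cnt-swap-to-mid : cnt 0 (o + q) (map σ v) ≡ cnt 0 o v + cnt (o + p) q v
  cnt-swap-to-mid = ≡.trans (cnt-split 0 o q (map σ v)) (cong₂ _+_ (cnt-swap-low 0 o ≤-refl) (cnt-swap-second₀ q ≤-refl))

  cnt-swap-to-end : cnt 0 (o + p + q) (map σ v) ≡ cnt 0 (o + p + q) v
  cnt-swap-to-end = begin
    cnt 0 (o + p + q) (map σ v)  ≡⟨ cong (λ z → cnt 0 z (map σ v)) (+-swap o p q) ⟩
    cnt 0 (o + q + p) (map σ v)  ≡⟨ cnt-split 0 (o + q) p (map σ v) ⟩
    cnt 0 (o + q) (map σ v) + cnt (o + q) p (map σ v) ≡⟨ cong₂ _+_ cnt-swap-to-mid (cnt-swap-first₀ p ≤-refl) ⟩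
    cnt 0 o v + cnt (o + p) q v + cnt o p v  ≡⟨ +-swap (cnt 0 o v) _ _ ⟩
    cnt 0 o v + cnt o p v + cnt (o + p) q v  ≡⟨ cong (_+ cnt (o + p) q v) (sym (cnt-split 0 o p v)) ⟩
    cnt 0 (o + p) v + cnt (o + p) q v  ≡⟨ sym (cnt-split 0 (o + p) q v) ⟩
    cnt 0 (o + p + q) v  ∎
    where open ≡-Reasoning

  Balanced-swap-low : Balanced v 0 o → Balanced (map σ v) 0 o
  Balanced-swap-low b s t e = subst (_≤ t) (sym (cnt-swap-low s t (≤-reflexive e))) (b s t e)

  Balanced-swap-first : Balanced v o p → Balanced (map σ v) (o + q) p
  Balanced-swap-first b s t e = subst (_≤ t) (sym (cnt-swap-first s t (≤-reflexive e))) (b s t e)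

  Balanced-swap-second : Balanced v (o + p) q → Balanced (map σ v) o q
  Balanced-swap-second b s t e = subst (_≤ t) (sym (cnt-swap-second s t (≤-reflexive e))) (b s t e)

-- A final part of the union lies in the second interval, or consists of the second interval and a
-- final part of the first.
Balanced-join : ∀ v o p q → Balanced v o p → Balanced v (o + p) q → Balanced v o (p + q)
Balanced-join v o p q b₁ b₂ s t e with ≤-total p s
... | inj₁ p≤s with m≤n⇒∃[o]m+o≡n p≤s
...   | s′ , refl = subst (λ z → cnt z t v ≤ t) (+-assoc o p s′)
        (b₂ s′ t (+-cancelˡ-≡ p _ _ (≡.trans (sym (+-assoc p s′ t)) e)))
Balanced-join v o p q b₁ b₂ s t e | inj₂ s≤p with m≤n⇒∃[o]m+o≡n s≤p
...   | s′ , refl = subst (λ z → cnt (o + s) z v ≤ z) (sym t≡) (subst (_≤ s′ + q) (sym (cnt-split (o + s) s′ q v))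
        (+-mono-≤ (b₁ s s′ refl)
          (subst (λ z → cnt z q v ≤ q) (≡.trans (+-identityʳ (o + (s + s′))) (sym (+-assoc o s s′))) (b₂ 0 q refl))))
  where
  t≡ : t ≡ s′ + q
  t≡ = +-cancelˡ-≡ s _ _ (≡.trans e (+-assoc s s′ q))

Balanced-++ˡ : ∀ {v} v′ o l → Balanced (v ++ v′) o l → Balanced v o l
Balanced-++ˡ {v} v′ o l b s t e = ≤-trans (m≤m+n _ _) (subst (_≤ t) (cnt-++ (o + s) t v v′) (b s t e))

Balanced-++ʳ : ∀ v {v′} o l → Balanced (v ++ v′) o l → Balanced v′ o l
Balanced-++ʳ v {v′} o l b s t e = ≤-trans (m≤n+m _ _) (subst (_≤ t) (cnt-++ (o + s) t v v′) (b s t e))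

Balanced-↭ : ∀ {v v′ o l} → v ↭ v′ → Balanced v o l → Balanced v′ o l
Balanced-↭ {v} {v′} {o} π b s t e = subst (_≤ t) (cnt-↭ (o + s) t π) (b s t e)

Positive-swap : ∀ o p q {v} → Positive v → Positive (map (blockSwap o p q) v)
Positive-swap o p q pos = Allₚ.map⁺ (All.map (blockSwap-≥1 o p q) pos)

-- The hypothesis common to the words `Φ m`, whose columns may be empty, and to the factors of
-- parking functions. In neither are the intervals necessarily full.
record ThreeBlocks (v : Word) (o p q : ℕ) : Set where
  field
    positive : Positive v
    before   : Balanced v 0 o
    first    : Balanced v o p
    second   : Balanced v (o + p) q

module _ {v o p q} (blocks : ThreeBlocks v o p q) where
  open ThreeBlocks blocks

  private
    σ  = blockSwap o p q
    v′ = map σ v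
    c₀ = cnt 0 o v
    c₁ = cnt o p v
    c₂ = cnt (o + p) q v
    upToFirst : Balanced v 0 (o + p)
    upToFirst = Balanced-join v 0 o p before first
    upToSecond : Balanced v 0 (o + p + q)
    upToSecond = Balanced-join v 0 (o + p) q upToFirst second
    upToSecond′ : Balanced v′ 0 (o + q)
    upToSecond′ = Balanced-join v′ 0 o q (Balanced-swap-low o p q v before) (Balanced-swap-second o p q v second)
    upToFirst′ : Balanced v′ 0 (o + p + q)
    upToFirst′ = subst (Balanced v′ 0) (+-swap o q p)
      (Balanced-join v′ 0 (o + q) p upToSecond′ (Balanced-swap-first o p q v first))
    count-2 : cnt 0 (o + p) v ≡ c₀ + c₁
    count-2 = cnt-split 0 o p v
    count-3 : cnt 0 (o + p + q) v ≡ c₀ + c₁ + c₂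
    count-3 = ≡.trans (cnt-split 0 (o + p) q v) (cong (_+ c₂) count-2)

  -- By `parkLetter-split` a parked value is the number of letters in the intervals before that of
  -- the letter plus a term depending only on counts inside its own interval. The exchange carries
  -- the inner counts along and permutes the interval totals, which are the lengths in the exchange
  -- on the right.
  parkLetter-swap : ∀ {a} → a ∈ v → parkLetter 0 v′ (σ a) ≡ blockSwap c₀ c₁ c₂ (parkLetter 0 v a)
  parkLetter-swap {a} a∈ with locate o p q a
  ... | low h = begin
    parkLetter 0 v′ (σ a)  ≡⟨ cong (parkLetter 0 v′) (blockSwap-low o p q h) ⟩
    parkLetter 0 v′ a  ≡⟨ parked-cong a (λ s s≤ → cnt-swap-low o p q v 0 s (≤-trans s≤ h)) ⟩
    parkLetter 0 v a  ≡⟨ sym (blockSwap-low c₀ c₁ c₂ (parkLetter-≤ {v} h)) ⟩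
    blockSwap c₀ c₁ c₂ (parkLetter 0 v a) ∎
    where open ≡-Reasoning
  ... | inFirst t h = begin
    parkLetter 0 v′ (σ (o + suc t))  ≡⟨ cong (parkLetter 0 v′) (blockSwap-first o p q h) ⟩
    parkLetter 0 v′ (o + q + suc t)  ≡⟨ parkLetter-split v′ 0 (o + q) (suc t) upToSecond′ ⟩
    cnt 0 (o + q) v′ + parkLetter (o + q) v′ (suc t)  ≡⟨ cong₂ _+_ (cnt-swap-to-mid o p q v) (parked-cong (suc t) (λ s s≤ → cnt-swap-first₀ o p q v s (≤-trans s≤ h))) ⟩
    c₀ + c₂ + parkLetter o v (suc t)  ≡⟨ swapped ⟩
    blockSwap c₀ c₁ c₂ (c₀ + parkLetter o v (suc t))  ≡⟨ cong (blockSwap c₀ c₁ c₂) (sym (parkLetter-split v 0 o (suc t) before)) ⟩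
    blockSwap c₀ c₁ c₂ (parkLetter 0 v (o + suc t))  ∎
    where
    open ≡-Reasoning
    -- The letter occurs, so its parked offset is a successor not exceeding `c₁`, as
    -- `blockSwap-first` requires.
    swapped : c₀ + c₂ + parkLetter o v (suc t) ≡ blockSwap c₀ c₁ c₂ (c₀ + parkLetter o v (suc t))
    swapped with parkLetter o v (suc t) | parkLetter-≥1 {v} {o} {t} a∈ | parkLetter-≤ {v} {o} h
    ... | suc x | _ | k = sym (blockSwap-first c₀ c₁ c₂ k)
  ... | inSecond t h = begin
    parkLetter 0 v′ (σ (o + p + suc t))  ≡⟨ cong (parkLetter 0 v′) (blockSwap-second o p q h) ⟩
    parkLetter 0 v′ (o + suc t)  ≡⟨ parkLetter-split v′ 0 o (suc t) (Balanced-swap-low o p q v before) ⟩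
    cnt 0 o v′ + parkLetter o v′ (suc t)  ≡⟨ cong₂ _+_ (cnt-swap-low o p q v 0 o ≤-refl) (parked-cong (suc t) (λ s s≤ → cnt-swap-second₀ o p q v s (≤-trans s≤ h))) ⟩
    c₀ + parkLetter (o + p) v (suc t)  ≡⟨ swapped ⟩
    blockSwap c₀ c₁ c₂ (c₀ + c₁ + parkLetter (o + p) v (suc t)) ≡⟨ cong (λ z → blockSwap c₀ c₁ c₂ (z + parkLetter (o + p) v (suc t))) (sym count-2) ⟩
    blockSwap c₀ c₁ c₂ (cnt 0 (o + p) v + parkLetter (o + p) v (suc t)) ≡⟨ cong (blockSwap c₀ c₁ c₂) (sym (parkLetter-split v 0 (o + p) (suc t) upToFirst)) ⟩
    blockSwap c₀ c₁ c₂ (parkLetter 0 v (o + p + suc t))  ∎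
    where
    open ≡-Reasoning
    swapped : c₀ + parkLetter (o + p) v (suc t) ≡ blockSwap c₀ c₁ c₂ (c₀ + c₁ + parkLetter (o + p) v (suc t))
    swapped with parkLetter (o + p) v (suc t) | parkLetter-≥1 {v} {o + p} {t} a∈ | parkLetter-≤ {v} {o + p} h
    ... | suc x | _ | k = sym (blockSwap-second c₀ c₁ c₂ k)
  ... | high t = begin
    parkLetter 0 v′ (σ (e + suc t))  ≡⟨ cong (parkLetter 0 v′) (blockSwap-high o p q) ⟩
    parkLetter 0 v′ (e + suc t)  ≡⟨ parkLetter-split v′ 0 e (suc t) upToFirst′ ⟩
    cnt 0 e v′ + parkLetter e v′ (suc t)  ≡⟨ cong₂ _+_ (≡.trans (cnt-swap-to-end o p q v) count-3) (parked-cong (suc t) (λ s s≤ → cnt-swap-high₀ o p q v s)) ⟩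
    c₀ + c₁ + c₂ + parkLetter e v (suc t)  ≡⟨ swapped ⟩
    blockSwap c₀ c₁ c₂ (c₀ + c₁ + c₂ + parkLetter e v (suc t)) ≡⟨ cong (λ z → blockSwap c₀ c₁ c₂ (z + parkLetter e v (suc t))) (sym count-3) ⟩
    blockSwap c₀ c₁ c₂ (cnt 0 e v + parkLetter e v (suc t)) ≡⟨ cong (blockSwap c₀ c₁ c₂) (sym (parkLetter-split v 0 e (suc t) upToSecond)) ⟩
    blockSwap c₀ c₁ c₂ (parkLetter 0 v (e + suc t))  ∎
    where
    open ≡-Reasoning
    e = o + p + q
    swapped : c₀ + c₁ + c₂ + parkLetter e v (suc t) ≡ blockSwap c₀ c₁ c₂ (c₀ + c₁ + c₂ + parkLetter e v (suc t))
    swapped with parkLetter e v (suc t) | parkLetter-≥1 {v} {e} {t} a∈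
    ... | suc x | _ = sym (blockSwap-high c₀ c₁ c₂)

  Park-swap : Park (map σ v) ≡ map (blockSwap c₀ c₁ c₂) (Park v)
  Park-swap = begin
    Park v′  ≡⟨ Park-letters (Positive-swap o p q positive) ⟩
    map (parkLetter 0 v′) v′  ≡⟨ sym (map-∘ v) ⟩
    map (parkLetter 0 v′ ∘ σ) v  ≡⟨ map-cong-local (All.tabulate parkLetter-swap) ⟩
    map (blockSwap c₀ c₁ c₂ ∘ parkLetter 0 v) v  ≡⟨ map-∘ v ⟩
    map (blockSwap c₀ c₁ c₂) (map (parkLetter 0 v) v)  ≡⟨ cong (map (blockSwap c₀ c₁ c₂)) (sym (Park-letters positive)) ⟩
    map (blockSwap c₀ c₁ c₂) (Park v)  ∎
    where open ≡-Reasoning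

-- Breaks and admissible exchanges

Break : Word → ℕ → Set
Break u i = cnt 0 i u ≡ i

-- Letters up to `o` park to at most `cnt 0 o v`, and by balance every letter above `o` parks
-- strictly beyond that value.
Park-break : ∀ {v o} → Positive v → Balanced v 0 o → Break (Park v) (cnt 0 o v)
Park-break {v} {o} pos b = ≡.trans (cong (cnt 0 (cnt 0 o v)) (Park-letters pos))
  (cnt-map (parkLetter 0 v) v (All.tabulate λ a∈ → inInterval-cong {0} {o} (to a∈) (from a∈)))
  where
  to : ∀ {a} → a ∈ v → InInterval 0 o a → InInterval 0 (cnt 0 o v) (parkLetter 0 v a)
  to {suc a} a∈ (_ , h) = parkLetter-≥1 {v} {0} {a} a∈ , parkLetter-≤ {v} {0} h
  from : ∀ {a} → a ∈ v → InInterval 0 (cnt 0 o v) (parkLetter 0 v a) → InInterval 0 o a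
  from {a} a∈ (_ , h) with a ≤? o
  ... | yes a≤o = All.lookup pos a∈ , a≤o
  ... | no a≰o with m≤n⇒∃[o]m+o≡n (≰⇒> a≰o)
  ...   | t , refl = contradiction
    (≤-trans (parkLetter-≥1 {v} {o} {t} (subst (_∈ v) (sym (+-suc o t)) a∈))
      (+-cancelˡ-≤ (cnt 0 o v) _ 0 (begin
        cnt 0 o v + parkLetter o v (suc t)  ≡⟨ sym (parkLetter-split v 0 o (suc t) b) ⟩
        parkLetter 0 v (o + suc t)  ≡⟨ cong (parkLetter 0 v) (+-suc o t) ⟩
        parkLetter 0 v (suc o + t)  ≤⟨ h ⟩
        cnt 0 o v  ≡⟨ sym (+-identityʳ _) ⟩
        cnt 0 o v + 0  ∎))) λ ()
    where open ≤-Reasoning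

-- Of the o + l letters up to the break at least o + s are ≤ o + s, which leaves at most t.
Parking⇒Balanced : ∀ {u} o l → Parking u → Break u (o + l) → Balanced u o l
Parking⇒Balanced {u} o l (_ , h) e s t refl = +-cancelˡ-≤ (o + s) _ _ (begin
  o + s + cnt (o + s) t u  ≤⟨ +-monoˡ-≤ _ (h (o + s) (≤-trans (≤-trans (m≤m+n (o + s) t) (≤-reflexive (+-assoc o s t)))
                                          (subst (_≤ length u) e (cnt≤length 0 (o + (s + t)) u)))) ⟩
  cnt 0 (o + s) u + cnt (o + s) t u  ≡⟨ sym (cnt-split 0 (o + s) t u) ⟩
  cnt 0 (o + s + t) u  ≡⟨ cong (λ z → cnt 0 z u) (+-assoc o s t) ⟩
  cnt 0 (o + (s + t)) u  ≡⟨ e ⟩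
  o + (s + t)  ≡⟨ sym (+-assoc o s t) ⟩
  o + s + t  ∎)
  where open ≤-Reasoning

Break-cnt : ∀ u o l → Break u o → Break u (o + l) → cnt o l u ≡ l
Break-cnt u o l e e′ = +-cancelˡ-≡ o _ _ (begin
  o + cnt o l u  ≡⟨ cong (_+ cnt o l u) (sym e) ⟩
  cnt 0 o u + cnt o l u ≡⟨ sym (cnt-split 0 o l u) ⟩
  cnt 0 (o + l) u  ≡⟨ e′ ⟩
  o + l  ∎)
  where open ≡-Reasoning

Small : Rank → ℕ → Set
Small (fin r) l = l < r
Small ∞       l = ⊤

Small-≤ : ∀ r {k l} → k ≤ l → Small r l → Small r k
Small-≤ (fin r) k≤l h = ≤-<-trans k≤l h
Small-≤ ∞       _   _ = tt

-- Empty intervals are allowed: parking a factor may leave nothing of an interval, and exchanging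
-- with an empty one is the identity.
record Swappable (r : Rank) (u : Word) (o p q : ℕ) : Set where
  field
    parking : Parking u
    break₀  : Break u o
    break₁  : Break u (o + p)
    break₂  : Break u (o + p + q)
    small   : Small r p ⊎ Small r q

module _ {r u o p q} (sw : Swappable r u o p q) where
  open Swappable sw

  swappable⇒blocks : ThreeBlocks u o p q
  swappable⇒blocks = record
    { positive = proj₁ parking
    ; before   = Parking⇒Balanced 0 o parking break₀
    ; first    = Parking⇒Balanced o p parking break₁
    ; second   = Parking⇒Balanced (o + p) q parking break₂ }

  Park-swappable : Park (map (blockSwap o p q) u) ≡ map (blockSwap o p q) u
  Park-swappable = begin
    Park (map (blockSwap o p q) u)  ≡⟨ Park-swap swappable⇒blocks ⟩
    map (blockSwap (cnt 0 o u) (cnt o p u) (cnt (o + p) q u)) (Park u)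
      ≡⟨ cong₂ (λ x y → map (blockSwap x y (cnt (o + p) q u)) (Park u)) break₀ (Break-cnt u o p break₀ break₁) ⟩
    map (blockSwap o p (cnt (o + p) q u)) (Park u)
      ≡⟨ cong₂ (λ x y → map (blockSwap o p x) y) (Break-cnt u (o + p) q break₁ break₂) (Park-id parking) ⟩
    map (blockSwap o p q) u ∎
    where open ≡-Reasoning

  -- The exchanged word is its own parkization, and parkizations of positive words are parking
  -- functions.
  swapped-parking : Parking (map (blockSwap o p q) u)
  swapped-parking = subst Parking Park-swappable (Park-parking (Positive-swap o p q (proj₁ parking)))

  swappable-sym : Swappable r (map (blockSwap o p q) u) o q p
  swappable-sym = record
    { parking = swapped-parking
    ; break₀  = ≡.trans (cnt-swap-low o p q u 0 o ≤-refl) break₀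
    ; break₁  = ≡.trans (cnt-swap-to-mid o p q u) (cong₂ _+_ break₀ (Break-cnt u (o + p) q break₁ break₂))
    ; break₂  = subst (Break (map (blockSwap o p q) u)) (+-swap o p q) (≡.trans (cnt-swap-to-end o p q u) break₂)
    ; small   = Sum.swap small }

-- Parking leaves each interval as many values as it holds letters, so counts take the place of
-- lengths and smallness has to be asked of the counts.
blocks⇒swappable : ∀ {r v o p q} → ThreeBlocks v o p q → Small r (cnt o p v) ⊎ Small r (cnt (o + p) q v) →
  Swappable r (Park v) (cnt 0 o v) (cnt o p v) (cnt (o + p) q v)
blocks⇒swappable {v = v} {o} {p} {q} blocks small = record
  { parking = Park-parking positive
  ; break₀  = Park-break positive before
  ; break₁  = subst (Break (Park v)) (cnt-split 0 o p v) (Park-break {v} {o + p} positive upTo₁)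
  ; break₂  = subst (Break (Park v)) (≡.trans (cnt-split 0 (o + p) q v) (cong (_+ cnt (o + p) q v) (cnt-split 0 o p v)))
                (Park-break {v} {o + p + q} positive (Balanced-join v 0 (o + p) q upTo₁ second))
  ; small   = small }
  where
  open ThreeBlocks blocks
  upTo₁ : Balanced v 0 (o + p)
  upTo₁ = Balanced-join v 0 o p before first

-- Reading the word of a sequence of columns

Unique-↭ : ∀ {a} {A : Set a} {xs ys : List A} → xs ↭ ys → Unique xs → Unique ys
Unique-↭ refl u = u
Unique-↭ (prep x p) (x∉ ∷ u) = All-resp-↭ p x∉ ∷ Unique-↭ p u
Unique-↭ (swap x y p) ((x≢y ∷ x∉) ∷ y∉ ∷ u) =
  ((λ e → x≢y (sym e)) ∷ All-resp-↭ p y∉) ∷ All-resp-↭ p x∉ ∷ Unique-↭ p u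
Unique-↭ (trans p q) u = Unique-↭ q (Unique-↭ p u)

≡ᵇ-refl : ∀ n → (n ≡ᵇ n) ≡ true
≡ᵇ-refl n = T⇒true (≡⇒≡ᵇ n n refl)

≢⇒≡ᵇ : ∀ {m n} → m ≢ n → (m ≡ᵇ n) ≡ false
≢⇒≡ᵇ {m} {n} ne = ¬T⇒false (ne ∘ ≡ᵇ⇒≡ m n)

keys : List (ℕ × ℕ) → List ℕ
keys = map proj₁

values : List (ℕ × ℕ) → Word
values = map proj₂

lookup-↭ : ∀ p {xs ys} → xs ↭ ys → Unique (keys xs) → lookupAssoc p xs ≡ lookupAssoc p ys
lookup-↭ p refl u = refl
lookup-↭ p (prep (k , v) π) (_ ∷ u) with p ≡ᵇ k
... | true  = refl
... | false = lookup-↭ p π u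
lookup-↭ p (swap (k , v) (k′ , v′) π) ((k≢k′ ∷ _) ∷ _ ∷ u) with p ≡ᵇ k in e | p ≡ᵇ k′ in e′
... | true  | true  = contradiction (≡.trans (sym (≡ᵇ⇒≡ p k (subst T (sym e) tt))) (≡ᵇ⇒≡ p k′ (subst T (sym e′) tt))) k≢k′
... | true  | false = refl
... | false | true  = refl
... | false | false = lookup-↭ p π u
lookup-↭ p (trans π ρ) u = ≡.trans (lookup-↭ p π u) (lookup-↭ p ρ (Unique-↭ (map⁺ proj₁ π) u))

mapValues : (ℕ → ℕ) → List (ℕ × ℕ) → List (ℕ × ℕ)
mapValues g = map (λ x → proj₁ x , g (proj₂ x))

-- The condition on `g 0` accounts for the default value 0 that `lookupAssoc` returns for a missing
-- key.
lookup-mapValues : ∀ g p xs → g 0 ≡ 0 → lookupAssoc p (mapValues g xs) ≡ g (lookupAssoc p xs)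
lookup-mapValues g p []             g0 = sym g0
lookup-mapValues g p ((k , v) ∷ xs) g0 with p ≡ᵇ k
... | true  = refl
... | false = lookup-mapValues g p xs g0

lookup-keys : ∀ xs → Unique (keys xs) → map (λ p → lookupAssoc p xs) (keys xs) ≡ values xs
lookup-keys []             u = refl
lookup-keys ((k , v) ∷ xs) (k∉ ∷ u) rewrite ≡ᵇ-refl k = cong (v ∷_)
  (≡.trans (map-cong-local (All.map (λ {p} ne → cong (λ b → if b then v else lookupAssoc p xs) (≢⇒≡ᵇ (λ e → ne (sym e)))) k∉))
           (lookup-keys xs u))

positions : ℕ → List ℕ
positions = applyUpTo suc

Unique-positions : ∀ n → Unique (positions n)
Unique-positions n = Uniqueₚ.applyUpTo⁺₁ suc n (λ i<j _ e → <⇒≢ i<j (suc-injective e))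

-- `Φ m` unfolds to a `readout` of `assoc 0 m`; with the length kept apart, length and list can be
-- replaced independently.
readout : ℕ → List (ℕ × ℕ) → Word
readout n xs = map (λ p → lookupAssoc p xs) (positions n)

readout-values : ∀ n xs → keys xs ↭ positions n → readout n xs ↭ values xs
readout-values n xs π = ↭-trans (map⁺ _ (↭-sym π))
  (↭-reflexive (lookup-keys xs (Unique-↭ (↭-sym π) (Unique-positions n))))

readout-↭ : ∀ n {xs ys} → xs ↭ ys → Unique (keys xs) → readout n xs ≡ readout n ys
readout-↭ n π u = map-cong-local (All.universal (λ p → lookup-↭ p π u) (positions n))

readout-mapValues : ∀ n g xs → g 0 ≡ 0 → readout n (mapValues g xs) ≡ map g (readout n xs)
readout-mapValues n g xs g0 = ≡.trans
  (map-cong-local (All.universal (λ p → lookup-mapValues g p xs g0) (positions n))) (map-∘ (positions n))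

keys-zip : ∀ (L : List ℕ) (M : Word) → length M ≡ length L → keys (zip L M) ≡ L
keys-zip []      []      _ = refl
keys-zip (x ∷ L) (y ∷ M) e = cong (x ∷_) (keys-zip L M (suc-injective e))

values-zip : ∀ (L : List ℕ) (M : Word) → length M ≡ length L → values (zip L M) ≡ M
values-zip []      []      _ = refl
values-zip (x ∷ L) (y ∷ M) e = cong (y ∷_) (values-zip L M (suc-injective e))

mapValues-zip : ∀ g (L : List ℕ) (M : Word) → mapValues g (zip L M) ≡ zip L (map g M)
mapValues-zip g []      M       = refl
mapValues-zip g (x ∷ L) []      = refl
mapValues-zip g (x ∷ L) (y ∷ M) = cong (_ ∷_) (mapValues-zip g L M)

norm : List Column → ℕ
norm []            = 0
norm ((L , M) ∷ m) = cnorm L + norm m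

assoc-++ : ∀ off m m′ → assoc off (m ++ m′) ≡ assoc off m ++ assoc (off + norm m) m′
assoc-++ off [] m′ = cong (λ z → assoc z m′) (sym (+-identityʳ off))
assoc-++ off ((L , M) ∷ m) m′ = begin
  zip L (shift off M) ++ assoc (off + cnorm L) (m ++ m′)
    ≡⟨ cong (zip L (shift off M) ++_) (assoc-++ (off + cnorm L) m m′) ⟩
  zip L (shift off M) ++ (assoc (off + cnorm L) m ++ assoc (off + cnorm L + norm m) m′)
    ≡⟨ sym (++-assoc (zip L (shift off M)) _ _) ⟩
  (zip L (shift off M) ++ assoc (off + cnorm L) m) ++ assoc (off + cnorm L + norm m) m′
    ≡⟨ cong (λ z → assoc off ((L , M) ∷ m) ++ assoc z m′) (+-assoc off (cnorm L) (norm m)) ⟩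
  assoc off ((L , M) ∷ m) ++ assoc (off + norm ((L , M) ∷ m)) m′ ∎
  where open ≡-Reasoning

length-shift : ∀ k M → length (shift k M) ≡ length M
length-shift k = length-map (k +_)

column-length : ∀ L M → ValidColumn (L , M) → length M ≡ length L
column-length L M valid = proj₂ (proj₂ (proj₂ valid))

column-parking : ∀ L M → ValidColumn (L , M) → Parking M
column-parking L M valid = IsPrimePF⇒Parking M (proj₁ (proj₂ (proj₂ valid)))

column-letters : ∀ L M → ValidColumn (L , M) → All (InInterval 0 (cnorm L)) M
column-letters []      []      valid = []
column-letters []      (y ∷ M) valid = contradiction (column-length [] (y ∷ M) valid) λ ()
column-letters (x ∷ L) M       valid = subst (λ z → All (InInterval 0 z) M) (column-length (x ∷ L) M valid)
  (Parking⇒≤length (column-parking (x ∷ L) M valid))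

-- A nonempty column is a parking function that fills its interval. An empty one takes up one value
-- and contributes no letter: balanced, but not full.
column-balanced : ∀ L M → ValidColumn (L , M) → Balanced M 0 (cnorm L)
column-balanced []      []      valid = λ s t e → z≤n
column-balanced []      (y ∷ M) valid = contradiction (column-length [] (y ∷ M) valid) λ ()
column-balanced (x ∷ L) M       valid = subst (Balanced M 0) (column-length (x ∷ L) M valid)
  (Parking⇒Balanced 0 (length M) h (≤-antisym (cnt≤length 0 _ M) (proj₂ h _ ≤-refl)))
  where
  h = column-parking (x ∷ L) M valid

shifted-letters : ∀ L M → ValidColumn (L , M) → ∀ off → All (InInterval off (cnorm L)) (shift off M)
shifted-letters L M valid off = Allₚ.map⁺ (All.map
  (λ {a} (h₁ , h₂) → subst (_< off + a) (+-identityʳ off) (+-monoʳ-< off h₁) , +-monoʳ-≤ off h₂) (column-letters L M valid))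

keys-column : ∀ L M → ValidColumn (L , M) → ∀ off → keys (zip L (shift off M)) ≡ L
keys-column L M valid off = keys-zip L (shift off M) (≡.trans (length-shift off M) (column-length L M valid))

values-column : ∀ L M → ValidColumn (L , M) → ∀ off → values (zip L (shift off M)) ≡ shift off M
values-column L M valid off = values-zip L (shift off M) (≡.trans (length-shift off M) (column-length L M valid))

keys-assoc : ∀ off {m} → All ValidColumn m → keys (assoc off m) ≡ concatMap proj₁ m
keys-assoc off [] = refl
keys-assoc off {(L , M) ∷ m} (h ∷ hs) = ≡.trans (map-++ proj₁ (zip L (shift off M)) _)
  (cong₂ _++_ (keys-column L M h off) (keys-assoc (off + cnorm L) hs))

letters : ℕ → List Column → Word
letters off m = values (assoc off m)

letters-∷ : ∀ off L M m → ValidColumn (L , M) → letters off ((L , M) ∷ m) ≡ shift off M ++ letters (off + cnorm L) m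
letters-∷ off L M m h = ≡.trans (map-++ proj₂ (zip L (shift off M)) _)
  (cong (_++ letters (off + cnorm L) m) (values-column L M h off))

InInterval-⊆ : ∀ {o l a} s t → s + t ≤ l → InInterval (o + s) t a → InInterval o l a
InInterval-⊆ {o} {l} {a} s t b (h₁ , h₂) =
  ≤-<-trans (m≤m+n o s) h₁ , ≤-trans h₂ (≤-trans (≤-reflexive (+-assoc o s t)) (+-monoʳ-≤ o b))

letters-interval : ∀ off {m} → All ValidColumn m → All (InInterval off (norm m)) (letters off m)
letters-interval off [] = []
letters-interval off {(L , M) ∷ m} (h ∷ hs) = subst (All (InInterval off (norm ((L , M) ∷ m)))) (sym (letters-∷ off L M m h))
  (Allₚ.++⁺ (All.map (λ {a} i → InInterval-⊆ 0 (cnorm L) (m≤m+n (cnorm L) (norm m)) (subst (λ z → InInterval z (cnorm L) a) (sym (+-identityʳ off)) i)) (shifted-letters L M h off))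
            (All.map (InInterval-⊆ (cnorm L) (norm m) ≤-refl) (letters-interval (off + cnorm L) hs)))

above⇒outside : ∀ {o l o′ l′ v} → o + l ≤ o′ → All (InInterval o′ l′) v → All (¬_ ∘ InInterval o l) v
above⇒outside b = All.map (λ (h , _) (_ , h′) → <⇒≱ h (≤-trans h′ b))

below⇒outside : ∀ {o l o′ l′ v} → o′ + l′ ≤ o → All (InInterval o′ l′) v → All (¬_ ∘ InInterval o l) v
below⇒outside b = All.map (λ (_ , h) (h′ , _) → <⇒≱ h′ (≤-trans h b))

cnt-shift : ∀ off s t v → cnt (off + s) t (shift off v) ≡ cnt s t v
cnt-shift off s t v = cnt-map (off +_) v (All.universal (λ a → inInterval-cong {s} {t} {a}
  (λ (h₁ , h₂) → +-monoʳ-< off h₁ , subst (off + a ≤_) (sym (+-assoc off s t)) (+-monoʳ-≤ off h₂))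
  (λ (h₁ , h₂) → +-cancelˡ-< off s a h₁ , +-cancelˡ-≤ off a (s + t) (subst (off + a ≤_) (+-assoc off s t) h₂))) v)

cnt-outside : ∀ {o l} s t v {W} → s + t ≤ l → All (¬_ ∘ InInterval o l) W → cnt (o + s) t (v ++ W) ≡ cnt (o + s) t v
cnt-outside {o} s t v {W} b out = ≡.trans (cnt-++ (o + s) t v W) (≡.trans
  (cong (cnt (o + s) t v +_) (cnt-none W (All.map (_∘ InInterval-⊆ s t b) out))) (+-identityʳ _))

column-balanced-in : ∀ L M {W} off → ValidColumn (L , M) → All (¬_ ∘ InInterval off (cnorm L)) W →
  Balanced (shift off M ++ W) off (cnorm L)
column-balanced-in L M {W} off h out s t e = subst (_≤ t)
  (sym (≡.trans (cnt-outside s t (shift off M) (≤-reflexive e) out) (cnt-shift off s t M))) (column-balanced L M h s t e)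

column-count : ∀ L M {W} off → All (¬_ ∘ InInterval off (cnorm L)) W → cnt off (cnorm L) (shift off M ++ W) ≤ length M
column-count L M {W} off out = begin
  cnt off (cnorm L) (shift off M ++ W)  ≡⟨ cong (λ z → cnt z (cnorm L) (shift off M ++ W)) (sym (+-identityʳ off)) ⟩
  cnt (off + 0) (cnorm L) (shift off M ++ W)  ≡⟨ cnt-outside 0 (cnorm L) (shift off M) ≤-refl out ⟩
  cnt (off + 0) (cnorm L) (shift off M)  ≤⟨ cnt≤length (off + 0) (cnorm L) (shift off M) ⟩
  length (shift off M)  ≡⟨ length-shift off M ⟩
  length M  ∎
  where open ≤-Reasoning

rotate : ∀ {a} {A : Set a} (xs ys zs : List A) → ys ++ (xs ++ zs) ↭ xs ++ (ys ++ zs)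
rotate xs ys zs = ↭-trans (↭-reflexive (sym (++-assoc ys xs zs)))
  (↭-trans (++⁺ʳ zs (++-comm ys xs)) (↭-reflexive (++-assoc xs ys zs)))

-- The foreign letters `W` make the induction possible: seen from the first column the later ones
-- are foreign, and conversely.
letters-balanced : ∀ off {m W} → All ValidColumn m → All (¬_ ∘ InInterval off (norm m)) W →
  Balanced (letters off m ++ W) off (norm m)
letters-balanced off {[]} {W} [] out s t e = subst (λ z → cnt (off + s) z W ≤ z) (sym (m+n≡0⇒n≡0 s e))
  (≤-reflexive (cnt-zero (off + s) W))
letters-balanced off {(L , M) ∷ m} {W} (h ∷ hs) out rewrite letters-∷ off L M m h | ++-assoc (shift off M) (letters (off + cnorm L) m) W =
  Balanced-join (shift off M ++ letters (off + cnorm L) m ++ W) off (cnorm L) (norm m)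
    (column-balanced-in L M off h (Allₚ.++⁺ (above⇒outside ≤-refl (letters-interval (off + cnorm L) hs))
      (All.map (λ {a} ¬i i → ¬i (InInterval-⊆ 0 (cnorm L) (m≤m+n (cnorm L) (norm m)) (subst (λ z → InInterval z (cnorm L) a) (sym (+-identityʳ off)) i))) out)))
    (Balanced-↭ (rotate (shift off M) (letters (off + cnorm L) m) W)
      (letters-balanced (off + cnorm L) hs
        (Allₚ.++⁺ (below⇒outside ≤-refl (shifted-letters L M h off)) (All.map (_∘ InInterval-⊆ (cnorm L) (norm m) ≤-refl) out))))

module SwapColumns (pre post : List Column) (L₁ : List ℕ) (M₁ : Word) (L₂ : List ℕ) (M₂ : Word)
  (valid : ValidBW (pre ++ (L₁ , M₁) ∷ (L₂ , M₂) ∷ post)) where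

  private
    m m′ : List Column
    m  = pre ++ (L₁ , M₁) ∷ (L₂ , M₂) ∷ post
    m′ = pre ++ (L₂ , M₂) ∷ (L₁ , M₁) ∷ post
    o p q n : ℕ
    o  = norm pre
    p  = cnorm L₁
    q  = cnorm L₂
    n  = length (concatMap proj₁ m)
    σ  = blockSwap o p q
    valid-pre : All ValidColumn pre
    valid-pre = Allₚ.++⁻ˡ pre (proj₁ valid)
    valid₁ : ValidColumn (L₁ , M₁)
    valid₁ = All.head (Allₚ.++⁻ʳ pre (proj₁ valid))
    valid₂ : ValidColumn (L₂ , M₂)
    valid₂ = All.head (All.tail (Allₚ.++⁻ʳ pre (proj₁ valid)))
    valid-post : All ValidColumn post
    valid-post = All.tail (All.tail (Allₚ.++⁻ʳ pre (proj₁ valid)))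
    keys-m : keys (assoc 0 m) ↭ positions n
    keys-m = ↭-trans (↭-reflexive (keys-assoc 0 (proj₁ valid))) (proj₂ valid)

    A₀ A₃ : List (ℕ × ℕ)
    A₀ = assoc 0 pre
    A₃ = assoc (o + p + q) post

    mapValues-fix : ∀ xs → All (λ a → σ a ≡ a) (values xs) → mapValues σ xs ≡ xs
    mapValues-fix []       _        = refl
    mapValues-fix (x ∷ xs) (h ∷ hs) = cong₂ _∷_ (cong (proj₁ x ,_) h) (mapValues-fix xs hs)

    σ-pre : mapValues σ A₀ ≡ A₀
    σ-pre = mapValues-fix A₀ (All.map (λ (_ , h) → blockSwap-low o p q h) (letters-interval 0 valid-pre))

    σ-post : mapValues σ A₃ ≡ A₃
    σ-post = mapValues-fix A₃ (All.map fixed (letters-interval (o + p + q) valid-post))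
      where
      fixed : ∀ {a} → InInterval (o + p + q) (norm post) a → σ a ≡ a
      fixed (h , _) with <⇒+suc o p q h
      ... | t , refl = blockSwap-high o p q

    σ-first : map σ (shift o M₁) ≡ shift (o + q) M₁
    σ-first = ≡.trans (sym (map-∘ M₁)) (map-cong-local (All.map moved (column-letters L₁ M₁ valid₁)))
      where
      moved : ∀ {a} → InInterval 0 p a → σ (o + a) ≡ o + q + a
      moved {suc a} (_ , h) = blockSwap-first o p q h

    σ-second : map σ (shift (o + p) M₂) ≡ shift o M₂
    σ-second = ≡.trans (sym (map-∘ M₂)) (map-cong-local (All.map moved (column-letters L₂ M₂ valid₂)))
      where
      moved : ∀ {a} → InInterval 0 q a → σ (o + p + a) ≡ o + a
      moved {suc a} (_ , h) = blockSwap-second o p q h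

    assoc-m : assoc 0 m ≡ A₀ ++ zip L₁ (shift o M₁) ++ zip L₂ (shift (o + p) M₂) ++ A₃
    assoc-m = assoc-++ 0 pre _

    assoc-m′ : assoc 0 m′ ≡ A₀ ++ zip L₂ (shift o M₂) ++ zip L₁ (shift (o + q) M₁) ++ A₃
    assoc-m′ = ≡.trans (assoc-++ 0 pre _)
      (cong (λ z → A₀ ++ zip L₂ (shift o M₂) ++ zip L₁ (shift (o + q) M₁) ++ assoc z post) (+-swap o q p))

    σ-assoc : mapValues σ (assoc 0 m) ↭ assoc 0 m′
    σ-assoc = begin
      mapValues σ (assoc 0 m)  ≡⟨ cong (mapValues σ) assoc-m ⟩
      mapValues σ (A₀ ++ zip L₁ (shift o M₁) ++ zip L₂ (shift (o + p) M₂) ++ A₃)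
        ≡⟨ ≡.trans (map-++ _ A₀ _) (cong (mapValues σ A₀ ++_) (≡.trans (map-++ _ (zip L₁ (shift o M₁)) _)
             (cong (mapValues σ (zip L₁ (shift o M₁)) ++_) (map-++ _ (zip L₂ (shift (o + p) M₂)) _)))) ⟩
      mapValues σ A₀ ++ mapValues σ (zip L₁ (shift o M₁)) ++ mapValues σ (zip L₂ (shift (o + p) M₂)) ++ mapValues σ A₃
        ≡⟨ cong₂ _++_ σ-pre (cong₂ _++_ (≡.trans (mapValues-zip σ L₁ _) (cong (zip L₁) σ-first))
                            (cong₂ _++_ (≡.trans (mapValues-zip σ L₂ _) (cong (zip L₂) σ-second)) σ-post)) ⟩
      A₀ ++ zip L₁ (shift (o + q) M₁) ++ zip L₂ (shift o M₂) ++ A₃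
        ↭⟨ ++⁺ˡ A₀ (rotate (zip L₂ (shift o M₂)) (zip L₁ (shift (o + q) M₁)) A₃) ⟩
      A₀ ++ zip L₂ (shift o M₂) ++ zip L₁ (shift (o + q) M₁) ++ A₃ ≡⟨ sym assoc-m′ ⟩
      assoc 0 m′ ∎
      where open PermutationReasoning

    keys-mapValues : ∀ g xs → keys (mapValues g xs) ≡ keys xs
    keys-mapValues g xs = sym (map-∘ xs)

    concat-m′ : concatMap proj₁ m ↭ concatMap proj₁ m′
    concat-m′ = begin
      concatMap proj₁ m ≡⟨ concatMap-++ proj₁ pre _ ⟩
      concatMap proj₁ pre ++ L₁ ++ L₂ ++ concatMap proj₁ post ↭⟨ ++⁺ˡ (concatMap proj₁ pre) (rotate L₂ L₁ _) ⟩
      concatMap proj₁ pre ++ L₂ ++ L₁ ++ concatMap proj₁ post ≡⟨ sym (concatMap-++ proj₁ pre _) ⟩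
      concatMap proj₁ m′ ∎
      where open PermutationReasoning

  -- The exchange of values carries the association list of `m` to that of `m′` up to order, and
  -- order does not matter to `readout` because the positions are distinct.
  Φ-swap : Φ m′ ≡ map (blockSwap o p q) (Φ m)
  Φ-swap = begin
    readout (length (concatMap proj₁ m′)) (assoc 0 m′)  ≡⟨ cong (λ z → readout z (assoc 0 m′)) (sym (↭-length concat-m′)) ⟩
    readout n (assoc 0 m′)  ≡⟨ sym (readout-↭ n σ-assoc (subst Unique (sym (keys-mapValues σ (assoc 0 m))) (Unique-↭ (↭-sym keys-m) (Unique-positions n)))) ⟩
    readout n (mapValues σ (assoc 0 m))  ≡⟨ readout-mapValues n σ (assoc 0 m) refl ⟩
    map σ (readout n (assoc 0 m))  ∎
    where open ≡-Reasoning

  private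
    X₀ X₁ X₂ X₃ : Word
    X₀ = letters 0 pre
    X₁ = shift o M₁
    X₂ = shift (o + p) M₂
    X₃ = letters (o + p + q) post
    in₀ : All (InInterval 0 o) X₀
    in₀ = letters-interval 0 valid-pre
    in₁ : All (InInterval o p) X₁
    in₁ = shifted-letters L₁ M₁ valid₁ o
    in₂ : All (InInterval (o + p) q) X₂
    in₂ = shifted-letters L₂ M₂ valid₂ (o + p)
    in₃ : All (InInterval (o + p + q) (norm post)) X₃
    in₃ = letters-interval (o + p + q) valid-post

    letters-m : letters 0 m ≡ X₀ ++ X₁ ++ X₂ ++ X₃
    letters-m = ≡.trans (cong values (assoc-++ 0 pre _)) (≡.trans (map-++ proj₂ (assoc 0 pre) _)
      (cong (X₀ ++_) (≡.trans (letters-∷ o L₁ M₁ ((L₂ , M₂) ∷ post) valid₁) (cong (X₁ ++_) (letters-∷ (o + p) L₂ M₂ post valid₂)))))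

    Φ-letters : X₀ ++ X₁ ++ X₂ ++ X₃ ↭ Φ m
    Φ-letters = ↭-trans (↭-reflexive (sym letters-m)) (↭-sym (readout-values n (assoc 0 m) keys-m))

    view₁ : X₁ ++ X₀ ++ X₂ ++ X₃ ↭ Φ m
    view₁ = ↭-trans (rotate X₀ X₁ _) Φ-letters

    view₂ : X₂ ++ X₀ ++ X₁ ++ X₃ ↭ Φ m
    view₂ = ↭-trans (rotate X₀ X₂ _) (↭-trans (++⁺ˡ X₀ (rotate X₁ X₂ X₃)) Φ-letters)

    out₁ : All (¬_ ∘ InInterval o p) (X₀ ++ X₂ ++ X₃)
    out₁ = Allₚ.++⁺ (below⇒outside ≤-refl in₀) (Allₚ.++⁺ (above⇒outside ≤-refl in₂) (above⇒outside (m≤m+n (o + p) q) in₃))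

    out₂ : All (¬_ ∘ InInterval (o + p) q) (X₀ ++ X₁ ++ X₃)
    out₂ = Allₚ.++⁺ (below⇒outside (m≤m+n o p) in₀) (Allₚ.++⁺ (below⇒outside ≤-refl in₁) (above⇒outside ≤-refl in₃))

    positive-⊆ : ∀ {o l v} → All (InInterval o l) v → Positive v
    positive-⊆ = All.map (λ (h , _) → ≤-trans (s≤s z≤n) h)

  blocks : ThreeBlocks (Φ m) o p q
  blocks = record
    { positive = All-resp-↭ Φ-letters (Allₚ.++⁺ (positive-⊆ in₀) (Allₚ.++⁺ (positive-⊆ in₁) (Allₚ.++⁺ (positive-⊆ in₂) (positive-⊆ in₃))))
    ; before   = Balanced-↭ {X₀ ++ X₁ ++ X₂ ++ X₃} {Φ m} {0} {o} Φ-letters (letters-balanced 0 valid-pre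
                   (Allₚ.++⁺ (above⇒outside ≤-refl in₁) (Allₚ.++⁺ (above⇒outside (m≤m+n o p) in₂)
                     (above⇒outside (≤-trans (m≤m+n o p) (m≤m+n (o + p) q)) in₃))))
    ; first    = Balanced-↭ {X₁ ++ X₀ ++ X₂ ++ X₃} {Φ m} {o} {p} view₁ (column-balanced-in L₁ M₁ o valid₁ out₁)
    ; second   = Balanced-↭ {X₂ ++ X₀ ++ X₁ ++ X₃} {Φ m} {o + p} {q} view₂ (column-balanced-in L₂ M₂ (o + p) valid₂ out₂) }

  -- Smallness passes to smaller numbers, so this bound hands it from the word of the column to the
  -- parked interval.
  count-first : cnt o p (Φ m) ≤ length M₁
  count-first = subst (_≤ length M₁) (cnt-↭ o p view₁) (column-count L₁ M₁ o out₁)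

  count-second : cnt (o + p) q (Φ m) ≤ length M₂
  count-second = subst (_≤ length M₂) (cnt-↭ (o + p) q view₂) (column-count L₂ M₂ (o + p) out₂)

-- The action of the generators on words

applyUpTo-cong : ∀ {A : Set} {f g : ℕ → A} n → (∀ i → i < n → f i ≡ g i) → applyUpTo f n ≡ applyUpTo g n
applyUpTo-cong zero    e = refl
applyUpTo-cong (suc n) e = cong₂ _∷_ (e 0 (s≤s z≤n)) (applyUpTo-cong n (λ i i< → e (suc i) (s≤s i<)))

applyUpTo-split : ∀ {A : Set} (f : ℕ → A) i k →
  applyUpTo f (i + suc (suc k)) ≡ applyUpTo f i ++ f i ∷ f (suc i) ∷ applyUpTo (λ j → f (suc (suc i) + j)) k
applyUpTo-split f zero    k = refl
applyUpTo-split f (suc i) k = cong (f 0 ∷_) (applyUpTo-split (f ∘ suc) i k)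

colAt-pad : ∀ m k → applyUpTo (colAt m) (length m + k) ≡ m ++ replicate k emptyCol
colAt-pad []      zero    = refl
colAt-pad []      (suc k) = cong (emptyCol ∷_) (colAt-pad [] k)
colAt-pad (c ∷ m) k       = cong (c ∷_) (colAt-pad m k)

concatMap-empty : ∀ k → concatMap proj₁ (replicate k emptyCol) ≡ []
concatMap-empty zero    = refl
concatMap-empty (suc k) = concatMap-empty k

assoc-empty : ∀ off k → assoc off (replicate k emptyCol) ≡ []
assoc-empty off zero    = refl
assoc-empty off (suc k) = assoc-empty (off + 1) k

concatMap-pad : ∀ m k → concatMap proj₁ (m ++ replicate k emptyCol) ≡ concatMap proj₁ m
concatMap-pad m k = ≡.trans (concatMap-++ proj₁ m _) (≡.trans (cong (concatMap proj₁ m ++_) (concatMap-empty k)) (++-identityʳ _))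

Φ-pad : ∀ m k → Φ (m ++ replicate k emptyCol) ≡ Φ m
Φ-pad m k = cong₂ (λ n xs → readout n xs) (cong length (concatMap-pad m k))
  (≡.trans (assoc-++ 0 m _) (≡.trans (cong (assoc 0 m ++_) (assoc-empty (norm m) k)) (++-identityʳ _)))

ValidBW-pad : ∀ m k → ValidBW m → ValidBW (m ++ replicate k emptyCol)
ValidBW-pad m k (valid , π) = Allₚ.++⁺ valid (Allₚ.replicate⁺ k ([] , [] , tt , refl)) ,
  subst (λ z → z ↭ positions (length z)) (sym (concatMap-pad m k)) π

-- The list may have fewer than i + 2 columns. Padding by empty columns, which does not affect `Φ`,
-- gives it the shape required by `SwapColumns`.
module SwapAt (i : ℕ) (m : List Column) (valid : ValidBW m) where

  pre : List Column
  pre = applyUpTo (colAt m) i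

  L₁ L₂ : List ℕ
  L₁ = proj₁ (colAt m i)
  L₂ = proj₁ (colAt m (suc i))
  M₁ M₂ : Word
  M₁ = proj₂ (colAt m i)
  M₂ = proj₂ (colAt m (suc i))

  private
    N k : ℕ
    N = suc (suc i) ⊔ length m
    k = N ∸ suc (suc i)

    N≡ : N ≡ i + suc (suc k)
    N≡ = ≡.trans (sym (m+[n∸m]≡n (m≤m⊔n (suc (suc i)) (length m))))
                 (sym (≡.trans (+-suc i (suc k)) (cong suc (+-suc i k))))

    post : List Column
    post = applyUpTo (λ j → colAt m (suc (suc i) + j)) k

    padded : List Column
    padded = pre ++ (L₁ , M₁) ∷ (L₂ , M₂) ∷ post

    padded≡ : padded ≡ m ++ replicate (N ∸ length m) emptyCol
    padded≡ = begin
      padded  ≡⟨ sym (applyUpTo-split (colAt m) i k) ⟩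
      applyUpTo (colAt m) (i + suc (suc k))  ≡⟨ cong (applyUpTo (colAt m)) (sym N≡) ⟩
      applyUpTo (colAt m) N  ≡⟨ cong (applyUpTo (colAt m)) (sym (m+[n∸m]≡n (m≤n⊔m (suc (suc i)) (length m)))) ⟩
      applyUpTo (colAt m) (length m + (N ∸ length m)) ≡⟨ colAt-pad m _ ⟩
      m ++ replicate (N ∸ length m) emptyCol  ∎
      where open ≡-Reasoning

    -- The function inside `swapCols` is local and cannot be named, so it is replaced by any `f`
    -- satisfying its equation.
    swapped-split : ∀ f → (∀ j → f j ≡ (if j ≡ᵇ i then colAt m (suc i) else if j ≡ᵇ suc i then colAt m i else colAt m j)) →
      applyUpTo f N ≡ pre ++ (L₂ , M₂) ∷ (L₁ , M₁) ∷ post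
    swapped-split f spec = begin
      applyUpTo f N  ≡⟨ cong (applyUpTo f) N≡ ⟩
      applyUpTo f (i + suc (suc k))  ≡⟨ applyUpTo-split f i k ⟩
      applyUpTo f i ++ f i ∷ f (suc i) ∷ applyUpTo (λ j → f (suc (suc i) + j)) k
        ≡⟨ cong₂ _++_ (applyUpTo-cong i before) (cong₂ _∷_ at (cong₂ _∷_ at-suc (applyUpTo-cong k (λ j _ → after j)))) ⟩
      pre ++ (L₂ , M₂) ∷ (L₁ , M₁) ∷ post  ∎
      where
      open ≡-Reasoning
      before : ∀ j → j < i → f j ≡ colAt m j
      before j j<i = ≡.trans (spec j) (cong₂ (λ a b → if a then colAt m (suc i) else if b then colAt m i else colAt m j)
        (≢⇒≡ᵇ (<⇒≢ j<i)) (≢⇒≡ᵇ (<⇒≢ (m≤n⇒m≤1+n j<i))))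
      at : f i ≡ colAt m (suc i)
      at = ≡.trans (spec i) (cong (λ a → if a then colAt m (suc i) else if i ≡ᵇ suc i then colAt m i else colAt m i) (≡ᵇ-refl i))
      at-suc : f (suc i) ≡ colAt m i
      at-suc = ≡.trans (spec (suc i)) (cong₂ (λ a b → if a then colAt m (suc i) else if b then colAt m i else colAt m (suc i))
        (≢⇒≡ᵇ {suc i} {i} 1+n≢n) (≡ᵇ-refl i))
      after : ∀ j → f (suc (suc i) + j) ≡ colAt m (suc (suc i) + j)
      after j = ≡.trans (spec (suc (suc i) + j)) (cong₂ (λ a b → if a then colAt m (suc i) else if b then colAt m i else colAt m (suc (suc i) + j))
        (≢⇒≡ᵇ {suc (suc i) + j} {i} (λ e → <⇒≢ (m≤n⇒m≤1+n (s≤s (m≤m+n i j))) (sym e)))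
        (≢⇒≡ᵇ {suc i + j} {i} (λ e → <⇒≢ (s≤s (m≤m+n i j)) (sym e))))

    swapped≡ : swapCols i m ≡ pre ++ (L₂ , M₂) ∷ (L₁ , M₁) ∷ post
    swapped≡ = swapped-split _ (λ j → refl)

    Φ-padded : Φ padded ≡ Φ m
    Φ-padded = ≡.trans (cong Φ padded≡) (Φ-pad m _)

    module S = SwapColumns pre post L₁ M₁ L₂ M₂ (subst ValidBW (sym padded≡) (ValidBW-pad m _ valid))

  Φ-swapCols : Φ (swapCols i m) ≡ map (blockSwap (norm pre) (cnorm L₁) (cnorm L₂)) (Φ m)
  Φ-swapCols = ≡.trans (cong Φ swapped≡) (≡.trans S.Φ-swap (cong (map _) Φ-padded))

  blocks : ThreeBlocks (Φ m) (norm pre) (cnorm L₁) (cnorm L₂)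
  blocks = subst (λ w → ThreeBlocks w (norm pre) (cnorm L₁) (cnorm L₂)) Φ-padded S.blocks

  count-first : cnt (norm pre) (cnorm L₁) (Φ m) ≤ length M₁
  count-first = subst (λ w → cnt (norm pre) (cnorm L₁) w ≤ length M₁) Φ-padded S.count-first

  count-second : cnt (norm pre + cnorm L₁) (cnorm L₂) (Φ m) ≤ length M₂
  count-second = subst (λ w → cnt (norm pre + cnorm L₁) (cnorm L₂) w ≤ length M₂) Φ-padded S.count-second

short⇒Small : ∀ r M → T (short r M) → Small r (length M)
short⇒Small (fin r) M h = <ᵇ⇒< (length M) r h
short⇒Small ∞       M h = tt

Small⇒short : ∀ r M → Small r (length M) → T (short r M)
Small⇒short (fin r) M h = <⇒<ᵇ h
Small⇒short ∞       M h = tt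

-- Exchanging with an empty column may change `Φ m`; after parking that column has length 0, and the
-- exchange becomes the identity.
act-swaps : ∀ r i m → ValidBW m →
  Park (Φ (act r i m)) ≡ Park (Φ m) ⊎
  ∃ λ o → ∃ λ p → ∃ λ q → Swappable r (Park (Φ m)) o p q × Park (Φ (act r i m)) ≡ map (blockSwap o p q) (Park (Φ m))
act-swaps r i m valid with short r (proj₂ (colAt m i)) ∨ short r (proj₂ (colAt m (suc i))) in eq
... | false = inj₁ refl
... | true  = inj₂ (_ , _ , _ , blocks⇒swappable blocks
    (Sum.map (Small-≤ r count-first ∘ short⇒Small r M₁) (Small-≤ r count-second ∘ short⇒Small r M₂)
      (Equivalence.to (T-∨ {short r M₁}) (subst T (sym eq) tt)))
  , ≡.trans (cong Park Φ-swapCols) (Park-swap blocks))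
  where open SwapAt i m valid

-- The columns of a parking function

module Columns (u : Word) (parking : Parking u) where

  n : ℕ
  n = length u

  indexed : List (ℕ × ℕ)
  indexed = zip (positions n) u

  segment : ℕ → ℕ → List (ℕ × ℕ)
  segment b l = filterᵇ (inInterval b l ∘ proj₂) indexed

  column : ℕ → ℕ → Column
  column b l = keys (segment b l) , map (_∸ b) (values (segment b l))

  keys-indexed : keys indexed ≡ positions n
  keys-indexed = keys-zip (positions n) u (sym (length-applyUpTo suc n))

  values-indexed : values indexed ≡ u
  values-indexed = values-zip (positions n) u (sym (length-applyUpTo suc n))

  filter-split : ∀ b s t (xs : List (ℕ × ℕ)) → filterᵇ (inInterval b s ∘ proj₂) xs ++ filterᵇ (inInterval (b + s) t ∘ proj₂) xs
    ↭ filterᵇ (inInterval b (s + t) ∘ proj₂) xs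
  filter-split b s t [] = refl
  filter-split b s t (x ∷ xs)
    with inInterval b s (proj₂ x) | inInterval (b + s) t (proj₂ x) | inInterval b (s + t) (proj₂ x) | bit-split b s t (proj₂ x)
  ... | true  | true  | true  | ()
  ... | true  | true  | false | ()
  ... | true  | false | true  | _ = prep x (filter-split b s t xs)
  ... | false | true  | true  | _ = ↭-trans (shift-∷ x (filterᵇ (inInterval b s ∘ proj₂) xs) _) (prep x (filter-split b s t xs))
    where
    shift-∷ : ∀ {A : Set} (x : A) xs ys → xs ++ x ∷ ys ↭ x ∷ xs ++ ys
    shift-∷ x xs ys = rotate (x ∷ []) xs ys
  ... | false | false | false | _ = filter-split b s t xs

  segment-split : ∀ b s t → segment b s ++ segment (b + s) t ↭ segment b (s + t)
  segment-split b s t = filter-split b s t indexed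

  segment-all : segment 0 n ≡ indexed
  segment-all = filter-all (T? ∘ inInterval 0 n ∘ proj₂) (Allₚ.map⁻ (subst (All (T ∘ inInterval 0 n)) (sym values-indexed)
    (All.map inInterval-from (Parking⇒≤length parking))))

  values-filter : ∀ b l (xs : List (ℕ × ℕ)) → values (filterᵇ (inInterval b l ∘ proj₂) xs) ≡ filterᵇ (inInterval b l) (values xs)
  values-filter b l [] = refl
  values-filter b l (x ∷ xs) with inInterval b l (proj₂ x)
  ... | true  = cong (proj₂ x ∷_) (values-filter b l xs)
  ... | false = values-filter b l xs

  column-word : ∀ b l → proj₂ (column b l) ≡ map (_∸ b) (filterᵇ (inInterval b l) u)
  column-word b l = cong (map (_∸ b)) (≡.trans (values-filter b l indexed) (cong (filterᵇ (inInterval b l)) values-indexed))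

  cnt-filter : ∀ b l i v → i ≤ l → cnt 0 i (map (_∸ b) (filterᵇ (inInterval b l) v)) ≡ cnt b i v
  cnt-filter b l i []      h = refl
  cnt-filter b l i (a ∷ v) h with inInterval b l a in eq
  ... | true  = cong₂ (λ x y → bit x + y) (inInterval-cong {0} {i} {a ∸ b} {b} {i} {a} to from) (cnt-filter b l i v h)
    where
    b<a : b < a
    b<a = proj₁ (inInterval-to {b} {l} (subst T (sym eq) tt))
    to : InInterval 0 i (a ∸ b) → InInterval b i a
    to (_ , k) = b<a , subst (_≤ b + i) (m+[n∸m]≡n (<⇒≤ b<a)) (+-monoʳ-≤ b k)
    from : InInterval b i a → InInterval 0 i (a ∸ b)
    from (k₁ , k₂) = m<n⇒0<n∸m k₁ , m≤n+o⇒m∸n≤o a b k₂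
  ... | false = ≡.trans (cnt-filter b l i v h) (sym (cong (λ x → bit x + cnt b i v) (¬T⇒false {inInterval b i a} (λ k →
    subst T eq (inInterval-from {b} {l} (InInterval-⊆ {b} {l} {a} 0 i h (subst (λ z → InInterval z i a) (sym (+-identityʳ b)) (inInterval-to {b} {i} k))))))))

  length-filter-cnt : ∀ b l v → length (filterᵇ (inInterval b l) v) ≡ cnt b l v
  length-filter-cnt b l [] = refl
  length-filter-cnt b l (a ∷ v) with inInterval b l a
  ... | true  = cong suc (length-filter-cnt b l v)
  ... | false = length-filter-cnt b l v

  zip-column : ∀ b l → zip (proj₁ (column b l)) (shift b (proj₂ (column b l))) ≡ segment b l
  zip-column b l = go (segment b l) (All.map (λ h → proj₁ (inInterval-to {b} {l} h)) (Allₚ.all-filter (T? ∘ inInterval b l ∘ proj₂) indexed))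
    where
    go : ∀ xs → All (λ x → b < proj₂ x) xs → zip (keys xs) (shift b (map (_∸ b) (values xs))) ≡ xs
    go []             []       = refl
    go ((k , a) ∷ xs) (h ∷ hs) = cong₂ (λ x y → (k , x) ∷ y) (m+[n∸m]≡n (<⇒≤ h)) (go xs hs)

  record PrimeBlock (b l : ℕ) : Set where
    field
      nonempty : 1 ≤ l
      begins   : Break u b
      ends     : Break u (b + l)
      inner    : ∀ t → 1 ≤ t → t < l → ¬ Break u (b + t)

  module _ {b l} (pb : PrimeBlock b l) where
    open PrimeBlock pb

    private
      M : Word
      M = proj₂ (column b l)

      bound : ∀ i → i ≤ l → i ≤ cnt b i u
      bound i i≤l = +-cancelˡ-≤ b _ _ (begin
        b + i  ≤⟨ proj₂ parking (b + i) (≤-trans (+-monoʳ-≤ b i≤l) (subst (_≤ n) ends (cnt≤length 0 (b + l) u))) ⟩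
        cnt 0 (b + i) u  ≡⟨ cnt-split 0 b i u ⟩
        cnt 0 b u + cnt b i u  ≡⟨ cong (_+ cnt b i u) begins ⟩
        b + cnt b i u  ∎)
        where open ≤-Reasoning

      cnt-M : ∀ i → i ≤ l → cnt 0 i M ≡ cnt b i u
      cnt-M i i≤l = ≡.trans (cong (cnt 0 i) (column-word b l)) (cnt-filter b l i u i≤l)

    length-word : length M ≡ l
    length-word = begin
      length M  ≡⟨ cong length (column-word b l) ⟩
      length (map (_∸ b) (filterᵇ (inInterval b l) u)) ≡⟨ length-map _ (filterᵇ (inInterval b l) u) ⟩
      length (filterᵇ (inInterval b l) u)  ≡⟨ length-filter-cnt b l u ⟩
      cnt b l u  ≡⟨ Break-cnt u b l begins ends ⟩
      l  ∎
      where open ≡-Reasoning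

    length-positions : length (proj₁ (column b l)) ≡ l
    length-positions = ≡.trans (length-map proj₁ (segment b l)) (≡.trans (sym (≡.trans (length-map _ (values (segment b l))) (length-map _ (segment b l)))) length-word)

    cnorm-column : cnorm (proj₁ (column b l)) ≡ l
    cnorm-column with proj₁ (column b l) | length-positions
    ... | []    | e = contradiction nonempty (<⇒≱ (s≤s (≤-reflexive (sym e))))
    ... | x ∷ L | e = e

    private
      parking-M : Parking M
      parking-M = subst Positive (sym (column-word b l)) (Allₚ.map⁺ (All.map (λ h → m<n⇒0<n∸m (proj₁ (inInterval-to {b} {l} h)))
                    (Allₚ.all-filter (T? ∘ inInterval b l) u)))
        , λ i i≤ → let i≤l = subst (i ≤_) length-word i≤ in subst (i ≤_) (sym (cnt-M i i≤l)) (bound i i≤l)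

      -- Parking gives at least i letters, and equality would be an inner break of the block.
      prime-M : ∀ i → 1 ≤ i → i < length M → i < cnt 0 i M
      prime-M i 1≤i i< = subst (i <_) (sym (cnt-M i (<⇒≤ i<l))) (≤∧≢⇒< (bound i (<⇒≤ i<l))
        (λ e → inner i 1≤i i<l (≡.trans (cnt-split 0 b i u) (cong₂ _+_ begins (sym e)))))
        where
        i<l : i < l
        i<l = subst (i <_) length-word i<

    column-valid : ValidColumn (column b l)
    column-valid =
        Linked-map⁺ (Linked-filter⁺ (T? ∘ inInterval b l ∘ proj₂) <-trans (Linked-zip (positions n) u (Linked-applyUpTo⁺₂ suc n (λ i → ≤-refl))))
      , Allₚ.map⁺ (Allₚ.filter⁺ (T? ∘ inInterval b l ∘ proj₂) (Allₚ.map⁻ (subst (All (1 ≤_)) (sym keys-indexed) (Allₚ.applyUpTo⁺₂ suc n (λ i → s≤s z≤n)))))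
      , Parking⇒IsPrimePF M parking-M prime-M
      , ≡.trans length-word (sym length-positions)
      where
      Linked-zip : ∀ (L : List ℕ) (v : Word) → Linked _<_ L → Linked (λ x y → proj₁ x < proj₁ y) (zip L v)
      Linked-zip []          v           _        = []
      Linked-zip (x ∷ L)     []          _        = []
      Linked-zip (x ∷ [])    (y ∷ v)     _        = [-]
      Linked-zip (x ∷ y ∷ L) (a ∷ [])    _        = [-]
      Linked-zip (x ∷ y ∷ L) (a ∷ c ∷ v) (h ∷ hs) = h ∷ Linked-zip (y ∷ L) (c ∷ v) hs

  -- In the positive case both parts are nonempty, hence shorter than `l`; the recursions on
  -- interval lengths rest on this.
  innerBreak? : ∀ b l → (∃ λ s → ∃ λ t → suc s + suc t ≡ l × Break u (b + suc s)) ⊎ (∀ t → 1 ≤ t → t < l → ¬ Break u (b + t))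
  innerBreak? b l with anyUpTo? (λ t → (1 ≤? t) ×-dec (cnt 0 (b + t) u ≟ b + t)) l
  ... | no ¬h = inj₂ (λ t 1≤t t<l e → ¬h (t , t<l , 1≤t , e))
  ... | yes (suc s , s<l , _ , e) with m≤n⇒∃[o]m+o≡n s<l
  ...   | t , eq = inj₁ (s , t , ≡.trans (+-suc (suc s) t) eq , e)

  -- `covers` holds up to order only: the columns list the letters interval by interval, the segment
  -- lists them by position.
  record Segmentation (b l : ℕ) : Set where
    field
      columns   : List Column
      valid     : All ValidColumn columns
      norm≡     : norm columns ≡ l
      covers    : assoc b columns ↭ segment b l

  prime-segmentation : ∀ {b l} → PrimeBlock b l → Segmentation b l
  prime-segmentation {b} {l} pb = record
    { columns = column b l ∷ []
    ; valid   = column-valid pb ∷ []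
    ; norm≡   = ≡.trans (+-identityʳ _) (cnorm-column pb)
    ; covers  = ↭-reflexive (≡.trans (++-identityʳ _) (zip-column b l)) }

  join : ∀ {b} s t → Segmentation b s → Segmentation (b + s) t → Segmentation b (s + t)
  join {b} s t S₁ S₂ = record
    { columns = S₁.columns ++ S₂.columns
    ; valid   = Allₚ.++⁺ S₁.valid S₂.valid
    ; norm≡   = ≡.trans (norm-++ S₁.columns S₂.columns) (cong₂ _+_ S₁.norm≡ S₂.norm≡)
    ; covers  = ↭-trans (↭-reflexive (≡.trans (assoc-++ b S₁.columns S₂.columns)
                  (cong (λ z → assoc b S₁.columns ++ assoc (b + z) S₂.columns) S₁.norm≡)))
                  (↭-trans (++⁺ S₁.covers S₂.covers) (segment-split b s t)) }
    where
    module S₁ = Segmentation S₁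
    module S₂ = Segmentation S₂
    norm-++ : ∀ m m′ → norm (m ++ m′) ≡ norm m + norm m′
    norm-++ []            m′ = refl
    norm-++ ((L , M) ∷ m) m′ = ≡.trans (cong (cnorm L +_) (norm-++ m m′)) (sym (+-assoc (cnorm L) _ _))

  segment-empty : ∀ b → segment b 0 ≡ []
  segment-empty b = go indexed
    where
    go : ∀ (xs : List (ℕ × ℕ)) → filterᵇ (inInterval b 0 ∘ proj₂) xs ≡ []
    go [] = refl
    go (x ∷ xs) rewrite ¬T⇒false {inInterval b 0 (proj₂ x)} (λ h → let (k₁ , k₂) = inInterval-to {b} {0} h in
      <⇒≱ k₁ (subst (proj₂ x ≤_) (+-identityʳ b) k₂)) = go xs

  segmentation : ∀ fuel b l → l ≤ fuel → Break u b → Break u (b + l) → Segmentation b l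
  segmentation fuel b zero _ _ _ = record
    { columns = [] ; valid = [] ; norm≡ = refl ; covers = ↭-reflexive (sym (segment-empty b)) }
  segmentation (suc fuel) b (suc l) (s≤s l≤) e₁ e₂ with innerBreak? b (suc l)
  ... | inj₂ none = prime-segmentation record { nonempty = s≤s z≤n ; begins = e₁ ; ends = e₂ ; inner = none }
  ... | inj₁ (s , t , refl , e) = join (suc s) (suc t)
    (segmentation fuel b (suc s) (≤-trans (≤-trans (s≤s (m≤m+n s t)) (≤-reflexive (sym (+-suc s t)))) l≤) e₁ e)
    (segmentation fuel (b + suc s) (suc t) (≤-trans (m≤n+m (suc t) s) l≤) e (subst (Break u) (sym (+-assoc b (suc s) (suc t))) e₂))

module Realize (u : Word) (parking : Parking u) where
  open Columns u parking

  module _ {o p q} (block₁ : PrimeBlock o p) (block₂ : PrimeBlock (o + p) q) where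

    private
      e≤n : o + p + q ≤ n
      e≤n = subst (_≤ n) (PrimeBlock.ends block₂) (cnt≤length 0 (o + p + q) u)

      rest : ℕ
      rest = n ∸ (o + p + q)

      break-n : Break u (o + p + q + rest)
      break-n = subst (Break u) (sym (m+[n∸m]≡n e≤n)) (≤-antisym (cnt≤length 0 n u) (proj₂ parking n ≤-refl))

      before : Segmentation 0 o
      before = segmentation o 0 o ≤-refl (cnt-zero 0 u) (PrimeBlock.begins block₁)

      after : Segmentation (o + p + q) rest
      after = segmentation rest (o + p + q) rest ≤-refl (PrimeBlock.ends block₂) break-n

      whole : Segmentation 0 (o + (p + (q + rest)))
      whole = join o (p + (q + rest)) before (join p (q + rest) (prime-segmentation block₁) (join q rest (prime-segmentation block₂) after))

      module W = Segmentation whole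

      whole≡n : o + (p + (q + rest)) ≡ n
      whole≡n = ≡.trans (≡.trans (sym (+-assoc o p (q + rest))) (sym (+-assoc (o + p) q rest))) (m+[n∸m]≡n e≤n)

      pre : List Column
      pre = Segmentation.columns before

      -- By computation this is `W.columns`, written so as to show the two blocks as neighbours.
      m : List Column
      m = pre ++ column o p ∷ column (o + p) q ∷ Segmentation.columns after

      covers : assoc 0 m ↭ indexed
      covers = ↭-trans W.covers (↭-reflexive (≡.trans (cong (segment 0) whole≡n) segment-all))

      concat-keys : concatMap proj₁ m ↭ positions n
      concat-keys = ↭-trans (↭-reflexive (sym (keys-assoc 0 W.valid)))
        (↭-trans (map⁺ proj₁ covers) (↭-reflexive keys-indexed))

      length-m : length (concatMap proj₁ m) ≡ n
      length-m = ≡.trans (↭-length concat-keys) (length-applyUpTo suc n)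

      valid : ValidBW m
      valid = W.valid , subst (λ z → concatMap proj₁ m ↭ positions z) (sym length-m) concat-keys

      Φ≡u : Φ m ≡ u
      Φ≡u = begin
        readout (length (concatMap proj₁ m)) (assoc 0 m)  ≡⟨ cong (λ z → readout z (assoc 0 m)) length-m ⟩
        readout n (assoc 0 m)  ≡⟨ readout-↭ n covers (Unique-↭ (↭-sym (↭-trans (map⁺ proj₁ covers) (↭-reflexive keys-indexed))) (Unique-positions n)) ⟩
        map (λ k → lookupAssoc k indexed) (positions n)  ≡⟨ cong (map (λ k → lookupAssoc k indexed)) (sym keys-indexed) ⟩
        map (λ k → lookupAssoc k indexed) (keys indexed)  ≡⟨ lookup-keys indexed (subst Unique (sym keys-indexed) (Unique-positions n)) ⟩
        values indexed  ≡⟨ values-indexed ⟩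
        u  ∎
        where open ≡-Reasoning

      i : ℕ
      i = length pre

      colAt-++ : ∀ m′ {m″} j → colAt (m′ ++ m″) (length m′ + j) ≡ colAt m″ j
      colAt-++ []       j = refl
      colAt-++ (c ∷ m′) j = colAt-++ m′ j

      applyUpTo-colAt : ∀ m′ {m″} → applyUpTo (colAt (m′ ++ m″)) (length m′) ≡ m′
      applyUpTo-colAt []       = refl
      applyUpTo-colAt (c ∷ m′) = cong (c ∷_) (applyUpTo-colAt m′)

      at-i : colAt m i ≡ column o p
      at-i = ≡.trans (cong (colAt m) (sym (+-identityʳ i))) (colAt-++ pre 0)

      at-suc-i : colAt m (suc i) ≡ column (o + p) q
      at-suc-i = ≡.trans (cong (colAt m) (+-comm 1 i)) (colAt-++ pre 1)

      Φ-swapped : Φ (swapCols i m) ≡ map (blockSwap o p q) u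
      Φ-swapped = begin
        Φ (swapCols i m) ≡⟨ SwapAt.Φ-swapCols i m valid ⟩
        map (blockSwap (norm (applyUpTo (colAt m) i)) (cnorm (proj₁ (colAt m i))) (cnorm (proj₁ (colAt m (suc i))))) (Φ m)
          ≡⟨ cong₂ (λ x y → map (blockSwap (norm x) (cnorm (proj₁ (colAt m i))) (cnorm (proj₁ (colAt m (suc i))))) y) (applyUpTo-colAt pre) Φ≡u ⟩
        map (blockSwap (norm pre) (cnorm (proj₁ (colAt m i))) (cnorm (proj₁ (colAt m (suc i))))) u
          ≡⟨ cong₂ (λ x y → map (blockSwap (norm pre) (cnorm (proj₁ x)) (cnorm (proj₁ y))) u) at-i at-suc-i ⟩
        map (blockSwap (norm pre) (cnorm (proj₁ (column o p))) (cnorm (proj₁ (column (o + p) q)))) u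
          ≡⟨ cong₂ (λ x y → map (blockSwap (norm pre) x y) u) (cnorm-column block₁) (cnorm-column block₂) ⟩
        map (blockSwap (norm pre) p q) u ≡⟨ cong (λ x → map (blockSwap x p q) u) (Segmentation.norm≡ before) ⟩
        map (blockSwap o p q) u ∎
        where open ≡-Reasoning

      act-swapCols : ∀ r → Small r p ⊎ Small r q → act r i m ≡ swapCols i m
      act-swapCols r small = cong (λ b → if b then swapCols i m else m) (T⇒true (Equivalence.from (T-∨ {short r (proj₂ (colAt m i))})
        (Sum.map (λ h → Small⇒short r _ (subst (Small r) (sym (≡.trans (cong (length ∘ proj₂) at-i) (length-word block₁))) h))
                 (λ h → Small⇒short r _ (subst (Small r) (sym (≡.trans (cong (length ∘ proj₂) at-suc-i) (length-word block₂))) h)) small)))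

    -- The witness is `u` cut into columns at its breaks. The two blocks are then adjacent columns,
    -- and the generator is indexed by the number of columns before them.
    prime-swap-acts : ∀ r → Small r p ⊎ Small r q →
      ∃ λ i → ∃ λ m → ValidBW m × Φ m ≡ u × Φ (act r i m) ≡ map (blockSwap o p q) u
    prime-swap-acts r small = i , m , valid , Φ≡u , ≡.trans (cong Φ (act-swapCols r small)) Φ-swapped

-- Decomposition of exchanges

blockSwap-zeroˡ : ∀ o q a → blockSwap o 0 q a ≡ a
blockSwap-zeroˡ o q a with locate o 0 q a
... | low h      = blockSwap-low o 0 q h
... | inSecond t h = ≡.trans (blockSwap-second o 0 q h) (cong (_+ suc t) (sym (+-identityʳ o)))
... | high t     = blockSwap-high o 0 q

blockSwap-zeroʳ : ∀ o p a → blockSwap o p 0 a ≡ a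
blockSwap-zeroʳ o p a = ≡.trans (sym (blockSwap-zeroˡ o p (blockSwap o p 0 a))) (blockSwap-involutive o p 0 a)

-- The part of length t, adjacent to the second interval, passes it first, then the part of length s
-- does, as in a product of adjacent transpositions.
blockSwap-splitˡ : ∀ o s t q a → blockSwap o s q (blockSwap (o + s) t q a) ≡ blockSwap o (s + t) q a
blockSwap-splitˡ o s t q a with locate (o + s) t q a
... | low h = ≡.trans (cong (blockSwap o s q) (blockSwap-low (o + s) t q h)) (go (locate o s q a))
  where
  go : Location o s q a → blockSwap o s q a ≡ blockSwap o (s + t) q a
  go (low h′)       = ≡.trans (blockSwap-low o s q h′) (sym (blockSwap-low o (s + t) q h′))
  go (inFirst x h′) = ≡.trans (blockSwap-first o s q h′) (sym (blockSwap-first o (s + t) q (≤-trans h′ (m≤m+n s t))))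
  go (inSecond x _) = contradiction h (m+1+n≰m (o + s))
  go (high x)       = contradiction (≤-trans h (m≤m+n (o + s) q)) (m+1+n≰m (o + s + q))
... | inFirst x h = begin
  blockSwap o s q (blockSwap (o + s) t q (o + s + suc x)) ≡⟨ cong (blockSwap o s q) (blockSwap-first (o + s) t q h) ⟩
  blockSwap o s q (o + s + q + suc x)  ≡⟨ blockSwap-high o s q ⟩
  o + s + q + suc x  ≡⟨ cong (_+ suc x) (+-swap o s q) ⟩
  o + q + s + suc x  ≡⟨ +-assoc (o + q) s (suc x) ⟩
  o + q + (s + suc x)  ≡⟨ cong (o + q +_) (+-suc s x) ⟩
  o + q + suc (s + x)  ≡⟨ sym (blockSwap-first o (s + t) q (subst (_≤ s + t) (+-suc s x) (+-monoʳ-≤ s h))) ⟩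
  blockSwap o (s + t) q (o + suc (s + x))  ≡⟨ cong (blockSwap o (s + t) q) (≡.trans (cong (o +_) (sym (+-suc s x))) (sym (+-assoc o s (suc x)))) ⟩
  blockSwap o (s + t) q (o + s + suc x)  ∎
  where open ≡-Reasoning
... | inSecond x h = begin
  blockSwap o s q (blockSwap (o + s) t q (o + s + t + suc x)) ≡⟨ cong (blockSwap o s q) (blockSwap-second (o + s) t q h) ⟩
  blockSwap o s q (o + s + suc x)  ≡⟨ blockSwap-second o s q h ⟩
  o + suc x  ≡⟨ sym (blockSwap-second o (s + t) q h) ⟩
  blockSwap o (s + t) q (o + (s + t) + suc x)  ≡⟨ cong (λ z → blockSwap o (s + t) q (z + suc x)) (sym (+-assoc o s t)) ⟩
  blockSwap o (s + t) q (o + s + t + suc x)  ∎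
  where open ≡-Reasoning
... | high x = begin
  blockSwap o s q (blockSwap (o + s) t q (o + s + t + q + suc x)) ≡⟨ cong (blockSwap o s q) (blockSwap-high (o + s) t q) ⟩
  blockSwap o s q (o + s + t + q + suc x)  ≡⟨ cong (blockSwap o s q) e ⟩
  blockSwap o s q (o + s + q + suc (t + x))  ≡⟨ blockSwap-high o s q ⟩
  o + s + q + suc (t + x)  ≡⟨ sym e ⟩
  o + s + t + q + suc x  ≡⟨ cong (λ z → z + q + suc x) (+-assoc o s t) ⟩
  o + (s + t) + q + suc x  ≡⟨ sym (blockSwap-high o (s + t) q) ⟩
  blockSwap o (s + t) q (o + (s + t) + q + suc x)  ≡⟨ cong (λ z → blockSwap o (s + t) q (z + q + suc x)) (sym (+-assoc o s t)) ⟩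
  blockSwap o (s + t) q (o + s + t + q + suc x)  ∎
  where
  open ≡-Reasoning
  e : o + s + t + q + suc x ≡ o + s + q + suc (t + x)
  e = ≡.trans (cong (_+ suc x) (+-swap (o + s) t q)) (≡.trans (+-assoc (o + s + q) t (suc x)) (cong (o + s + q +_) (+-suc t x)))

-- Obtained by taking inverses on both sides of `blockSwap-splitˡ`.
blockSwap-splitʳ : ∀ o p t s a → blockSwap (o + t) p s (blockSwap o p t a) ≡ blockSwap o p (t + s) a
blockSwap-splitʳ o p t s a = begin
  blockSwap (o + t) p s (blockSwap o p t a)  ≡⟨ cong (blockSwap (o + t) p s ∘ blockSwap o p t) (sym undone) ⟩
  blockSwap (o + t) p s (blockSwap o p t (blockSwap o t p (blockSwap (o + t) s p y))) ≡⟨ cong (blockSwap (o + t) p s) (blockSwap-involutive o t p (blockSwap (o + t) s p y)) ⟩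
  blockSwap (o + t) p s (blockSwap (o + t) s p y)  ≡⟨ blockSwap-involutive (o + t) s p y ⟩
  y  ∎
  where
  open ≡-Reasoning
  y : ℕ
  y = blockSwap o p (t + s) a
  undone : blockSwap o t p (blockSwap (o + t) s p y) ≡ a
  undone = ≡.trans (blockSwap-splitˡ o t s p y) (blockSwap-involutive o p (t + s) a)

module _ {r u o s t q} (sw : Swappable r u o (s + t) q) (e : Break u (o + s)) where
  open Swappable sw

  -- A part of a small interval is small, and the other interval stays as it is. So both factors of
  -- the decomposed exchange are admissible.
  swappable-splitˡ₁ : Swappable r u (o + s) t q
  swappable-splitˡ₁ = record
    { parking = parking ; break₀ = e ; break₁ = subst (Break u) (sym (+-assoc o s t)) break₁
    ; break₂ = subst (λ z → Break u (z + q)) (sym (+-assoc o s t)) break₂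
    ; small = Sum.map₁ (Small-≤ r (m≤n+m t s)) small }

  swappable-splitˡ₂ : Swappable r (map (blockSwap (o + s) t q) u) o s q
  swappable-splitˡ₂ = record
    { parking = swapped-parking swappable-splitˡ₁
    ; break₀ = ≡.trans (cnt-swap-low (o + s) t q u 0 o (m≤m+n o s)) break₀
    ; break₁ = Swappable.break₀ (swappable-sym swappable-splitˡ₁)
    ; break₂ = Swappable.break₁ (swappable-sym swappable-splitˡ₁)
    ; small = Sum.map₁ (Small-≤ r (m≤m+n s t)) small }

module _ {r u o p t s} (sw : Swappable r u o p (t + s)) (e : Break u (o + p + t)) where
  open Swappable sw

  swappable-splitʳ₁ : Swappable r u o p t
  swappable-splitʳ₁ = record
    { parking = parking ; break₀ = break₀ ; break₁ = break₁ ; break₂ = e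
    ; small = Sum.map₂ (Small-≤ r (m≤m+n t s)) small }

  private
    u₁ : Word
    u₁ = map (blockSwap o p t) u

    last : Break u₁ (o + p + t + s)
    last = begin
      cnt 0 (o + p + t + s) u₁  ≡⟨ cnt-split 0 (o + p + t) s u₁ ⟩
      cnt 0 (o + p + t) u₁ + cnt (o + p + t) s u₁  ≡⟨ cong₂ _+_ (cnt-swap-to-end o p t u) (cnt-swap-high₀ o p t u s) ⟩
      cnt 0 (o + p + t) u + cnt (o + p + t) s u  ≡⟨ sym (cnt-split 0 (o + p + t) s u) ⟩
      cnt 0 (o + p + t + s) u  ≡⟨ subst (Break u) (sym (+-assoc (o + p) t s)) break₂ ⟩
      o + p + t + s  ∎
      where open ≡-Reasoning

  swappable-splitʳ₂ : Swappable r (map (blockSwap o p t) u) (o + t) p s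
  swappable-splitʳ₂ = record
    { parking = swapped-parking swappable-splitʳ₁
    ; break₀ = Swappable.break₁ (swappable-sym swappable-splitʳ₁)
    ; break₁ = Swappable.break₂ (swappable-sym swappable-splitʳ₁)
    ; break₂ = subst (λ z → Break u₁ (z + s)) (+-swap o p t) last
    ; small = Sum.map₂ (Small-≤ r (m≤n+m s t)) small }

-- The two descriptions of invariance

module _ {c ℓ} (S : Setoid c ℓ) (r : Rank) (f : Word → Setoid.Carrier S) where
  open Setoid S using (_≈_) renaming (refl to ≈-refl; sym to ≈-sym; trans to ≈-trans; reflexive to ≈-reflexive)

  ActInvariant : Set ℓ
  ActInvariant = ∀ i m → ValidBW m → f (Park (Φ (act r i m))) ≈ f (Park (Φ m))

  SwapInvariant : Set ℓ
  SwapInvariant = ∀ {u o p q} → Swappable r u o p q → f (map (blockSwap o p q) u) ≈ f u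

  swap⇒act : SwapInvariant → ActInvariant
  swap⇒act inv i m valid with act-swaps r i m valid
  ... | inj₁ e = ≈-reflexive (cong f e)
  ... | inj₂ (o , p , q , sw , e) = ≈-trans (≈-reflexive (cong f e)) (inv sw)

  module _ (inv : ActInvariant) where

    private
      Prime : Word → ℕ → ℕ → Set
      Prime u b l = ∀ t → 1 ≤ t → t < l → ¬ Break u (b + t)

      -- `u` and its exchange are both parking functions, so the parkizations in `ActInvariant`
      -- disappear.
      prime-case : ∀ {u o p q} → Swappable r u o (suc p) (suc q) → Prime u o (suc p) → Prime u (o + suc p) (suc q) →
        f (map (blockSwap o (suc p) (suc q)) u) ≈ f u
      prime-case {u} {o} {p} {q} sw none₁ none₂ = go (Realize.prime-swap-acts u parking
          record { nonempty = s≤s z≤n ; begins = break₀ ; ends = break₁ ; inner = none₁ }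
          record { nonempty = s≤s z≤n ; begins = break₁ ; ends = break₂ ; inner = none₂ } r small)
        where
        open Swappable sw
        go : (∃ λ i → ∃ λ m → ValidBW m × Φ m ≡ u × Φ (act r i m) ≡ map (blockSwap o (suc p) (suc q)) u) →
             f (map (blockSwap o (suc p) (suc q)) u) ≈ f u
        go (i , m , valid , e , e′) = ≈-trans (≈-reflexive (cong f (sym (≡.trans (cong Park e′) (Park-swappable sw)))))
          (≈-trans (inv i m valid) (≈-reflexive (cong f (≡.trans (cong Park e) (Park-id parking)))))

      composedˡ : ∀ u o s t q → map (blockSwap o (s + t) q) u ≡ map (blockSwap o s q) (map (blockSwap (o + s) t q) u)
      composedˡ u o s t q = ≡.trans (map-cong-local (All.universal (λ a → sym (blockSwap-splitˡ o s t q a)) u)) (map-∘ u)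

      composedʳ : ∀ u o p t s → map (blockSwap o p (t + s)) u ≡ map (blockSwap (o + t) p s) (map (blockSwap o p t) u)
      composedʳ u o p t s = ≡.trans (map-cong-local (All.universal (λ a → sym (blockSwap-splitʳ o p t s a)) u)) (map-∘ u)

    -- A swap of intervals that are not prime is a composition of swaps of shorter ones.
    act⇒swap′ : ∀ fuel u o p q → p + q ≤ fuel → Swappable r u o p q → f (map (blockSwap o p q) u) ≈ f u
    act⇒swap′ fuel u o zero q _ sw =
      ≈-reflexive (cong f (map-id-local (All.universal (blockSwap-zeroˡ o q) u)))
    act⇒swap′ fuel u o (suc p) zero _ sw =
      ≈-reflexive (cong f (map-id-local (All.universal (blockSwap-zeroʳ o (suc p)) u)))
    act⇒swap′ (suc fuel) u o (suc p) (suc q) (s≤s pq≤) sw =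
      go (Columns.innerBreak? u parking o (suc p)) (Columns.innerBreak? u parking (o + suc p) (suc q))
      where
      open Swappable sw
      splitˡ : ∀ {s t} → suc s + suc t ≡ suc p → Break u (o + suc s) → f (map (blockSwap o (suc p) (suc q)) u) ≈ f u
      splitˡ {s} {t} refl e = ≈-trans (≈-reflexive (cong f (composedˡ u o (suc s) (suc t) (suc q))))
        (≈-trans (act⇒swap′ fuel _ o (suc s) (suc q)
                   (≤-trans (+-monoˡ-≤ (suc q) (subst (suc s ≤_) (sym (+-suc s t)) (s≤s (m≤m+n s t)))) pq≤) (swappable-splitˡ₂ sw e))
                 (act⇒swap′ fuel u (o + suc s) (suc t) (suc q) (≤-trans (+-monoˡ-≤ (suc q) (m≤n+m (suc t) s)) pq≤) (swappable-splitˡ₁ sw e)))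
      splitʳ : ∀ {t s} → suc t + suc s ≡ suc q → Break u (o + suc p + suc t) → f (map (blockSwap o (suc p) (suc q)) u) ≈ f u
      splitʳ {t} {s} refl e = ≈-trans (≈-reflexive (cong f (composedʳ u o (suc p) (suc t) (suc s))))
        (≈-trans (act⇒swap′ fuel _ (o + suc t) (suc p) (suc s)
                   (≤-trans (subst (_≤ p + suc (t + suc s)) (+-suc p (suc s)) (+-monoʳ-≤ p (s≤s (m≤n+m (suc s) t)))) pq≤) (swappable-splitʳ₂ sw e))
                 (act⇒swap′ fuel u o (suc p) (suc t)
                   (≤-trans (subst (_≤ p + suc (t + suc s)) (+-suc p (suc t)) (+-monoʳ-≤ p (s≤s (subst (suc t ≤_) (sym (+-suc t s)) (s≤s (m≤m+n t s)))))) pq≤) (swappable-splitʳ₁ sw e)))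
      go : (∃ λ s → ∃ λ t → suc s + suc t ≡ suc p × Break u (o + suc s)) ⊎ Prime u o (suc p) →
           (∃ λ s → ∃ λ t → suc s + suc t ≡ suc q × Break u (o + suc p + suc s)) ⊎ Prime u (o + suc p) (suc q) →
           f (map (blockSwap o (suc p) (suc q)) u) ≈ f u
      go (inj₁ (s , t , eq , e)) _ = splitˡ eq e
      go (inj₂ _) (inj₁ (t , s , eq , e)) = splitʳ eq e
      go (inj₂ none₁) (inj₂ none₂) = prime-case sw none₁ none₂

    act⇒swap : SwapInvariant
    act⇒swap {u} {o} {p} {q} = act⇒swap′ (p + q) u o p q ≤-refl

-- Enumerations

Unique-concatMap : ∀ {a b} {A : Set a} {B : Set b} (h : A → List B) {xs} → Unique xs → (∀ x → Unique (h x)) →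
  (∀ {x y z} → z ∈ h x → z ∈ h y → x ≡ y) → Unique (concatMap h xs)
Unique-concatMap h [] uh inj = []
Unique-concatMap h {x ∷ xs} (x∉ ∷ u) uh inj = Uniqueₚ.++⁺ (uh x) (Unique-concatMap h u uh inj)
  λ (z∈ , z∈′) → let (y , y∈ , z∈hy) = find (∈-concatMap⁻ h z∈′) in All.lookup x∉ y∈ (inj z∈ z∈hy)

∈-wordsOver⁺ : ∀ {k} w → All (InInterval 0 k) w → w ∈ wordsOver (length w) k
∈-wordsOver⁺ []          []       = here refl
∈-wordsOver⁺ {k} (suc a ∷ w) ((_ , h) ∷ hs) = ∈-concatMap⁺ (λ a → map (a ∷_) (wordsOver (length w) k))
  (lose (∈-applyUpTo⁺ suc h) (∈-map⁺ (suc a ∷_) (∈-wordsOver⁺ w hs)))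

∈-wordsOver⁻ : ∀ n {k w} → w ∈ wordsOver n k → length w ≡ n
∈-wordsOver⁻ zero    (here refl) = refl
∈-wordsOver⁻ (suc n) {k} {w} w∈ with find (∈-concatMap⁻ (λ a → map (a ∷_) (wordsOver n k)) {xs = positions k} w∈)
... | a , _ , w∈′ with ∈-map⁻ (a ∷_) w∈′
...   | w′ , w′∈ , refl = cong suc (∈-wordsOver⁻ n w′∈)

Unique-wordsOver : ∀ n k → Unique (wordsOver n k)
Unique-wordsOver zero    k = [] ∷ []
Unique-wordsOver (suc n) k = Unique-concatMap _ (Unique-positions k)
  (λ a → Uniqueₚ.map⁺ (λ e → proj₂ (∷-injective e)) (Unique-wordsOver n k))
  (λ {a} {b} z∈ z∈′ → let (_ , _ , e) = ∈-map⁻ (a ∷_) z∈ ; (_ , _ , e′) = ∈-map⁻ (b ∷_) z∈′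
                      in proj₁ (∷-injective (≡.trans (sym e) e′)))

∈-pfs⁺ : ∀ {w} → Parking w → w ∈ pfs (length w)
∈-pfs⁺ {w} h = ∈-filter⁺ (T? ∘ isPF) (∈-wordsOver⁺ w (Parking⇒≤length h)) (Parking⇒IsPF w h)

∈-pfs⁻ : ∀ n {w} → w ∈ pfs n → length w ≡ n × Parking w
∈-pfs⁻ n {w} w∈ with ∈-filter⁻ (T? ∘ isPF) {xs = wordsOver n n} w∈
... | w∈′ , h = ∈-wordsOver⁻ n w∈′ , IsPF⇒Parking w h

Unique-pfs : ∀ n → Unique (pfs n)
Unique-pfs n = Uniqueₚ.filter⁺ (T? ∘ isPF) (Unique-wordsOver n n)

==-refl : ∀ u → (u == u) ≡ true
==-refl u = dec-true (≡-dec _≟_ u u) refl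

==-≢ : ∀ {u v} → u ≢ v → (u == v) ≡ false
==-≢ {u} {v} = dec-false (≡-dec _≟_ u v)

==⇒≡ : ∀ {u v} → T (u == v) → u ≡ v
==⇒≡ {u} {v} h with ≡-dec _≟_ u v
... | yes e = e

≡⇒== : ∀ {u v} → u ≡ v → T (u == v)
≡⇒== {u} refl = subst T (sym (==-refl u)) tt

-- Shuffles

shuffles : Word → Word → List Word
shuffles []      c       = c ∷ []
shuffles (x ∷ a) []      = (x ∷ a) ∷ []
shuffles (x ∷ a) (y ∷ c) = map (x ∷_) (shuffles a (y ∷ c)) ++ map (y ∷_) (shuffles (x ∷ a) c)

isShuffle⇒∈ : ∀ u a c → T (isShuffle u a c) → u ∈ shuffles a c
isShuffle⇒∈ []      []      []      h = here refl
isShuffle⇒∈ (z ∷ u) []      c       h = here (==⇒≡ h)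
isShuffle⇒∈ (z ∷ u) (x ∷ a) []      h = here (==⇒≡ h)
isShuffle⇒∈ (z ∷ u) (x ∷ a) (y ∷ c) h with Equivalence.to (T-∨ {(x ≡ᵇ z) ∧ isShuffle u a (y ∷ c)}) h
... | inj₁ h₁ with Equivalence.to (T-∧ {x ≡ᵇ z}) h₁
...   | e , h′ rewrite ≡ᵇ⇒≡ x z e = ∈-++⁺ˡ (∈-map⁺ (z ∷_) (isShuffle⇒∈ u a (y ∷ c) h′))
isShuffle⇒∈ (z ∷ u) (x ∷ a) (y ∷ c) h | inj₂ h₂ with Equivalence.to (T-∧ {y ≡ᵇ z}) h₂
...   | e , h′ rewrite ≡ᵇ⇒≡ y z e = ∈-++⁺ʳ (map (x ∷_) (shuffles a (z ∷ c))) (∈-map⁺ (z ∷_) (isShuffle⇒∈ u (x ∷ a) c h′))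

∈⇒isShuffle : ∀ {u} a c → u ∈ shuffles a c → T (isShuffle u a c)
∈⇒isShuffle []      []      (here refl) = tt
∈⇒isShuffle []      (y ∷ c) (here refl) = ≡⇒== {y ∷ c} refl
∈⇒isShuffle (x ∷ a) []      (here refl) = ≡⇒== {x ∷ a} refl
∈⇒isShuffle (x ∷ a) (y ∷ c) u∈ with ∈-++⁻ (map (x ∷_) (shuffles a (y ∷ c))) u∈
... | inj₁ h with ∈-map⁻ (x ∷_) h
...   | u , u∈′ , refl = Equivalence.from (T-∨ {(x ≡ᵇ x) ∧ isShuffle u a (y ∷ c)})
        (inj₁ (Equivalence.from T-∧ (≡⇒≡ᵇ x x refl , ∈⇒isShuffle a (y ∷ c) u∈′)))
∈⇒isShuffle (x ∷ a) (y ∷ c) u∈ | inj₂ h with ∈-map⁻ (y ∷_) h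
...   | u , u∈′ , refl = Equivalence.from (T-∨ {(x ≡ᵇ y) ∧ isShuffle u a (y ∷ c)})
        (inj₂ (Equivalence.from T-∧ (≡⇒≡ᵇ y y refl , ∈⇒isShuffle (x ∷ a) c u∈′)))

-- The separating value `k` shows from which of the two words a first letter was taken.
Unique-shuffles : ∀ {k} a c → All (_≤ k) a → All (k <_) c → Unique (shuffles a c)
Unique-shuffles []      c       _ _ = [] ∷ []
Unique-shuffles (x ∷ a) []      _ _ = [] ∷ []
Unique-shuffles (x ∷ a) (y ∷ c) (h ∷ hs) (h′ ∷ hs′) = Uniqueₚ.++⁺
  (Uniqueₚ.map⁺ (proj₂ ∘ ∷-injective) (Unique-shuffles a (y ∷ c) hs (h′ ∷ hs′)))
  (Uniqueₚ.map⁺ (proj₂ ∘ ∷-injective) (Unique-shuffles (x ∷ a) c (h ∷ hs) hs′))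
  λ (z∈ , z∈′) → let (_ , _ , e) = ∈-map⁻ (x ∷_) z∈ ; (_ , _ , e′) = ∈-map⁻ (y ∷_) z∈′
                 in <⇒≢ (≤-<-trans h h′) (proj₁ (∷-injective (≡.trans (sym e) e′)))

∈-shuffles⇒↭ : ∀ {u} a c → u ∈ shuffles a c → u ↭ a ++ c
∈-shuffles⇒↭ []      c       (here refl) = refl
∈-shuffles⇒↭ (x ∷ a) []      (here refl) = ↭-reflexive (sym (++-identityʳ (x ∷ a)))
∈-shuffles⇒↭ (x ∷ a) (y ∷ c) u∈ with ∈-++⁻ (map (x ∷_) (shuffles a (y ∷ c))) u∈
... | inj₁ h with ∈-map⁻ (x ∷_) h
...   | u , u∈′ , refl = prep x (∈-shuffles⇒↭ a (y ∷ c) u∈′)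
∈-shuffles⇒↭ (x ∷ a) (y ∷ c) u∈ | inj₂ h with ∈-map⁻ (y ∷_) h
...   | u , u∈′ , refl = ↭-trans (prep y (∈-shuffles⇒↭ (x ∷ a) c u∈′)) (rotate (x ∷ a) (y ∷ []) c)

-- Holds for every `g`, since `shuffles` never compares letters. It lets an exchange act on all
-- shuffles at once.
map-shuffles : ∀ g a c → map (map g) (shuffles a c) ≡ shuffles (map g a) (map g c)
map-shuffles g []      c       = refl
map-shuffles g (x ∷ a) []      = refl
map-shuffles g (x ∷ a) (y ∷ c) = ≡.trans (map-++ (map g) (map (x ∷_) (shuffles a (y ∷ c))) _) (cong₂ _++_
  (≡.trans (map-map-∷ x (shuffles a (y ∷ c))) (cong (map (g x ∷_)) (map-shuffles g a (y ∷ c))))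
  (≡.trans (map-map-∷ y (shuffles (x ∷ a) c)) (cong (map (g y ∷_)) (map-shuffles g (x ∷ a) c))))
  where
  map-map-∷ : ∀ x us → map (map g) (map (x ∷_) us) ≡ map (g x ∷_) (map (map g) us)
  map-map-∷ x us = ≡.trans (sym (map-∘ us)) (map-∘ us)

shuffles-comm : ∀ a c → shuffles a c ↭ shuffles c a
shuffles-comm []      []      = refl
shuffles-comm []      (y ∷ c) = refl
shuffles-comm (x ∷ a) []      = refl
shuffles-comm (x ∷ a) (y ∷ c) = ↭-trans (++-comm (map (x ∷_) (shuffles a (y ∷ c))) _)
  (++⁺ (map⁺ (y ∷_) (shuffles-comm (x ∷ a) c)) (map⁺ (x ∷_) (shuffles-comm a (y ∷ c))))

-- Finite sums

module Sums {c ℓ} (F : Field c ℓ) where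
  open Field F public
    using (Carrier; _≈_; 0#; 1#; setoid; zeroˡ; zeroʳ; distribˡ; distribʳ)
    renaming (_+_ to _⊕_; _*_ to _⊛_; -_ to ⊖_; refl to ≈-refl; sym to ≈-sym; trans to ≈-trans; reflexive to ≈-reflexive
             ; *-cong to ⊛-cong; +-cong to ⊕-cong; +-identityˡ to ⊕-identityˡ; *-identityˡ to ⊛-identityˡ
             ; +-identityʳ to ⊕-identityʳ; *-identityʳ to ⊛-identityʳ; *-assoc to ⊛-assoc; *-comm to ⊛-comm; +-comm to ⊕-comm; +-assoc to ⊕-assoc
             ; +-commutativeSemigroup to ⊕-commutativeSemigroup)
  open PQ F using (sumK)
  open SetoidReasoning setoid

  private
    variable
      a b : Level
      A : Set a
      B : Set b

  ∑ : List A → (A → Carrier) → Carrier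
  ∑ xs g = sumK (map g xs)

  𝟙 : Bool → Carrier
  𝟙 b = if b then 1# else 0#

  ∑-cong : ∀ (xs : List A) {g h} → (∀ {x} → x ∈ xs → g x ≈ h x) → ∑ xs g ≈ ∑ xs h
  ∑-cong []       e = ≈-refl
  ∑-cong (x ∷ xs) e = ⊕-cong (e (here refl)) (∑-cong xs (e ∘ there))

  ∑-map : ∀ (h : A → B) xs g → ∑ (map h xs) g ≡ ∑ xs (g ∘ h)
  ∑-map h xs g = cong sumK (sym (map-∘ xs))

  ∑-++ : ∀ (xs ys : List A) g → ∑ (xs ++ ys) g ≈ ∑ xs g ⊕ ∑ ys g
  ∑-++ []       ys g = ≈-sym (⊕-identityˡ _)
  ∑-++ (x ∷ xs) ys g = ≈-trans (⊕-cong ≈-refl (∑-++ xs ys g)) (≈-sym (⊕-assoc _ _ _))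

  ∑-concatMap : ∀ (h : A → List B) xs g → ∑ (concatMap h xs) g ≈ ∑ xs (λ x → ∑ (h x) g)
  ∑-concatMap h []       g = ≈-refl
  ∑-concatMap h (x ∷ xs) g = ≈-trans (∑-++ (h x) (concatMap h xs) g) (⊕-cong ≈-refl (∑-concatMap h xs g))

  ∑-zero : ∀ (xs : List A) {g} → (∀ {x} → x ∈ xs → g x ≈ 0#) → ∑ xs g ≈ 0#
  ∑-zero []       e = ≈-refl
  ∑-zero (x ∷ xs) e = ≈-trans (⊕-cong (e (here refl)) (∑-zero xs (e ∘ there))) (⊕-identityˡ 0#)

  ∑-⊕ : ∀ (xs : List A) g h → ∑ xs (λ x → g x ⊕ h x) ≈ ∑ xs g ⊕ ∑ xs h
  ∑-⊕ []       g h = ≈-sym (⊕-identityˡ 0#)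
  ∑-⊕ (x ∷ xs) g h = ≈-trans (⊕-cong ≈-refl (∑-⊕ xs g h)) (interchange⊕ _ _ _ _)
    where open CommutativeSemigroupₚ ⊕-commutativeSemigroup renaming (interchange to interchange⊕)

  ∑-⊛ˡ : ∀ (xs : List A) k g → ∑ xs (λ x → k ⊛ g x) ≈ k ⊛ ∑ xs g
  ∑-⊛ˡ []       k g = ≈-sym (zeroʳ k)
  ∑-⊛ˡ (x ∷ xs) k g = ≈-trans (⊕-cong ≈-refl (∑-⊛ˡ xs k g)) (≈-sym (distribˡ k _ _))

  ∑-⊛ʳ : ∀ (xs : List A) k g → ∑ xs (λ x → g x ⊛ k) ≈ ∑ xs g ⊛ k
  ∑-⊛ʳ xs k g = ≈-trans (∑-cong xs (λ _ → ⊛-comm _ _)) (≈-trans (∑-⊛ˡ xs k g) (⊛-comm _ _))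

  ∑-neg : ∀ (xs : List A) g → ∑ xs (λ x → ⊖ g x) ≈ ⊖ ∑ xs g
  ∑-neg []       g = ≈-sym -0#≈0#
    where open Ringₚ (Field.ring F)
  ∑-neg (x ∷ xs) g = ≈-trans (⊕-cong ≈-refl (∑-neg xs g)) (-‿+-comm _ _)
    where open Ringₚ (Field.ring F)

  ∑-swap : ∀ (xs : List A) (ys : List B) (g : A → B → Carrier) → ∑ xs (λ x → ∑ ys (g x)) ≈ ∑ ys (λ y → ∑ xs (λ x → g x y))
  ∑-swap []       ys g = ≈-sym (∑-zero ys (λ _ → ≈-refl))
  ∑-swap (x ∷ xs) ys g = ≈-trans (⊕-cong ≈-refl (∑-swap xs ys g)) (≈-sym (∑-⊕ ys (g x) _))

  ∑-filter : ∀ p (xs : List A) g → ∑ (filterᵇ p xs) g ≈ ∑ xs (λ x → 𝟙 (p x) ⊛ g x)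
  ∑-filter p []       g = ≈-refl
  ∑-filter p (x ∷ xs) g with p x
  ... | true  = ⊕-cong (≈-sym (⊛-identityˡ _)) (∑-filter p xs g)
  ... | false = ≈-trans (∑-filter p xs g) (≈-trans (≈-sym (⊕-identityˡ _)) (⊕-cong (≈-sym (zeroˡ _)) ≈-refl))

  ∑-↭ : ∀ {xs ys : List A} g → xs ↭ ys → ∑ xs g ≈ ∑ ys g
  ∑-↭ g refl          = ≈-refl
  ∑-↭ g (prep x π)    = ⊕-cong ≈-refl (∑-↭ g π)
  ∑-↭ g (swap x y π)  = ≈-trans (≈-sym (⊕-assoc _ _ _)) (≈-trans (⊕-cong (⊕-comm _ _) (∑-↭ g π)) (⊕-assoc _ _ _))
  ∑-↭ g (trans π ρ)   = ≈-trans (∑-↭ g π) (∑-↭ g ρ)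

  ∑-single : ∀ {xs : List A} {y} g → Unique xs → y ∈ xs → (∀ {x} → x ∈ xs → x ≢ y → g x ≈ 0#) → ∑ xs g ≈ g y
  ∑-single {xs = x ∷ xs} g (x∉ ∷ u) (here refl) h =
    ≈-trans (⊕-cong ≈-refl (∑-zero xs (λ z∈ → h (there z∈) (λ e → All.lookup x∉ z∈ (sym e))))) (⊕-identityʳ _)
  ∑-single {xs = x ∷ xs} g (x∉ ∷ u) (there y∈) h =
    ≈-trans (⊕-cong (h (here refl) (All.lookup x∉ y∈)) (∑-single g u y∈ (h ∘ there))) (⊕-identityˡ _)

  -- `t` tests equality with `y` and `b` tests membership of `y`; in a list without repetitions `y`
  -- is counted once or not at all. All structure constants are reduced to 0 or 1 in this way.
  ∑-indicator : ∀ {xs : List A} {y} (t : A → Bool) b → Unique xs → (∀ {x} → T (t x) → x ≡ y) → T (t y) →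
    (T b → y ∈ xs) → (y ∈ xs → T b) → ∑ xs (𝟙 ∘ t) ≈ 𝟙 b
  ∑-indicator {xs = xs} t true u only ty to from =
    ≈-trans (∑-single (𝟙 ∘ t) u (to tt) (λ _ ne → ≈-reflexive (cong 𝟙 (¬T⇒false (ne ∘ only)))))
            (≈-reflexive (cong 𝟙 (T⇒true ty)))
  ∑-indicator {xs = xs} {y} t false u only ty to from =
    ∑-zero xs (λ {x} x∈ → ≈-reflexive (cong 𝟙 (¬T⇒false {t x} (λ h → from (subst (_∈ xs) (only h) x∈)))))

  𝟙-∧ : ∀ b b′ → 𝟙 (b ∧ b′) ≈ 𝟙 b ⊛ 𝟙 b′
  𝟙-∧ true  b′ = ≈-sym (⊛-identityˡ _)
  𝟙-∧ false b′ = ≈-sym (zeroˡ _)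

  if-𝟙 : ∀ b k → (if b then k else 0#) ≈ k ⊛ 𝟙 b
  if-𝟙 true  k = ≈-sym (⊛-identityʳ k)
  if-𝟙 false k = ≈-sym (zeroʳ k)

-- Formal linear combinations

module Linear {c ℓ} (F : Field c ℓ) where
  open Sums F public
  open PQ F public
  open SetoidReasoning setoid

  -- The linear extension of a function on basis words. It is computed from the list that represents
  -- the element; `⟪⟫-ext` shows that only the coefficients matter.
  ⟪_,_⟫ : Elem → (Word → Carrier) → Carrier
  ⟪ x , g ⟫ = ∑ x (λ e → proj₁ e ⊛ g (proj₂ e))

  ⟪⟫-cong : ∀ x {g h} → (∀ {e} → e ∈ x → g (proj₂ e) ≈ h (proj₂ e)) → ⟪ x , g ⟫ ≈ ⟪ x , h ⟫
  ⟪⟫-cong x e = ∑-cong x (λ h → ⊛-cong ≈-refl (e h))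

  coeff-⟪⟫ : ∀ x u → coeff x u ≈ ⟪ x , (λ v → 𝟙 (v == u)) ⟫
  coeff-⟪⟫ x u = ∑-cong x (λ {e} _ → if-𝟙 (proj₂ e == u) (proj₁ e))

  ⟪⟫-∑ : ∀ {a} {A : Set a} x (ys : List A) (g : A → Word → Carrier) → ⟪ x , (λ u → ∑ ys (λ y → g y u)) ⟫ ≈ ∑ ys (λ y → ⟪ x , g y ⟫)
  ⟪⟫-∑ x ys g = ≈-trans (∑-cong x (λ {e} _ → ≈-sym (∑-⊛ˡ ys (proj₁ e) _))) (∑-swap x ys _)

  ⟪⟫-⊛ʳ : ∀ x k g → ⟪ x , (λ u → g u ⊛ k) ⟫ ≈ ⟪ x , g ⟫ ⊛ k
  ⟪⟫-⊛ʳ x k g = ≈-trans (∑-cong x (λ _ → ≈-sym (⊛-assoc _ _ _))) (∑-⊛ʳ x k _)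

  ⟪⟫-expand : ∀ x g {U} → Unique U → (∀ {e} → e ∈ x → proj₂ e ∈ U) → ⟪ x , g ⟫ ≈ ∑ U (λ u → coeff x u ⊛ g u)
  ⟪⟫-expand x g {U} uniq supp = ≈-sym (begin
    ∑ U (λ u → coeff x u ⊛ g u)  ≈⟨ ∑-cong U (λ {u} _ → ⊛-cong (coeff-⟪⟫ x u) ≈-refl) ⟩
    ∑ U (λ u → ⟪ x , (λ v → 𝟙 (v == u)) ⟫ ⊛ g u)  ≈⟨ ∑-cong U (λ {u} _ → ≈-sym (⟪⟫-⊛ʳ x (g u) _)) ⟩
    ∑ U (λ u → ⟪ x , (λ v → 𝟙 (v == u) ⊛ g u) ⟫)  ≈⟨ ≈-sym (⟪⟫-∑ x U (λ u v → 𝟙 (v == u) ⊛ g u)) ⟩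
    ⟪ x , (λ v → ∑ U (λ u → 𝟙 (v == u) ⊛ g u)) ⟫  ≈⟨ ⟪⟫-cong x (λ {e} e∈ → select (proj₂ e) (supp e∈)) ⟩
    ⟪ x , g ⟫  ∎)
    where
    select : ∀ v → v ∈ U → ∑ U (λ u → 𝟙 (v == u) ⊛ g u) ≈ g v
    select v v∈ = ≈-trans
      (∑-single (λ u → 𝟙 (v == u) ⊛ g u) uniq v∈ (λ {u} _ ne → ≈-trans (⊛-cong (≈-reflexive (cong 𝟙 (==-≢ {v} {u} (λ e → ne (sym e))))) ≈-refl) (zeroˡ _)))
      (≈-trans (⊛-cong (≈-reflexive (cong 𝟙 (==-refl v))) ≈-refl) (⊛-identityˡ _))

  -- Both sides are expanded over one repetition-free list containing the words of `x` and of `y`,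
  -- after which only coefficients remain.
  ⟪⟫-ext : ∀ x y g → x ≋ y → ⟪ x , g ⟫ ≈ ⟪ y , g ⟫
  ⟪⟫-ext x y g e = begin
    ⟪ x , g ⟫  ≈⟨ ⟪⟫-expand x g uniq (λ h → ∈-deduplicate⁺ (≡-dec _≟_) (∈-map⁺ proj₂ (∈-++⁺ˡ h))) ⟩
    ∑ U (λ u → coeff x u ⊛ g u)  ≈⟨ ∑-cong U (λ {u} _ → ⊛-cong (e u) ≈-refl) ⟩
    ∑ U (λ u → coeff y u ⊛ g u)  ≈⟨ ≈-sym (⟪⟫-expand y g uniq (λ h → ∈-deduplicate⁺ (≡-dec _≟_) (∈-map⁺ proj₂ (∈-++⁺ʳ x h)))) ⟩
    ⟪ y , g ⟫  ∎
    where
    U : List Word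
    U = deduplicate (≡-dec _≟_) (map proj₂ (x ++ y))
    uniq : Unique U
    uniq = deduplicate-! (≡-dec _≟_) _

  G : Word → Elem
  G u = (1# , u) ∷ []

  coeff-++ : ∀ x y u → coeff (x ++ y) u ≈ coeff x u ⊕ coeff y u
  coeff-++ x y u = ∑-++ x y _

  coeff-scale : ∀ k x u → coeff (scale k x) u ≈ k ⊛ coeff x u
  coeff-scale k x u = begin
    coeff (scale k x) u  ≡⟨ ∑-map _ x _ ⟩
    ∑ x (λ e → if proj₂ e == u then k ⊛ proj₁ e else 0#)  ≈⟨ ∑-cong x (λ {e} _ → pull (proj₂ e == u) (proj₁ e)) ⟩
    ∑ x (λ e → k ⊛ (if proj₂ e == u then proj₁ e else 0#))  ≈⟨ ∑-⊛ˡ x k _ ⟩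
    k ⊛ coeff x u  ∎
    where
    pull : ∀ b z → (if b then k ⊛ z else 0#) ≈ k ⊛ (if b then z else 0#)
    pull true  z = ≈-refl
    pull false z = ≈-sym (zeroʳ k)

  coeff-concatMap : ∀ {a} {A : Set a} (h : A → Elem) xs u → coeff (concatMap h xs) u ≈ ∑ xs (λ x → coeff (h x) u)
  coeff-concatMap h xs u = ∑-concatMap h xs _

  coeff-homog : ∀ n x u → coeff (homog n x) u ≈ 𝟙 (length u ≡ᵇ n) ⊛ coeff x u
  coeff-homog n x u = begin
    coeff (homog n x) u ≈⟨ ∑-filter _ x _ ⟩
    ∑ x (λ e → 𝟙 (length (proj₂ e) ≡ᵇ n) ⊛ (if proj₂ e == u then proj₁ e else 0#)) ≈⟨ ∑-cong x (λ {e} _ → same (proj₂ e) (proj₁ e)) ⟩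
    ∑ x (λ e → 𝟙 (length u ≡ᵇ n) ⊛ (if proj₂ e == u then proj₁ e else 0#)) ≈⟨ ∑-⊛ˡ x _ _ ⟩
    𝟙 (length u ≡ᵇ n) ⊛ coeff x u ∎
    where
    same : ∀ v z → 𝟙 (length v ≡ᵇ n) ⊛ (if v == u then z else 0#) ≈ 𝟙 (length u ≡ᵇ n) ⊛ (if v == u then z else 0#)
    same v z with ≡-dec _≟_ v u
    ... | yes refl = ≈-refl
    ... | no _     = ≈-trans (zeroʳ _) (≈-sym (zeroʳ _))

-- Shuffles of parking functions

module _ {a b} (parking-a : Parking a) (parking-b : Parking b) where

  private
    k l : ℕ
    k = length a
    l = length b
    above : All (k <_) (shift k b)
    above = Allₚ.map⁺ (All.map (λ {x} h → subst (_< k + x) (+-identityʳ k) (+-monoʳ-< k h)) (proj₁ parking-b))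

  Unique-shuffles-shift : Unique (shuffles a (shift k b))
  Unique-shuffles-shift = Unique-shuffles {k} a (shift k b) (All.map proj₂ (Parking⇒≤length parking-a)) above

  module _ {u} (u∈ : u ∈ shuffles a (shift k b)) where

    private
      π : u ↭ a ++ shift k b
      π = ∈-shuffles⇒↭ a (shift k b) u∈

    length-shuffle : length u ≡ k + l
    length-shuffle = ≡.trans (↭-length π) (≡.trans (length-++ a) (cong (k +_) (length-shift k b)))

    cnt-shuffle-low : ∀ i → i ≤ k → cnt 0 i u ≡ cnt 0 i a
    cnt-shuffle-low i i≤k = ≡.trans (cnt-↭ 0 i π) (≡.trans (cnt-++ 0 i a (shift k b))
      (≡.trans (cong (cnt 0 i a +_) (cnt-none (shift k b) (All.map (λ h (_ , h′) → <⇒≱ h (≤-trans h′ i≤k)) above))) (+-identityʳ _)))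

    break-k : Break u k
    break-k = ≡.trans (cnt-shuffle-low k ≤-refl) (≤-antisym (cnt≤length 0 k a) (proj₂ parking-a k ≤-refl))

    cnt-shuffle-high : ∀ i → cnt 0 (k + i) u ≡ k + cnt 0 i b
    cnt-shuffle-high i = begin
      cnt 0 (k + i) u  ≡⟨ cnt-split 0 k i u ⟩
      cnt 0 k u + cnt k i u  ≡⟨ cong₂ _+_ break-k (cnt-↭ k i π) ⟩
      k + cnt k i (a ++ shift k b)  ≡⟨ cong (k +_) (cnt-++ k i a (shift k b)) ⟩
      k + (cnt k i a + cnt k i (shift k b))  ≡⟨ cong (λ z → k + (z + cnt k i (shift k b))) (cnt-none a (below⇒outside ≤-refl (Parking⇒≤length parking-a))) ⟩
      k + cnt k i (shift k b)  ≡⟨ cong (λ z → k + cnt z i (shift k b)) (sym (+-identityʳ k)) ⟩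
      k + cnt (k + 0) i (shift k b)  ≡⟨ cong (k +_) (cnt-shift k 0 i b) ⟩
      k + cnt 0 i b  ∎
      where open ≡-Reasoning

    shuffle-parking : Parking u
    shuffle-parking = All-resp-↭ (↭-sym π) (Allₚ.++⁺ (proj₁ parking-a) (All.map (≤-trans (s≤s z≤n)) above)) , bound
      where
      bound : ∀ i → i ≤ length u → i ≤ cnt 0 i u
      bound i i≤ with ≤-total i k
      ... | inj₁ i≤k = subst (i ≤_) (sym (cnt-shuffle-low i i≤k)) (proj₂ parking-a i i≤k)
      ... | inj₂ k≤i with m≤n⇒∃[o]m+o≡n k≤i
      ...   | j , refl = subst (k + j ≤_) (sym (cnt-shuffle-high j))
        (+-monoʳ-≤ k (proj₂ parking-b j (+-cancelˡ-≤ k j l (subst (k + j ≤_) length-shuffle i≤))))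

    -- Counts up to |a| see only the letters of `a`, so the breaks of `a` are breaks of every
    -- shuffle.
    shuffle-swappableˡ : ∀ {r o p q} → Swappable r a o p q → Swappable r u o p q
    shuffle-swappableˡ {r} {o} {p} {q} sw = record
      { parking = shuffle-parking
      ; break₀ = lift (≤-trans (m≤m+n o p) (≤-trans (m≤m+n (o + p) q) e≤k)) break₀
      ; break₁ = lift (≤-trans (m≤m+n (o + p) q) e≤k) break₁ ; break₂ = lift e≤k break₂ ; small = small }
      where
      open Swappable sw
      e≤k : o + p + q ≤ k
      e≤k = subst (_≤ k) break₂ (cnt≤length 0 (o + p + q) a)
      lift : ∀ {i} → i ≤ k → Break a i → Break u i
      lift {i} i≤k e = ≡.trans (cnt-shuffle-low i i≤k) e

    shuffle-swappableʳ : ∀ {r o p q} → Swappable r b o p q → Swappable r u (k + o) p q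
    shuffle-swappableʳ {r} {o} {p} {q} sw = record
      { parking = shuffle-parking ; break₀ = lift break₀
      ; break₁ = subst (Break u) (sym (+-assoc k o p)) (lift break₁)
      ; break₂ = subst (Break u) (≡.trans (sym (+-assoc k (o + p) q)) (cong (_+ q) (sym (+-assoc k o p)))) (lift break₂) ; small = small }
      where
      open Swappable sw
      lift : ∀ {i} → Break b i → Break u (k + i)
      lift {i} e = ≡.trans (cnt-shuffle-high i) (cong (k +_) e)

    -- |a| is a break of every shuffle. The letters of `a` and those of the shifted `b` thus fill
    -- two adjacent intervals, of unrestricted lengths.
    shuffle-swappable-∞ : Swappable ∞ u 0 k l
    shuffle-swappable-∞ = record
      { parking = shuffle-parking ; break₀ = cnt-zero 0 u ; break₁ = break-k
      ; break₂ = ≡.trans (cnt-shuffle-high l) (cong (k +_) (≤-antisym (cnt≤length 0 l b) (proj₂ parking-b l ≤-refl))) ; small = inj₁ tt }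

  map-swapˡ : ∀ {r o p q} → Swappable r a o p q → map (blockSwap o p q) (shift k b) ≡ shift k b
  map-swapˡ {r} {o} {p} {q} sw = map-id-local (All.map fixed above)
    where
    open Swappable sw
    fixed : ∀ {x} → k < x → blockSwap o p q x ≡ x
    fixed h with <⇒+suc o p q (≤-<-trans (subst (_≤ k) break₂ (cnt≤length 0 (o + p + q) a)) h)
    ... | t , refl = blockSwap-high o p q

  map-swapʳ : ∀ o p q → map (blockSwap (k + o) p q) a ≡ a
  map-swapʳ o p q = map-id-local (All.map (λ (_ , h) → blockSwap-low (k + o) p q (≤-trans h (m≤m+n k o))) (Parking⇒≤length parking-a))

  map-swap-∞ˡ : map (blockSwap 0 k l) a ≡ shift l a
  map-swap-∞ˡ = map-cong-local (All.map moved (Parking⇒≤length parking-a))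
    where
    moved : ∀ {x} → InInterval 0 k x → blockSwap 0 k l x ≡ l + x
    moved {suc x} (_ , h) = blockSwap-first 0 k l h

  map-swap-∞ʳ : map (blockSwap 0 k l) (shift k b) ≡ b
  map-swap-∞ʳ = ≡.trans (sym (map-∘ b)) (map-id-local (All.map moved (Parking⇒≤length parking-b)))
    where
    moved : ∀ {x} → InInterval 0 l x → blockSwap 0 k l (k + x) ≡ x
    moved {suc x} (_ , h) = blockSwap-second 0 k l h

blockSwap-shift : ∀ k o p q x → blockSwap (k + o) p q (k + x) ≡ k + blockSwap o p q x
blockSwap-shift k o p q x with locate o p q x
... | low h = ≡.trans (blockSwap-low (k + o) p q (+-monoʳ-≤ k h)) (cong (k +_) (sym (blockSwap-low o p q h)))
... | inFirst t h = begin
  blockSwap (k + o) p q (k + (o + suc t))  ≡⟨ cong (blockSwap (k + o) p q) (sym (+-assoc k o (suc t))) ⟩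
  blockSwap (k + o) p q (k + o + suc t)  ≡⟨ blockSwap-first (k + o) p q h ⟩
  k + o + q + suc t  ≡⟨ cong (_+ suc t) (+-assoc k o q) ⟩
  k + (o + q) + suc t  ≡⟨ +-assoc k (o + q) (suc t) ⟩
  k + (o + q + suc t)  ≡⟨ cong (k +_) (sym (blockSwap-first o p q h)) ⟩
  k + blockSwap o p q (o + suc t)  ∎
  where open ≡-Reasoning
... | inSecond t h = begin
  blockSwap (k + o) p q (k + (o + p + suc t))  ≡⟨ cong (blockSwap (k + o) p q) (≡.trans (sym (+-assoc k (o + p) (suc t))) (cong (_+ suc t) (sym (+-assoc k o p)))) ⟩
  blockSwap (k + o) p q (k + o + p + suc t)  ≡⟨ blockSwap-second (k + o) p q h ⟩
  k + o + suc t  ≡⟨ +-assoc k o (suc t) ⟩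
  k + (o + suc t)  ≡⟨ cong (k +_) (sym (blockSwap-second o p q h)) ⟩
  k + blockSwap o p q (o + p + suc t)  ∎
  where open ≡-Reasoning
... | high t = begin
  blockSwap (k + o) p q (k + (o + p + q + suc t))  ≡⟨ cong (blockSwap (k + o) p q) e ⟩
  blockSwap (k + o) p q (k + o + p + q + suc t)  ≡⟨ blockSwap-high (k + o) p q ⟩
  k + o + p + q + suc t  ≡⟨ sym e ⟩
  k + (o + p + q + suc t)  ≡⟨ cong (k +_) (sym (blockSwap-high o p q)) ⟩
  k + blockSwap o p q (o + p + q + suc t)  ∎
  where
  open ≡-Reasoning
  e : k + (o + p + q + suc t) ≡ k + o + p + q + suc t
  e = ≡.trans (sym (+-assoc k (o + p + q) (suc t))) (cong (_+ suc t) (≡.trans (sym (+-assoc k (o + p) q)) (cong (_+ q) (sym (+-assoc k o p)))))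

shift-swap : ∀ k o p q b → shift k (map (blockSwap o p q) b) ≡ map (blockSwap (k + o) p q) (shift k b)
shift-swap k o p q b = ≡.trans (sym (map-∘ b)) (≡.trans
  (map-cong-local (All.universal (λ x → sym (blockSwap-shift k o p q x)) b)) (map-∘ b))

-- Structure constants

length-Park-take : ∀ k {w} → Positive w → k ≤ length w → length (Park (take k w)) ≡ k
length-Park-take k {w} pos k≤ = ≡.trans (length-Park (Allₚ.take⁺ k pos)) (≡.trans (length-take k w) (m≤n⇒m⊓n≡m k≤))

module StructureConstants {c ℓ} (F : Field c ℓ) where
  open Linear F public
  open SetoidReasoning setoid

  ∈-prodBasis⁺ : ∀ {w} k → Parking w → k ≤ length w → w ∈ prodBasis (Park (take k w)) (Park (drop k w))
  ∈-prodBasis⁺ {w} k pw k≤ = ∈-filter⁺ (T? ∘ _)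
    (subst (λ n → w ∈ pfs n) (sym total) (∈-pfs⁺ pw))
    (Equivalence.from T-∧ (≡⇒== (cong (λ z → Park (take z w)) len) , ≡⇒== (cong (λ z → Park (drop z w)) len)))
    where
    len : length (Park (take k w)) ≡ k
    len = length-Park-take k (proj₁ pw) k≤
    total : length (Park (take k w)) + length (Park (drop k w)) ≡ length w
    total = ≡.trans (cong₂ _+_ len (≡.trans (length-Park (Allₚ.drop⁺ k (proj₁ pw))) (length-drop k w))) (m+[n∸m]≡n k≤)

  record InProduct (u v w : Word) : Set where
    field
      parking : Parking w
      total   : length w ≡ length u + length v
      left    : Park (take (length u) w) ≡ u
      right   : Park (drop (length u) w) ≡ v

  ∈-prodBasis⁻ : ∀ {u v w} → w ∈ prodBasis u v → InProduct u v w
  ∈-prodBasis⁻ {u} {v} {w} w∈ = record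
    { parking = proj₂ (∈-pfs⁻ (length u + length v) (proj₁ split)) ; total = proj₁ (∈-pfs⁻ (length u + length v) (proj₁ split))
    ; left = ==⇒≡ (proj₁ eqs) ; right = ==⇒≡ (proj₂ eqs) }
    where
    split = ∈-filter⁻ (T? ∘ (λ w → (Park (take (length u) w) == u) ∧ (Park (drop (length u) w) == v))) {xs = pfs (length u + length v)} w∈
    eqs = Equivalence.to (T-∧ {Park (take (length u) w) == u}) (proj₂ split)

  Unique-prodBasis : ∀ u v → Unique (prodBasis u v)
  Unique-prodBasis u v = Uniqueₚ.filter⁺ (T? ∘ _) (Unique-pfs (length u + length v))

  cuts : Word → List ℕ
  cuts w = upTo (suc (length w))

  -- Only the cut at |u| can contribute, since parking keeps lengths. Summing over all cuts
  -- nevertheless makes the range independent of `u`, so that the formula extends bilinearly in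
  -- `coeff-⋆`.
  prodBasis-count : ∀ u v w → ∑ (prodBasis u v) (λ w′ → 𝟙 (w′ == w)) ≈
    𝟙 (isPF w) ⊛ ∑ (cuts w) (λ k → 𝟙 (Park (take k w) == u) ⊛ 𝟙 (Park (drop k w) == v))
  prodBasis-count u v w with w ∈? prodBasis u v
  ... | yes w∈ = ≈-trans
    (∑-indicator (_== w) true (Unique-prodBasis u v) ==⇒≡ (≡⇒== {w} refl) (λ _ → w∈) (λ _ → tt))
    (≈-sym (≈-trans (⊛-cong (≈-reflexive (cong 𝟙 (T⇒true (Parking⇒IsPF w parking)))) sum≈1) (⊛-identityˡ 1#)))
    where
    open InProduct (∈-prodBasis⁻ {u} {v} w∈)
    k∈ : length u ∈ cuts w
    k∈ = ∈-upTo⁺ (s≤s (subst (length u ≤_) (sym total) (m≤m+n (length u) (length v))))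
    sum≈1 : ∑ (cuts w) (λ k → 𝟙 (Park (take k w) == u) ⊛ 𝟙 (Park (drop k w) == v)) ≈ 1#
    sum≈1 = ≈-trans (∑-single _ (Uniqueₚ.upTo⁺ (suc (length w))) k∈ (λ {k} k∈′ ne → ≈-trans (⊛-cong (≈-reflexive (cong 𝟙
        (==-≢ {Park (take k w)} {u} (λ e → ne (≡.trans (sym (length-Park-take k (proj₁ parking) (≤-pred (∈-upTo⁻ k∈′)))) (cong length e)))))) ≈-refl) (zeroˡ _)))
      (≈-trans (⊛-cong (≈-reflexive (cong 𝟙 (T⇒true (≡⇒== left)))) (≈-reflexive (cong 𝟙 (T⇒true (≡⇒== right))))) (⊛-identityˡ 1#))
  ... | no w∉ = ≈-trans
    (∑-zero (prodBasis u v) (λ {w′} w′∈ → ≈-reflexive (cong 𝟙 (==-≢ {w′} {w} (λ { refl → w∉ w′∈ })))))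
    (≈-sym (≈-trans (≈-sym (∑-⊛ˡ (cuts w) (𝟙 (isPF w)) _)) (∑-zero (cuts w) (λ {k} k∈ → term k (≤-pred (∈-upTo⁻ k∈))))))
    where
    term : ∀ k → k ≤ length w → 𝟙 (isPF w) ⊛ (𝟙 (Park (take k w) == u) ⊛ 𝟙 (Park (drop k w) == v)) ≈ 0#
    term k k≤ = ≈-trans (⊛-cong ≈-refl (≈-sym (𝟙-∧ (Park (take k w) == u) _))) (≈-trans (≈-sym (𝟙-∧ (isPF w) _))
      (≈-reflexive (cong 𝟙 (¬T⇒false {isPF w ∧ (Park (take k w) == u) ∧ (Park (drop k w) == v)} λ h →
        let (h₁ , h₂) = Equivalence.to (T-∧ {isPF w}) h ; (h₃ , h₄) = Equivalence.to (T-∧ {Park (take k w) == u}) h₂ in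
        w∉ (subst₂ (λ u v → w ∈ prodBasis u v) (==⇒≡ {Park (take k w)} {u} h₃) (==⇒≡ {Park (drop k w)} {v} h₄) (∈-prodBasis⁺ k (IsPF⇒Parking w h₁) k≤))))))
      where open ≡ using (subst₂)

  coeff-⋆ : ∀ x y w → coeff (x ⋆ y) w ≈
    𝟙 (isPF w) ⊛ ∑ (cuts w) (λ k → coeff x (Park (take k w)) ⊛ coeff y (Park (drop k w)))
  coeff-⋆ x y w = begin
    coeff (x ⋆ y) w
      ≈⟨ coeff-concatMap _ x w ⟩
    ∑ x (λ e → coeff (concatMap (λ f → map (λ w → (proj₁ e ⊛ proj₁ f , w)) (prodBasis (proj₂ e) (proj₂ f))) y) w)
      ≈⟨ ∑-cong x (λ _ → coeff-concatMap _ y w) ⟩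
    ∑ x (λ e → ∑ y (λ f → coeff (map (λ w → (proj₁ e ⊛ proj₁ f , w)) (prodBasis (proj₂ e) (proj₂ f))) w))
      ≈⟨ ∑-cong x (λ {e} _ → ∑-cong y (λ {f} _ → basis-term (proj₁ e) (proj₁ f) (proj₂ e) (proj₂ f))) ⟩
    ∑ x (λ e → ∑ y (λ f → P ⊛ ∑ (cuts w) (λ k → (proj₁ e ⊛ α k (proj₂ e)) ⊛ (proj₁ f ⊛ β k (proj₂ f)))))
      ≈⟨ ∑-cong x (λ {e} _ → ≈-trans (∑-⊛ˡ y P _) (⊛-cong ≈-refl (∑-swap y (cuts w) _))) ⟩
    ∑ x (λ e → P ⊛ ∑ (cuts w) (λ k → ∑ y (λ f → (proj₁ e ⊛ α k (proj₂ e)) ⊛ (proj₁ f ⊛ β k (proj₂ f)))))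
      ≈⟨ ≈-trans (∑-⊛ˡ x P _) (⊛-cong ≈-refl (∑-swap x (cuts w) _)) ⟩
    P ⊛ ∑ (cuts w) (λ k → ∑ x (λ e → ∑ y (λ f → (proj₁ e ⊛ α k (proj₂ e)) ⊛ (proj₁ f ⊛ β k (proj₂ f)))))
      ≈⟨ ⊛-cong ≈-refl (∑-cong (cuts w) (λ {k} _ → ≈-trans (∑-cong x (λ _ → ∑-⊛ˡ y _ _)) (∑-⊛ʳ x _ _))) ⟩
    P ⊛ ∑ (cuts w) (λ k → ⟪ x , α k ⟫ ⊛ ⟪ y , β k ⟫)
      ≈⟨ ⊛-cong ≈-refl (∑-cong (cuts w) (λ {k} _ → ⊛-cong (to-coeff x (Park (take k w))) (to-coeff y (Park (drop k w))))) ⟩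
    P ⊛ ∑ (cuts w) (λ k → coeff x (Park (take k w)) ⊛ coeff y (Park (drop k w))) ∎
    where
    P : Carrier
    P = 𝟙 (isPF w)
    α β : ℕ → Word → Carrier
    α k u = 𝟙 (Park (take k w) == u)
    β k v = 𝟙 (Park (drop k w) == v)
    ==-sym : ∀ u v → (u == v) ≡ (v == u)
    ==-sym u v = T-ext (≡⇒== {v} ∘ sym ∘ ==⇒≡ {u}) (≡⇒== {u} ∘ sym ∘ ==⇒≡ {v})
    to-coeff : ∀ z u → ⟪ z , (λ v → 𝟙 (u == v)) ⟫ ≈ coeff z u
    to-coeff z u = ≈-trans (⟪⟫-cong z (λ {e} _ → ≈-reflexive (cong 𝟙 (==-sym u (proj₂ e))))) (≈-sym (coeff-⟪⟫ z u))
    basis-term : ∀ i j u v → coeff (map (λ w → (i ⊛ j , w)) (prodBasis u v)) w ≈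
      P ⊛ ∑ (cuts w) (λ k → (i ⊛ α k u) ⊛ (j ⊛ β k v))
    basis-term i j u v = begin
      coeff (map (λ w → (i ⊛ j , w)) (prodBasis u v)) w  ≡⟨ ∑-map _ (prodBasis u v) _ ⟩
      ∑ (prodBasis u v) (λ w′ → if w′ == w then i ⊛ j else 0#)  ≈⟨ ∑-cong (prodBasis u v) (λ {w′} _ → if-𝟙 (w′ == w) _) ⟩
      ∑ (prodBasis u v) (λ w′ → (i ⊛ j) ⊛ 𝟙 (w′ == w))  ≈⟨ ∑-⊛ˡ (prodBasis u v) _ _ ⟩
      (i ⊛ j) ⊛ ∑ (prodBasis u v) (λ w′ → 𝟙 (w′ == w))  ≈⟨ ⊛-cong ≈-refl (prodBasis-count u v w) ⟩
      (i ⊛ j) ⊛ (P ⊛ ∑ (cuts w) (λ k → α k u ⊛ β k v))  ≈⟨ x∙yz≈y∙xz _ _ _ ⟩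
      P ⊛ ((i ⊛ j) ⊛ ∑ (cuts w) (λ k → α k u ⊛ β k v))  ≈⟨ ⊛-cong ≈-refl (≈-sym (∑-⊛ˡ (cuts w) _ _)) ⟩
      P ⊛ ∑ (cuts w) (λ k → (i ⊛ j) ⊛ (α k u ⊛ β k v))  ≈⟨ ⊛-cong ≈-refl (∑-cong (cuts w) (λ _ → interchange⊛ _ _ _ _)) ⟩
      P ⊛ ∑ (cuts w) (λ k → (i ⊛ α k u) ⊛ (j ⊛ β k v))  ∎
      where open CommutativeSemigroupₚ (Field.*-commutativeSemigroup F) using (x∙yz≈y∙xz) renaming (interchange to interchange⊛)

  record InCoproduct (u a b : Word) : Set where
    field
      parkingˡ : Parking a
      parkingʳ : Parking b
      shuffle  : T (isShuffle u a (shift (length a) b))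

  pairsAt : Word → ℕ → List (Word × Word)
  pairsAt u k = filterᵇ (λ ab → isShuffle u (proj₁ ab) (shift k (proj₂ ab))) (cartesianProduct (pfs k) (pfs (length u ∸ k)))

  ∈-pairsAt⁻ : ∀ {u a b} k → (a , b) ∈ pairsAt u k → length a ≡ k × InCoproduct u a b
  ∈-pairsAt⁻ {u} {a} {b} k h = len , record
    { parkingˡ = proj₂ (∈-pfs⁻ k (proj₁ both)) ; parkingʳ = proj₂ (∈-pfs⁻ (length u ∸ k) (proj₂ both))
    ; shuffle = subst (λ z → T (isShuffle u a (shift z b))) (sym len) (proj₂ split) }
    where
    split = ∈-filter⁻ (T? ∘ (λ ab → isShuffle u (proj₁ ab) (shift k (proj₂ ab)))) {xs = cartesianProduct (pfs k) (pfs (length u ∸ k))} h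
    both = ∈-cartesianProduct⁻ (pfs k) (pfs (length u ∸ k)) (proj₁ split)
    len : length a ≡ k
    len = proj₁ (∈-pfs⁻ k (proj₁ both))

  ∈-coprodPairs⁻ : ∀ {u a b} → (a , b) ∈ coprodPairs u → InCoproduct u a b
  ∈-coprodPairs⁻ {u} h = let (k , _ , h′) = find (∈-concatMap⁻ (pairsAt u) {xs = cuts u} h) in proj₂ (∈-pairsAt⁻ k h′)

  length-coproduct : ∀ {u a b} → InCoproduct u a b → length u ≡ length a + length b
  length-coproduct {u} {a} {b} h = length-shuffle parkingˡ parkingʳ (isShuffle⇒∈ u a (shift (length a) b) shuffle)
    where open InCoproduct h

  ∈-coprodPairs⁺ : ∀ {u a b} → InCoproduct u a b → (a , b) ∈ coprodPairs u
  ∈-coprodPairs⁺ {u} {a} {b} h = ∈-concatMap⁺ (pairsAt u) (lose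
    (∈-upTo⁺ (s≤s (subst (length a ≤_) (sym len) (m≤m+n (length a) (length b)))))
    (∈-filter⁺ (T? ∘ _) (∈-cartesianProduct⁺ (∈-pfs⁺ parkingˡ)
      (subst (λ n → b ∈ pfs n) (sym (≡.trans (cong (_∸ length a) len) (m+n∸m≡n (length a) (length b)))) (∈-pfs⁺ parkingʳ))) shuffle))
    where
    open InCoproduct h
    len = length-coproduct h

  Unique-coprodPairs : ∀ u → Unique (coprodPairs u)
  Unique-coprodPairs u = Unique-concatMap (pairsAt u) (Uniqueₚ.upTo⁺ (suc (length u)))
    (λ k → Uniqueₚ.filter⁺ (T? ∘ _) (Uniqueₚ.cartesianProduct⁺ (Unique-pfs k) (Unique-pfs (length u ∸ k))))
    (λ {k} {k′} h h′ → ≡.trans (sym (proj₁ (∈-pairsAt⁻ {u} k h))) (proj₁ (∈-pairsAt⁻ {u} k′ h′)))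

  pairTest : Word → Word → Word × Word → Bool
  pairTest a b ab = (proj₁ ab == a) ∧ (proj₂ ab == b)

  coeff₂-Δ : ∀ x a b → coeff₂ (Δ x) a b ≈ ⟪ x , (λ u → ∑ (coprodPairs u) (𝟙 ∘ pairTest a b)) ⟫
  coeff₂-Δ x a b = ≈-trans (∑-concatMap _ x _) (∑-cong x (λ {e} _ → begin
    ∑ (map (λ ab → (proj₁ e , ab)) (coprodPairs (proj₂ e))) (λ f → if pairTest a b (proj₂ f) then proj₁ f else 0#)
      ≡⟨ ∑-map _ (coprodPairs (proj₂ e)) _ ⟩
    ∑ (coprodPairs (proj₂ e)) (λ ab → if pairTest a b ab then proj₁ e else 0#)
      ≈⟨ ∑-cong (coprodPairs (proj₂ e)) (λ {ab} _ → if-𝟙 (pairTest a b ab) _) ⟩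
    ∑ (coprodPairs (proj₂ e)) (λ ab → proj₁ e ⊛ 𝟙 (pairTest a b ab))
      ≈⟨ ∑-⊛ˡ (coprodPairs (proj₂ e)) _ _ ⟩
    proj₁ e ⊛ ∑ (coprodPairs (proj₂ e)) (𝟙 ∘ pairTest a b) ∎))

  pairTest⇒≡ : ∀ {a b} ab → T (pairTest a b ab) → ab ≡ (a , b)
  pairTest⇒≡ {a} {b} (a′ , b′) h with Equivalence.to (T-∧ {a′ == a}) h
  ... | h₁ , h₂ = cong₂ _,_ (==⇒≡ h₁) (==⇒≡ h₂)

  coprodPairs-count : ∀ {a b} u → Parking a → Parking b →
    ∑ (coprodPairs u) (𝟙 ∘ pairTest a b) ≈ 𝟙 (isShuffle u a (shift (length a) b))
  coprodPairs-count {a} {b} u pa pb = ∑-indicator (pairTest a b) _ (Unique-coprodPairs u) (λ {ab} → pairTest⇒≡ ab)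
    (Equivalence.from T-∧ (≡⇒== {a} refl , ≡⇒== {b} refl))
    (λ h → ∈-coprodPairs⁺ {u} record { parkingˡ = pa ; parkingʳ = pb ; shuffle = h })
    (λ h → InCoproduct.shuffle (∈-coprodPairs⁻ {u} h))

  -- The list of pairs of `u` and the list of shuffles are both free of repetitions, so either one
  -- detects exactly once that `u` is a shuffle. The sum over the words of `x` can then be traded
  -- for a sum over shuffles.
  coeff₂-Δ-shuffles : ∀ x {a b} → Parking a → Parking b →
    coeff₂ (Δ x) a b ≈ ∑ (shuffles a (shift (length a) b)) (coeff x)
  coeff₂-Δ-shuffles x {a} {b} pa pb = begin
    coeff₂ (Δ x) a b  ≈⟨ coeff₂-Δ x a b ⟩
    ⟪ x , (λ u → ∑ (coprodPairs u) (𝟙 ∘ pairTest a b)) ⟫  ≈⟨ ⟪⟫-cong x (λ {e} _ → count (proj₂ e)) ⟩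
    ⟪ x , (λ u → ∑ sh (λ u′ → 𝟙 (u == u′))) ⟫  ≈⟨ ⟪⟫-∑ x sh (λ u′ u → 𝟙 (u == u′)) ⟩
    ∑ sh (λ u′ → ⟪ x , (λ u → 𝟙 (u == u′)) ⟫)  ≈⟨ ∑-cong sh (λ {u′} _ → ≈-sym (coeff-⟪⟫ x u′)) ⟩
    ∑ sh (coeff x)  ∎
    where
    sh : List Word
    sh = shuffles a (shift (length a) b)
    count : ∀ u → ∑ (coprodPairs u) (𝟙 ∘ pairTest a b) ≈ ∑ sh (λ u′ → 𝟙 (u == u′))
    count u = ≈-trans (coprodPairs-count u pa pb) (≈-sym (∑-indicator (u ==_) _ (Unique-shuffles-shift pa pb)
      (sym ∘ ==⇒≡) (≡⇒== {u} refl) (isShuffle⇒∈ u a _) (∈⇒isShuffle a _)))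

  coeff₂-Δ-zero : ∀ x {a b} → (∀ {e} → e ∈ x → ¬ InCoproduct (proj₂ e) a b) → coeff₂ (Δ x) a b ≈ 0#
  coeff₂-Δ-zero x {a} {b} h = ≈-trans (coeff₂-Δ x a b) (∑-zero x (λ {e} e∈ → ≈-trans (⊛-cong ≈-refl
    (∑-zero (coprodPairs (proj₂ e)) (λ {ab} ab∈ → ≈-reflexive (cong 𝟙 (¬T⇒false {pairTest a b ab} (λ t →
      h e∈ (∈-coprodPairs⁻ {proj₂ e} (subst (_∈ coprodPairs (proj₂ e)) (pairTest⇒≡ ab t) ab∈)))))))) (zeroʳ _)))

-- Invariance of products and coproducts

module Closure {c ℓ} (F : Field c ℓ) (r : Rank) where
  open StructureConstants F public
  open SetoidReasoning setoid

  WordInvariant : (Word → Carrier) → Set ℓ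
  WordInvariant f = SwapInvariant setoid r f

  invariant⇒word : ∀ x → Invariant r x → WordInvariant (coeff x)
  invariant⇒word x inv {u} {o} {p} {q} = act⇒swap setoid r (coeff x) inv {u} {o} {p} {q}

  word⇒invariant : ∀ x → WordInvariant (coeff x) → Invariant r x
  word⇒invariant x inv = swap⇒act setoid r (coeff x) (λ {u} {o} {p} {q} → inv {u} {o} {p} {q})

  -- The word `v` itself need not be parking; its exchange becomes an admissible one only after
  -- parking.
  subword-invariant : ∀ {f} → WordInvariant f → ∀ {v o p q} → ThreeBlocks v o p q → Small r (cnt o p v) ⊎ Small r (cnt (o + p) q v) →
    f (Park (map (blockSwap o p q) v)) ≈ f (Park v)
  subword-invariant {f} inv blocks small = ≈-trans (≈-reflexive (cong f (Park-swap blocks))) (inv (blocks⇒swappable blocks small))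

  module _ {w o p q} (sw : Swappable r w o p q) (k : ℕ) where
    open Swappable sw

    private
      σ = blockSwap o p q
      blocks : ThreeBlocks (take k w ++ drop k w) o p q
      blocks = subst (λ z → ThreeBlocks z o p q) (sym (take++drop≡id k w)) (swappable⇒blocks sw)
      open ThreeBlocks blocks
      count : ∀ i l → cnt i l w ≡ cnt i l (take k w) + cnt i l (drop k w)
      count i l = ≡.trans (cong (cnt i l) (sym (take++drop≡id k w))) (cnt-++ i l (take k w) (drop k w))

      count₁ : cnt o p (take k w) + cnt o p (drop k w) ≡ p
      count₁ = ≡.trans (sym (count o p)) (Break-cnt w o p break₀ break₁)

      count₂ : cnt (o + p) q (take k w) + cnt (o + p) q (drop k w) ≡ q
      count₂ = ≡.trans (sym (count (o + p) q)) (Break-cnt w (o + p) q break₁ break₂)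

    -- The two factors share the p letters of the first interval and the q letters of the second.
    -- Neither factor holds more than the whole, so smallness is inherited.
    Park-take-invariant : ∀ {f} → WordInvariant f → f (Park (take k (map σ w))) ≈ f (Park (take k w))
    Park-take-invariant {f} inv = ≈-trans (≈-reflexive (cong (f ∘ Park) (take-map k w))) (subword-invariant {f} inv
      record { positive = Allₚ.++⁻ˡ (take k w) positive ; before = Balanced-++ˡ {take k w} (drop k w) 0 o before
             ; first = Balanced-++ˡ {take k w} (drop k w) o p first ; second = Balanced-++ˡ {take k w} (drop k w) (o + p) q second }
      (Sum.map (Small-≤ r (m+n≤o⇒m≤o _ (≤-reflexive count₁))) (Small-≤ r (m+n≤o⇒m≤o _ (≤-reflexive count₂))) small))

    Park-drop-invariant : ∀ {f} → WordInvariant f → f (Park (drop k (map σ w))) ≈ f (Park (drop k w))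
    Park-drop-invariant {f} inv = ≈-trans (≈-reflexive (cong (f ∘ Park) (drop-map k w))) (subword-invariant {f} inv
      record { positive = Allₚ.++⁻ʳ (take k w) positive ; before = Balanced-++ʳ (take k w) 0 o before
             ; first = Balanced-++ʳ (take k w) o p first ; second = Balanced-++ʳ (take k w) (o + p) q second }
      (Sum.map (Small-≤ r (m+n≤o⇒n≤o (cnt o p (take k w)) (≤-reflexive count₁)))
               (Small-≤ r (m+n≤o⇒n≤o (cnt (o + p) q (take k w)) (≤-reflexive count₂))) small))

  isPF-swapped : ∀ {w o p q} → Swappable r w o p q → isPF (map (blockSwap o p q) w) ≡ isPF w
  isPF-swapped {w} sw = ≡.trans (T⇒true (Parking⇒IsPF _ (swapped-parking sw))) (sym (T⇒true (Parking⇒IsPF w (Swappable.parking sw))))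

  cuts-swapped : ∀ w o p q → cuts (map (blockSwap o p q) w) ≡ cuts w
  cuts-swapped w o p q = cong (upTo ∘ suc) (length-map _ w)

  -- Stated for an arbitrary term, since the product and the recursion of the antipode lead to sums
  -- of this same shape.
  cut-sum-invariant : ∀ (g : ℕ → Word → Carrier) {w o p q} → (∀ k → g k (map (blockSwap o p q) w) ≈ g k w) → Swappable r w o p q →
    𝟙 (isPF (map (blockSwap o p q) w)) ⊛ ∑ (cuts (map (blockSwap o p q) w)) (λ k → g k (map (blockSwap o p q) w)) ≈
    𝟙 (isPF w) ⊛ ∑ (cuts w) (λ k → g k w)
  cut-sum-invariant g {w} {o} {p} {q} inv sw = ⊛-cong (≈-reflexive (cong 𝟙 (isPF-swapped sw)))
    (≈-trans (≈-reflexive (cong (λ z → ∑ z (λ k → g k (map (blockSwap o p q) w))) (cuts-swapped w o p q))) (∑-cong (cuts w) (λ {k} _ → inv k)))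

  ⋆-invariant : ∀ x y → WordInvariant (coeff x) → WordInvariant (coeff y) → WordInvariant (coeff (x ⋆ y))
  ⋆-invariant x y ix iy {w} {o} {p} {q} sw = begin
    coeff (x ⋆ y) (map (blockSwap o p q) w) ≈⟨ coeff-⋆ x y _ ⟩
    _ ≈⟨ cut-sum-invariant (λ k w → coeff x (Park (take k w)) ⊛ coeff y (Park (drop k w)))
           (λ k → ⊛-cong (Park-take-invariant sw k {coeff x} ix) (Park-drop-invariant sw k {coeff y} iy)) sw ⟩
    _ ≈⟨ ≈-sym (coeff-⋆ x y w) ⟩
    coeff (x ⋆ y) w ∎

  -- The exchange on `a` fixes the letters of the shifted `b`, hence takes the shuffles of `a` to
  -- those of the exchanged word, by an admissible exchange on each. If `b` is not parking, both
  -- sides vanish.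
  Δ-invariantˡ : ∀ x b → WordInvariant (coeff x) → WordInvariant (λ a → coeff₂ (Δ x) a b)
  Δ-invariantˡ x b inv {a} {o} {p} {q} sw with T? (isPF b)
  ... | no ¬pb = ≈-trans (coeff₂-Δ-zero x (λ _ h → ¬pb (Parking⇒IsPF b (InCoproduct.parkingʳ h))))
                         (≈-sym (coeff₂-Δ-zero x (λ _ h → ¬pb (Parking⇒IsPF b (InCoproduct.parkingʳ h)))))
  ... | yes pb = begin
    coeff₂ (Δ x) (map σ a) b  ≈⟨ coeff₂-Δ-shuffles x (swapped-parking sw) parking-b ⟩
    ∑ (shuffles (map σ a) (shift (length (map σ a)) b)) (coeff x) ≡⟨ cong (λ z → ∑ (shuffles (map σ a) z) (coeff x)) shifted ⟩
    ∑ (shuffles (map σ a) (map σ (shift (length a) b))) (coeff x) ≡⟨ cong (λ z → ∑ z (coeff x)) (sym (map-shuffles σ a (shift (length a) b))) ⟩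
    ∑ (map (map σ) (shuffles a (shift (length a) b))) (coeff x)  ≡⟨ ∑-map (map σ) (shuffles a (shift (length a) b)) (coeff x) ⟩
    ∑ (shuffles a (shift (length a) b)) (coeff x ∘ map σ)  ≈⟨ ∑-cong (shuffles a (shift (length a) b)) (λ u∈ → inv (shuffle-swappableˡ parking parking-b u∈ sw)) ⟩
    ∑ (shuffles a (shift (length a) b)) (coeff x)  ≈⟨ ≈-sym (coeff₂-Δ-shuffles x parking parking-b) ⟩
    coeff₂ (Δ x) a b  ∎
    where
    open Swappable sw
    σ = blockSwap o p q
    parking-b : Parking b
    parking-b = IsPF⇒Parking b pb
    shifted : shift (length (map σ a)) b ≡ map σ (shift (length a) b)
    shifted = ≡.trans (cong (λ z → shift z b) (length-map σ a)) (sym (map-swapˡ parking parking-b sw))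

  Δ-invariantʳ : ∀ x a → WordInvariant (coeff x) → WordInvariant (coeff₂ (Δ x) a)
  Δ-invariantʳ x a inv {b} {o} {p} {q} sw with T? (isPF a)
  ... | no ¬pa = ≈-trans (coeff₂-Δ-zero x (λ _ h → ¬pa (Parking⇒IsPF a (InCoproduct.parkingˡ h))))
                         (≈-sym (coeff₂-Δ-zero x (λ _ h → ¬pa (Parking⇒IsPF a (InCoproduct.parkingˡ h)))))
  ... | yes pa = begin
    coeff₂ (Δ x) a (map (blockSwap o p q) b)  ≈⟨ coeff₂-Δ-shuffles x parking-a (swapped-parking sw) ⟩
    ∑ (shuffles a (shift (length a) (map (blockSwap o p q) b))) (coeff x) ≡⟨ cong₂ (λ y z → ∑ (shuffles y z) (coeff x)) (sym (map-swapʳ parking-a parking o p q)) (shift-swap (length a) o p q b) ⟩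
    ∑ (shuffles (map σ a) (map σ (shift (length a) b))) (coeff x) ≡⟨ cong (λ z → ∑ z (coeff x)) (sym (map-shuffles σ a (shift (length a) b))) ⟩
    ∑ (map (map σ) (shuffles a (shift (length a) b))) (coeff x)  ≡⟨ ∑-map (map σ) (shuffles a (shift (length a) b)) (coeff x) ⟩
    ∑ (shuffles a (shift (length a) b)) (coeff x ∘ map σ)  ≈⟨ ∑-cong (shuffles a (shift (length a) b)) (λ u∈ → inv (shuffle-swappableʳ parking-a parking u∈ sw)) ⟩
    ∑ (shuffles a (shift (length a) b)) (coeff x)  ≈⟨ ≈-sym (coeff₂-Δ-shuffles x parking-a parking) ⟩
    coeff₂ (Δ x) a b  ∎
    where
    open Swappable sw
    σ = blockSwap (length a + o) p q
    parking-a : Parking a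
    parking-a = IsPF⇒Parking a pa

-- Orbits

small? : ∀ r l → Dec (Small r l)
small? (fin r) l = l <? r
small? ∞       l = yes tt

swappable? : ∀ r u o p q → Dec (Swappable r u o p q)
swappable? r u o p q = map′
  (λ (h , b₀ , b₁ , b₂ , s) → record { parking = IsPF⇒Parking u h ; break₀ = b₀ ; break₁ = b₁ ; break₂ = b₂ ; small = s })
  (λ sw → let open Swappable sw in Parking⇒IsPF u parking , break₀ , break₁ , break₂ , small)
  (T? (isPF u) ×-dec (cnt 0 o u ≟ o) ×-dec (cnt 0 (o + p) u ≟ o + p) ×-dec (cnt 0 (o + p + q) u ≟ o + p + q)
    ×-dec (small? r p ⊎-dec small? r q))

-- A representative of the class of a word for the equivalence relation generated by a list of pairs.
representative : List (Word × Word) → Word → Word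
representative []             z = z
representative ((u , v) ∷ es) z =
  if representative es z == representative es v then representative es u else representative es z

-- Each edge is processed on top of the classes of the edges behind it and can only merge two of
-- these, so an identification once made persists.
representative-edge : ∀ {u v} es → (u , v) ∈ es → representative es u ≡ representative es v
representative-edge {u} {v} (_ ∷ es) (here refl) rewrite ==-refl (representative es v) with representative es u == representative es v
... | true  = refl
... | false = refl
representative-edge ((u , v) ∷ es) (there h) =
  cong (λ z → if z == representative es v then representative es u else z) (representative-edge es h)

representative-∈ : ∀ {Z} es {z} → All (λ e → proj₁ e ∈ Z) es → z ∈ Z → representative es z ∈ Z
representative-∈ [] _ z∈ = z∈
representative-∈ ((u , v) ∷ es) {z} (h ∷ hs) z∈ with representative es z == representative es v
... | true  = representative-∈ es hs h
... | false = representative-∈ es hs z∈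

-- The bound N makes the set of words finite. Exchanges keep the length, so no class is cut off by
-- the bound.
module Orbits {c ℓ} (F : Field c ℓ) (r : Rank) (N : ℕ) where
  open Closure F r
  open SetoidReasoning setoid

  representative-value : ∀ (f : Word → Carrier) es → All (λ e → f (proj₁ e) ≈ f (proj₂ e)) es → ∀ z → f (representative es z) ≈ f z
  representative-value f [] _ z = ≈-refl
  representative-value f ((u , v) ∷ es) (h ∷ hs) z with representative es z == representative es v in eq
  ... | true  = begin
    f (representative es u) ≈⟨ representative-value f es hs u ⟩
    f u  ≈⟨ h ⟩
    f v  ≈⟨ ≈-sym (representative-value f es hs v) ⟩
    f (representative es v) ≡⟨ cong f (sym (==⇒≡ {representative es z} (subst T (sym eq) tt))) ⟩
    f (representative es z) ≈⟨ representative-value f es hs z ⟩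
    f z  ∎
  ... | false = representative-value f es hs z

  basis : List Word
  basis = concatMap pfs (upTo (suc N))

  inBasis : Word → Bool
  inBasis u = isPF u ∧ (length u ≤ᵇ N)

  Unique-basis : Unique basis
  Unique-basis = Unique-concatMap pfs (Uniqueₚ.upTo⁺ (suc N)) Unique-pfs
    (λ {n} {n′} h h′ → ≡.trans (sym (proj₁ (∈-pfs⁻ n h))) (proj₁ (∈-pfs⁻ n′ h′)))

  ∈-basis⁺ : ∀ {u} → Parking u → length u ≤ N → u ∈ basis
  ∈-basis⁺ pu h = ∈-concatMap⁺ pfs (lose (∈-upTo⁺ (s≤s h)) (∈-pfs⁺ pu))

  ∈-basis⁻ : ∀ {u} → u ∈ basis → Parking u × length u ≤ N
  ∈-basis⁻ h = let (n , n∈ , h′) = find (∈-concatMap⁻ pfs {xs = upTo (suc N)} h) ; (len , pu) = ∈-pfs⁻ n h′ in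
    pu , subst (_≤ N) (sym len) (≤-pred (∈-upTo⁻ n∈))

  inBasis⇒∈ : ∀ u → T (inBasis u) → u ∈ basis
  inBasis⇒∈ u h = let (h₁ , h₂) = Equivalence.to (T-∧ {isPF u}) h in ∈-basis⁺ (IsPF⇒Parking u h₁) (≤ᵇ⇒≤ _ N h₂)

  ∈⇒inBasis : ∀ u → u ∈ basis → T (inBasis u)
  ∈⇒inBasis u h = Equivalence.from T-∧ (Parking⇒IsPF u (proj₁ (∈-basis⁻ h)) , ≤⇒≤ᵇ (proj₂ (∈-basis⁻ h)))

  -- Inadmissible parameters yield a loop at `u`, so the edges can be listed over a plain product of
  -- index ranges.
  target : Word → ℕ → ℕ → ℕ → Word
  target u o p q with swappable? r u o p q
  ... | yes _ = map (blockSwap o p q) u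
  ... | no _  = u

  target-swappable : ∀ {u o p q} → Swappable r u o p q → target u o p q ≡ map (blockSwap o p q) u
  target-swappable {u} {o} {p} {q} sw with swappable? r u o p q
  ... | yes _   = refl
  ... | no ¬sw  = contradiction sw ¬sw

  target-value : ∀ {f} → WordInvariant f → ∀ u o p q → f u ≈ f (target u o p q)
  target-value inv u o p q with swappable? r u o p q
  ... | yes sw = ≈-sym (inv sw)
  ... | no _   = ≈-refl

  -- The last break of an admissible exchange is at most the length of the word, so indices up to N
  -- reach every such exchange.
  parameters : List (Word × ℕ × ℕ × ℕ)
  parameters = cartesianProduct basis (cartesianProduct (upTo (suc N)) (cartesianProduct (upTo (suc N)) (upTo (suc N))))

  edge : Word × ℕ × ℕ × ℕ → Word × Word
  edge (u , o , p , q) = u , target u o p q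

  edges : List (Word × Word)
  edges = map edge parameters

  rep : Word → Word
  rep = representative edges

  rep-swapped : ∀ {u o p q} → u ∈ basis → Swappable r u o p q → rep (map (blockSwap o p q) u) ≡ rep u
  rep-swapped {u} {o} {p} {q} u∈ sw = sym (≡.trans
    (representative-edge edges (∈-map⁺ edge (∈-cartesianProduct⁺ u∈ (∈-cartesianProduct⁺ (small-index o≤) (∈-cartesianProduct⁺ (small-index p≤) (small-index q≤))))))
    (cong rep (target-swappable sw)))
    where
    open Swappable sw
    e≤N : o + p + q ≤ N
    e≤N = ≤-trans (subst (_≤ length u) break₂ (cnt≤length 0 (o + p + q) u)) (proj₂ (∈-basis⁻ u∈))
    o≤ : o ≤ N
    o≤ = ≤-trans (m≤m+n o p) (≤-trans (m≤m+n (o + p) q) e≤N)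
    p≤ : p ≤ N
    p≤ = ≤-trans (m≤n+m p o) (≤-trans (m≤m+n (o + p) q) e≤N)
    q≤ : q ≤ N
    q≤ = ≤-trans (m≤n+m q (o + p)) e≤N
    small-index : ∀ {i} → i ≤ N → i ∈ upTo (suc N)
    small-index h = ∈-upTo⁺ (s≤s h)

  rep-∈ : ∀ {z} → z ∈ basis → rep z ∈ basis
  rep-∈ = representative-∈ edges (Allₚ.map⁺ {f = edge} (All.tabulate (λ h → proj₁ (∈-cartesianProduct⁻ basis _ h))))

  rep-value : ∀ {f} → WordInvariant f → ∀ z → f (rep z) ≈ f z
  rep-value {f} inv = representative-value f edges (Allₚ.map⁺ {f = edge} (All.universal (λ (u , o , p , q) → target-value {f} inv u o p q) parameters))

  -- Zero unless `z` represents some word of the basis, so that sums over classes may run over the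
  -- whole basis.
  orbitSum : Word → Elem
  orbitSum z = map (λ v → (𝟙 (rep v == z) , v)) basis

  coeff-orbitSum : ∀ z a → coeff (orbitSum z) a ≈ 𝟙 (inBasis a) ⊛ 𝟙 (rep a == z)
  coeff-orbitSum z a = begin
    coeff (orbitSum z) a  ≡⟨ ∑-map _ basis _ ⟩
    ∑ basis (λ v → if v == a then 𝟙 (rep v == z) else 0#)  ≈⟨ ∑-cong basis (λ {v} _ → at v) ⟩
    ∑ basis (λ v → 𝟙 (v == a) ⊛ 𝟙 (rep a == z))  ≈⟨ ∑-⊛ʳ basis _ _ ⟩
    ∑ basis (λ v → 𝟙 (v == a)) ⊛ 𝟙 (rep a == z)  ≈⟨ ⊛-cong (∑-indicator (_== a) (inBasis a) Unique-basis ==⇒≡ (≡⇒== {a} refl) (inBasis⇒∈ a) (∈⇒inBasis a)) ≈-refl ⟩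
    𝟙 (inBasis a) ⊛ 𝟙 (rep a == z)  ∎
    where
    at : ∀ v → (if v == a then 𝟙 (rep v == z) else 0#) ≈ 𝟙 (v == a) ⊛ 𝟙 (rep a == z)
    at v with ≡-dec _≟_ v a
    ... | yes refl = ≈-sym (⊛-identityˡ _)
    ... | no _     = ≈-sym (zeroˡ _)

  orbitSum-invariant : ∀ z → WordInvariant (coeff (orbitSum z))
  orbitSum-invariant z {u} {o} {p} {q} sw = ≈-trans (coeff-orbitSum z (map σ u)) (≈-trans step (≈-sym (coeff-orbitSum z u)))
    where
    σ = blockSwap o p q
    inBasis-swapped : inBasis (map σ u) ≡ inBasis u
    inBasis-swapped = cong₂ _∧_ (isPF-swapped sw) (cong (_≤ᵇ N) (length-map σ u))
    step : 𝟙 (inBasis (map σ u)) ⊛ 𝟙 (rep (map σ u) == z) ≈ 𝟙 (inBasis u) ⊛ 𝟙 (rep u == z)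
    step with T? (inBasis u)
    ... | yes h = ⊛-cong (≈-reflexive (cong 𝟙 inBasis-swapped)) (≈-reflexive (cong (λ v → 𝟙 (v == z)) (rep-swapped (inBasis⇒∈ u h) sw)))
    ... | no ¬h = ≈-trans (≈-trans (⊛-cong (≈-reflexive (cong 𝟙 (≡.trans inBasis-swapped (¬T⇒false ¬h)))) ≈-refl) (zeroˡ _))
                          (≈-sym (≈-trans (⊛-cong (≈-reflexive (cong 𝟙 (¬T⇒false ¬h))) ≈-refl) (zeroˡ _)))

  orbitSum-InPQ : ∀ z → InPQ (orbitSum z)
  orbitSum-InPQ z = Allₚ.map⁺ (All.tabulate (λ {u} h → Parking⇒IsPF u (proj₁ (∈-basis⁻ h))))

  coeff₂-⊗ : ∀ x y a b → coeff₂ (x ⊗ y) a b ≈ coeff x a ⊛ coeff y b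
  coeff₂-⊗ x y a b = begin
    coeff₂ (x ⊗ y) a b ≈⟨ ∑-concatMap _ x _ ⟩
    ∑ x (λ e → ∑ (map (λ f → (proj₁ e ⊛ proj₁ f , proj₂ e , proj₂ f)) y) (λ t → if pairTest a b (proj₂ t) then proj₁ t else 0#))
      ≈⟨ ∑-cong x (λ {e} _ → ≈-reflexive (∑-map _ y _)) ⟩
    ∑ x (λ e → ∑ y (λ f → if (proj₂ e == a) ∧ (proj₂ f == b) then proj₁ e ⊛ proj₁ f else 0#))
      ≈⟨ ∑-cong x (λ {e} _ → ∑-cong y (λ {f} _ → split (proj₂ e == a) (proj₂ f == b) (proj₁ e) (proj₁ f))) ⟩
    ∑ x (λ e → ∑ y (λ f → (if proj₂ e == a then proj₁ e else 0#) ⊛ (if proj₂ f == b then proj₁ f else 0#)))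
      ≈⟨ ∑-cong x (λ {e} _ → ∑-⊛ˡ y _ _) ⟩
    ∑ x (λ e → (if proj₂ e == a then proj₁ e else 0#) ⊛ coeff y b) ≈⟨ ∑-⊛ʳ x _ _ ⟩
    coeff x a ⊛ coeff y b ∎
    where
    split : ∀ s t i j → (if s ∧ t then i ⊛ j else 0#) ≈ (if s then i else 0#) ⊛ (if t then j else 0#)
    split true  true  i j = ≈-refl
    split true  false i j = ≈-sym (zeroʳ i)
    split false t     i j = ≈-sym (zeroˡ _)

  module _ (x : Elem) (inv : WordInvariant (coeff x)) (bounded : ∀ {e} → e ∈ x → length (proj₂ e) ≤ N) where

    private
      C : Word → Word → Carrier
      C = coeff₂ (Δ x)

      term : Word × Word → Elem × Elem
      term (z , y) = scale (C z y) (orbitSum z) , orbitSum y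

      pairs : List (Word × Word)
      pairs = cartesianProduct basis basis

    tensorTerms : List (Elem × Elem)
    tensorTerms = map term pairs

    private
      summand : Word → Word → Word × Word → Carrier
      summand a b (z , y) = (C z y ⊛ (𝟙 (inBasis a) ⊛ 𝟙 (rep a == z))) ⊛ (𝟙 (inBasis b) ⊛ 𝟙 (rep b == y))

      coeff₂-terms : ∀ a b → coeff₂ (concatMap (λ t → proj₁ t ⊗ proj₂ t) tensorTerms) a b ≈ ∑ pairs (summand a b)
      coeff₂-terms a b = begin
        coeff₂ (concatMap (λ t → proj₁ t ⊗ proj₂ t) tensorTerms) a b  ≈⟨ ∑-concatMap (λ t → proj₁ t ⊗ proj₂ t) tensorTerms _ ⟩
        ∑ tensorTerms (λ t → coeff₂ (proj₁ t ⊗ proj₂ t) a b)  ≡⟨ ∑-map term pairs _ ⟩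
        ∑ pairs (λ zy → coeff₂ (proj₁ (term zy) ⊗ proj₂ (term zy)) a b) ≈⟨ ∑-cong pairs (λ {zy} _ → at (proj₁ zy) (proj₂ zy)) ⟩
        ∑ pairs (summand a b)  ∎
        where
        at : ∀ z y → coeff₂ (scale (C z y) (orbitSum z) ⊗ orbitSum y) a b ≈ summand a b (z , y)
        at z y = ≈-trans (coeff₂-⊗ (scale (C z y) (orbitSum z)) (orbitSum y) a b)
          (⊛-cong (≈-trans (coeff-scale (C z y) (orbitSum z) a) (⊛-cong ≈-refl (coeff-orbitSum z a))) (coeff-orbitSum y b))

      vanish : ∀ i {j k} → j ≈ 0# → i ⊛ (j ⊛ k) ≈ 0#
      vanish i h = ≈-trans (⊛-cong ≈-refl (≈-trans (⊛-cong h ≈-refl) (zeroˡ _))) (zeroʳ i)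

      vanish′ : ∀ i {j k} → k ≈ 0# → i ⊛ (j ⊛ k) ≈ 0#
      vanish′ i h = ≈-trans (⊛-cong ≈-refl (≈-trans (⊛-cong ≈-refl h) (zeroʳ _))) (zeroʳ i)

      C-zero : ∀ {a b} → ¬ (T (inBasis a) × T (inBasis b)) → C a b ≈ 0#
      C-zero {a} {b} h = coeff₂-Δ-zero x (λ {e} e∈ ic → h
        ( ∈⇒inBasis a (∈-basis⁺ (InCoproduct.parkingˡ ic) (≤-trans (m≤m+n (length a) (length b)) (total e∈ ic)))
        , ∈⇒inBasis b (∈-basis⁺ (InCoproduct.parkingʳ ic) (≤-trans (m≤n+m (length b) (length a)) (total e∈ ic)))))
        where
        total : ∀ {e} → e ∈ x → InCoproduct (proj₂ e) a b → length a + length b ≤ N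
        total e∈ ic = subst (_≤ N) (length-coproduct ic) (bounded e∈)

      zero-summands : ∀ {a b} → ¬ (T (inBasis a) × T (inBasis b)) → ∑ pairs (summand a b) ≈ 0#
      zero-summands {a} {b} h = ∑-zero pairs (λ {zy} _ → at (proj₁ zy) (proj₂ zy))
        where
        at : ∀ z y → summand a b (z , y) ≈ 0#
        at z y with T? (inBasis a)
        ... | no ¬a = ≈-trans (⊛-cong (vanish (C z y) (≈-reflexive (cong 𝟙 (¬T⇒false ¬a)))) ≈-refl) (zeroˡ _)
        ... | yes a′ = vanish _ (≈-reflexive (cong 𝟙 (¬T⇒false (λ b′ → h (a′ , b′)))))

      -- Only the summand at the two representatives sees the pair, and the coefficient there equals
      -- the wanted one because `C` is constant on classes in each variable separately.
      total-summand : ∀ {a b} → T (inBasis a) → T (inBasis b) → ∑ pairs (summand a b) ≈ C a b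
      total-summand {a} {b} a∈ b∈ = begin
        ∑ pairs (summand a b)  ≈⟨ ∑-single (summand a b) (Uniqueₚ.cartesianProduct⁺ Unique-basis Unique-basis)
                                                (∈-cartesianProduct⁺ (rep-∈ (inBasis⇒∈ a a∈)) (rep-∈ (inBasis⇒∈ b b∈))) (λ {zy} _ → others (proj₁ zy) (proj₂ zy)) ⟩
        summand a b (rep a , rep b)  ≈⟨ ⊛-cong (⊛-cong ≈-refl (ones a a∈)) (ones b b∈) ⟩
        (C (rep a) (rep b) ⊛ 1#) ⊛ 1#  ≈⟨ ≈-trans (⊛-identityʳ _) (⊛-identityʳ _) ⟩
        C (rep a) (rep b)  ≈⟨ rep-value {λ z → C z (rep b)} (Δ-invariantˡ x (rep b) inv) a ⟩
        C a (rep b)  ≈⟨ rep-value {C a} (Δ-invariantʳ x a inv) b ⟩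
        C a b  ∎
        where
        ones : ∀ c → T (inBasis c) → 𝟙 (inBasis c) ⊛ 𝟙 (rep c == rep c) ≈ 1#
        ones c h = ≈-trans (⊛-cong (≈-reflexive (cong 𝟙 (T⇒true h))) (≈-reflexive (cong 𝟙 (==-refl (rep c))))) (⊛-identityˡ 1#)
        others : ∀ z y → (z , y) ≢ (rep a , rep b) → summand a b (z , y) ≈ 0#
        others z y ne with ≡-dec _≟_ (rep a) z
        ... | no ¬e = ≈-trans (⊛-cong (vanish′ (C z y) ≈-refl) ≈-refl) (zeroˡ _)
        ... | yes refl = vanish′ _ (≈-reflexive (cong 𝟙 (==-≢ {rep b} {y} (λ e → ne (cong (rep a ,_) (sym e))))))

    Δ≋terms : Δ x ≋₂ concatMap (λ t → proj₁ t ⊗ proj₂ t) tensorTerms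
    Δ≋terms a b with T? (inBasis a) ×-dec T? (inBasis b)
    ... | yes (a∈ , b∈) = ≈-sym (≈-trans (coeff₂-terms a b) (total-summand a∈ b∈))
    ... | no h          = ≈-trans (C-zero h) (≈-sym (≈-trans (coeff₂-terms a b) (zero-summands h)))

-- Invariance of the antipode

module Antipode {c ℓ} (F : Field c ℓ) (r : Rank) where
  open Closure F r
  open SetoidReasoning setoid
  open Ringₚ (Field.ring F) using (-0#≈0#; -‿distribʳ-*)
  open CommutativeSemigroupₚ (Field.*-commutativeSemigroup F) using (x∙yz≈y∙xz)

  nonTrivial : Word → List (Word × Word)
  nonTrivial u = filterᵇ (λ ab → not (null (proj₂ ab))) (coprodPairs u)

  coeff-G : ∀ u v → coeff (G u) v ≈ 𝟙 (u == v)
  coeff-G u v = ⊕-identityʳ _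

  ⊖-cong : ∀ {a b} → a ≈ b → ⊖ a ≈ ⊖ b
  ⊖-cong = Field.-‿cong F

  coeff-negate : ∀ y w → coeff (map (λ e → (⊖ proj₁ e , proj₂ e)) y) w ≈ ⊖ coeff y w
  coeff-negate y w = begin
    coeff (map (λ e → (⊖ proj₁ e , proj₂ e)) y) w  ≡⟨ ∑-map _ y _ ⟩
    ∑ y (λ e → if proj₂ e == w then ⊖ proj₁ e else 0#)  ≈⟨ ∑-cong y (λ {e} _ → pull (proj₂ e == w) (proj₁ e)) ⟩
    ∑ y (λ e → ⊖ (if proj₂ e == w then proj₁ e else 0#))  ≈⟨ ∑-neg y _ ⟩
    ⊖ coeff y w  ∎
    where
    pull : ∀ b k → (if b then ⊖ k else 0#) ≈ ⊖ (if b then k else 0#)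
    pull true  k = ≈-refl
    pull false k = ≈-sym -0#≈0#

  antiCoeff : ℕ → Word → Word → Carrier
  antiCoeff n w u = coeff (antiFuel n u) w

  antiTerms : ℕ → Word → Word → Carrier
  antiTerms n w u = ∑ (nonTrivial u) (λ ab → coeff (antiFuel n (proj₁ ab) ⋆ G (proj₂ ab)) w)

  antiCoeff-suc : ∀ n w u → antiCoeff (suc n) w u ≈ (𝟙 (u == []) ⊛ coeff unitE w) ⊕ (⊖ antiTerms n w u)
  -- The only pair for the empty word has an empty right factor and is discarded, so the sum is
  -- empty and the indicator supplies the unit.
  antiCoeff-suc n w [] = ≈-sym (≈-trans (⊕-cong (⊛-identityˡ _) -0#≈0#) (⊕-identityʳ _))
  antiCoeff-suc n w (x ∷ u) = begin
    coeff (antiFuel (suc n) (x ∷ u)) w  ≈⟨ coeff-negate (concatMap (λ ab → antiFuel n (proj₁ ab) ⋆ G (proj₂ ab)) (nonTrivial (x ∷ u))) w ⟩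
    ⊖ coeff (concatMap (λ ab → antiFuel n (proj₁ ab) ⋆ G (proj₂ ab)) (nonTrivial (x ∷ u))) w ≈⟨ ⊖-cong (coeff-concatMap _ (nonTrivial (x ∷ u)) w) ⟩
    ⊖ antiTerms n w (x ∷ u)  ≈⟨ ≈-sym (⊕-identityˡ _) ⟩
    0# ⊕ (⊖ antiTerms n w (x ∷ u))  ≈⟨ ⊕-cong (≈-sym (zeroˡ _)) ≈-refl ⟩
    (0# ⊛ coeff unitE w) ⊕ (⊖ antiTerms n w (x ∷ u))  ∎

  -- The combination of the left factors of the terms G_a ⊗ G_v of Δ x, for v nonempty.
  leftFactor : Word → Elem → Elem
  leftFactor v x = concatMap (λ e → map (λ ab → (proj₁ e ⊛ 𝟙 (proj₂ ab == v) , proj₁ ab)) (nonTrivial (proj₂ e))) x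

  ⟪leftFactor⟫ : ∀ v x g → ⟪ leftFactor v x , g ⟫ ≈ ∑ x (λ e → ∑ (nonTrivial (proj₂ e)) (λ ab → (proj₁ e ⊛ 𝟙 (proj₂ ab == v)) ⊛ g (proj₁ ab)))
  ⟪leftFactor⟫ v x g = ≈-trans (∑-concatMap _ x _) (∑-cong x (λ {e} _ → ≈-reflexive (∑-map _ (nonTrivial (proj₂ e)) _)))

  coeff-leftFactor : ∀ v x a → coeff (leftFactor v x) a ≈ 𝟙 (not (null v)) ⊛ coeff₂ (Δ x) a v
  coeff-leftFactor v x a = begin
    coeff (leftFactor v x) a
      ≈⟨ coeff-concatMap _ x a ⟩
    ∑ x (λ e → coeff (map (λ ab → (proj₁ e ⊛ 𝟙 (proj₂ ab == v) , proj₁ ab)) (nonTrivial (proj₂ e))) a)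
      ≈⟨ ∑-cong x (λ {e} _ → ≈-trans (≈-reflexive (∑-map _ (nonTrivial (proj₂ e)) _)) (∑-filter _ (coprodPairs (proj₂ e)) _)) ⟩
    ∑ x (λ e → ∑ (coprodPairs (proj₂ e)) (λ ab → 𝟙 (not (null (proj₂ ab))) ⊛ (if proj₁ ab == a then proj₁ e ⊛ 𝟙 (proj₂ ab == v) else 0#)))
      ≈⟨ ∑-cong x (λ {e} _ → ∑-cong (coprodPairs (proj₂ e)) (λ {ab} _ → at (proj₁ e) (proj₁ ab == a) (proj₂ ab))) ⟩
    ∑ x (λ e → ∑ (coprodPairs (proj₂ e)) (λ ab → 𝟙 (not (null v)) ⊛ (proj₁ e ⊛ 𝟙 (pairTest a v ab))))
      ≈⟨ ∑-cong x (λ {e} _ → ≈-trans (∑-⊛ˡ (coprodPairs (proj₂ e)) _ _) (⊛-cong ≈-refl (∑-⊛ˡ (coprodPairs (proj₂ e)) _ _))) ⟩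
    ∑ x (λ e → 𝟙 (not (null v)) ⊛ (proj₁ e ⊛ ∑ (coprodPairs (proj₂ e)) (𝟙 ∘ pairTest a v)))
      ≈⟨ ∑-⊛ˡ x _ _ ⟩
    𝟙 (not (null v)) ⊛ ⟪ x , (λ u → ∑ (coprodPairs u) (𝟙 ∘ pairTest a v)) ⟫
      ≈⟨ ⊛-cong ≈-refl (≈-sym (coeff₂-Δ x a v)) ⟩
    𝟙 (not (null v)) ⊛ coeff₂ (Δ x) a v ∎
    where
    at : ∀ k t b → 𝟙 (not (null b)) ⊛ (if t then k ⊛ 𝟙 (b == v) else 0#) ≈ 𝟙 (not (null v)) ⊛ (k ⊛ 𝟙 (t ∧ (b == v)))
    at k false b = ≈-trans (zeroʳ _) (≈-sym (≈-trans (⊛-cong ≈-refl (zeroʳ k)) (zeroʳ _)))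
    at k true  b with ≡-dec _≟_ b v
    ... | yes refl = ≈-refl
    ... | no _     = ≈-trans (≈-trans (⊛-cong ≈-refl (zeroʳ k)) (zeroʳ _)) (≈-sym (≈-trans (⊛-cong ≈-refl (zeroʳ k)) (zeroʳ _)))

  leftFactor-invariant : ∀ v x → WordInvariant (coeff x) → WordInvariant (coeff (leftFactor v x))
  leftFactor-invariant v x inv {a} {o} {p} {q} sw = ≈-trans (coeff-leftFactor v x _)
    (≈-trans (⊛-cong ≈-refl (Δ-invariantˡ x v inv sw)) (≈-sym (coeff-leftFactor v x a)))

  leftFactor-invariantᵛ : ∀ x a → WordInvariant (coeff x) → WordInvariant (λ v → coeff (leftFactor v x) a)
  leftFactor-invariantᵛ x a inv {v} {o} {p} {q} sw = ≈-trans (coeff-leftFactor (map σ v) x a)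
    (≈-trans (⊛-cong (≈-reflexive (cong (𝟙 ∘ not) (null-map v))) (Δ-invariantʳ x a inv sw)) (≈-sym (coeff-leftFactor v x a)))
    where
    σ = blockSwap o p q
    null-map : ∀ v → null (map σ v) ≡ null v
    null-map []      = refl
    null-map (_ ∷ _) = refl

  -- At each cut the right factor is forced to be the parkization of the second piece of `w`.
  -- Collecting the left factors that accompany it gives an element to which an induction hypothesis
  -- can be applied.
  ⟪antiTerms⟫ : ∀ n x w → ⟪ x , antiTerms n w ⟫ ≈
    𝟙 (isPF w) ⊛ ∑ (cuts w) (λ k → ⟪ leftFactor (Park (drop k w)) x , antiCoeff n (Park (take k w)) ⟫)
  ⟪antiTerms⟫ n x w = begin
    ⟪ x , antiTerms n w ⟫
      ≈⟨ ∑-cong x (λ {e} _ → ≈-sym (∑-⊛ˡ (nonTrivial (proj₂ e)) _ _)) ⟩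
    ∑ x (λ e → ∑ (nonTrivial (proj₂ e)) (λ ab → proj₁ e ⊛ coeff (antiFuel n (proj₁ ab) ⋆ G (proj₂ ab)) w))
      ≈⟨ ∑-cong x (λ {e} _ → ∑-cong (nonTrivial (proj₂ e)) (λ {ab} _ → at (proj₁ e) (proj₁ ab) (proj₂ ab))) ⟩
    ∑ x (λ e → ∑ (nonTrivial (proj₂ e)) (λ ab → P ⊛ ∑ (cuts w) (λ k → h k e ab)))
      ≈⟨ ∑-cong x (λ {e} _ → ≈-trans (∑-⊛ˡ (nonTrivial (proj₂ e)) P _) (⊛-cong ≈-refl (∑-swap (nonTrivial (proj₂ e)) (cuts w) _))) ⟩
    ∑ x (λ e → P ⊛ ∑ (cuts w) (λ k → ∑ (nonTrivial (proj₂ e)) (h k e)))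
      ≈⟨ ≈-trans (∑-⊛ˡ x P _) (⊛-cong ≈-refl (∑-swap x (cuts w) _)) ⟩
    P ⊛ ∑ (cuts w) (λ k → ∑ x (λ e → ∑ (nonTrivial (proj₂ e)) (h k e)))
      ≈⟨ ⊛-cong ≈-refl (∑-cong (cuts w) (λ {k} _ → ≈-sym (⟪leftFactor⟫ (Park (drop k w)) x (antiCoeff n (Park (take k w)))))) ⟩
    P ⊛ ∑ (cuts w) (λ k → ⟪ leftFactor (Park (drop k w)) x , antiCoeff n (Park (take k w)) ⟫) ∎
    where
    P : Carrier
    P = 𝟙 (isPF w)
    h : ℕ → Carrier × Word → Word × Word → Carrier
    h k e ab = (proj₁ e ⊛ 𝟙 (proj₂ ab == Park (drop k w))) ⊛ antiCoeff n (Park (take k w)) (proj₁ ab)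
    at : ∀ i a b → i ⊛ coeff (antiFuel n a ⋆ G b) w ≈ P ⊛ ∑ (cuts w) (λ k → (i ⊛ 𝟙 (b == Park (drop k w))) ⊛ antiCoeff n (Park (take k w)) a)
    at i a b = begin
      i ⊛ coeff (antiFuel n a ⋆ G b) w
        ≈⟨ ⊛-cong ≈-refl (coeff-⋆ (antiFuel n a) (G b) w) ⟩
      i ⊛ (P ⊛ ∑ (cuts w) (λ k → coeff (antiFuel n a) (Park (take k w)) ⊛ coeff (G b) (Park (drop k w))))
        ≈⟨ x∙yz≈y∙xz _ _ _ ⟩
      P ⊛ (i ⊛ ∑ (cuts w) (λ k → coeff (antiFuel n a) (Park (take k w)) ⊛ coeff (G b) (Park (drop k w))))
        ≈⟨ ⊛-cong ≈-refl (≈-sym (∑-⊛ˡ (cuts w) i _)) ⟩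
      P ⊛ ∑ (cuts w) (λ k → i ⊛ (coeff (antiFuel n a) (Park (take k w)) ⊛ coeff (G b) (Park (drop k w))))
        ≈⟨ ⊛-cong ≈-refl (∑-cong (cuts w) (λ {k} _ → ≈-trans (⊛-cong ≈-refl (≈-trans (⊛-comm _ _) (⊛-cong (coeff-G b (Park (drop k w))) ≈-refl))) (≈-sym (⊛-assoc _ _ _)))) ⟩
      P ⊛ ∑ (cuts w) (λ k → (i ⊛ 𝟙 (b == Park (drop k w))) ⊛ antiCoeff n (Park (take k w)) a) ∎

  unit-invariant : WordInvariant (coeff unitE)
  unit-invariant {[]}    sw = ≈-refl
  unit-invariant {_ ∷ _} sw = ≈-refl

  ⟪antiCoeff-suc⟫ : ∀ n x w → ⟪ x , antiCoeff (suc n) w ⟫ ≈ (⟪ x , (λ u → 𝟙 (u == [])) ⟫ ⊛ coeff unitE w) ⊕ (⊖ ⟪ x , antiTerms n w ⟫)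
  ⟪antiCoeff-suc⟫ n x w = begin
    ⟪ x , antiCoeff (suc n) w ⟫  ≈⟨ ⟪⟫-cong x (λ {e} _ → antiCoeff-suc n w (proj₂ e)) ⟩
    ⟪ x , (λ u → (𝟙 (u == []) ⊛ coeff unitE w) ⊕ (⊖ antiTerms n w u)) ⟫  ≈⟨ ∑-cong x (λ _ → distribˡ _ _ _) ⟩
    ∑ x (λ e → proj₁ e ⊛ (𝟙 (proj₂ e == []) ⊛ coeff unitE w) ⊕ proj₁ e ⊛ (⊖ antiTerms n w (proj₂ e))) ≈⟨ ∑-⊕ x _ _ ⟩
    ⟪ x , (λ u → 𝟙 (u == []) ⊛ coeff unitE w) ⟫ ⊕ ⟪ x , (λ u → ⊖ antiTerms n w u) ⟫
      ≈⟨ ⊕-cong (⟪⟫-⊛ʳ x (coeff unitE w) _) (≈-trans (∑-cong x (λ _ → ≈-sym (-‿distribʳ-* _ _))) (∑-neg x _)) ⟩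
    (⟪ x , (λ u → 𝟙 (u == [])) ⟫ ⊛ coeff unitE w) ⊕ (⊖ ⟪ x , antiTerms n w ⟫)  ∎

  -- Quantified over all invariant `x`, because the recursion leads from `x` to its left factors.
  -- These are invariant by the invariance of the coproduct in its first variable, while single
  -- basis words need not be.
  antiCoeff-invariant : ∀ n x → WordInvariant (coeff x) → WordInvariant (λ w → ⟪ x , antiCoeff n w ⟫)
  antiCoeff-invariant zero x inv {w} {o} {p} {q} sw = ⟪⟫-cong x (λ {e} _ → at (proj₂ e))
    where
    at : ∀ u → antiCoeff zero (map (blockSwap o p q) w) u ≈ antiCoeff zero w u
    at []      = unit-invariant sw
    at (_ ∷ _) = ≈-refl
  antiCoeff-invariant (suc n) x inv {w} {o} {p} {q} sw = ≈-trans (⟪antiCoeff-suc⟫ n x _)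
    (≈-trans (⊕-cong (⊛-cong ≈-refl (unit-invariant sw)) (⊖-cong terms)) (≈-sym (⟪antiCoeff-suc⟫ n x w)))
    where
    σ = blockSwap o p q
    cut : ∀ k → ⟪ leftFactor (Park (drop k (map σ w))) x , antiCoeff n (Park (take k (map σ w))) ⟫ ≈
                ⟪ leftFactor (Park (drop k w)) x , antiCoeff n (Park (take k w)) ⟫
    -- The exchange first acts on the index of the left factor, where all coefficients stay the
    -- same, and then on the word at which the antipode is evaluated.
    cut k = ≈-trans
      (⟪⟫-ext (leftFactor (Park (drop k (map σ w))) x) (leftFactor (Park (drop k w)) x) _
        (λ a → Park-drop-invariant sw k {λ v → coeff (leftFactor v x) a} (leftFactor-invariantᵛ x a inv)))
      (Park-take-invariant sw k {λ v → ⟪ leftFactor (Park (drop k w)) x , antiCoeff n v ⟫}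
        (antiCoeff-invariant n (leftFactor (Park (drop k w)) x) (leftFactor-invariant (Park (drop k w)) x inv)))
    terms : ⟪ x , antiTerms n (map σ w) ⟫ ≈ ⟪ x , antiTerms n w ⟫
    terms = ≈-trans (⟪antiTerms⟫ n x (map σ w)) (≈-trans
      (cut-sum-invariant (λ k w → ⟪ leftFactor (Park (drop k w)) x , antiCoeff n (Park (take k w)) ⟫) cut sw)
      (≈-sym (⟪antiTerms⟫ n x w)))

  nonTrivial-length : ∀ {u a b} → (a , b) ∈ nonTrivial u → length a < length u
  nonTrivial-length {u} {a} {b} h with ∈-filter⁻ (T? ∘ (λ ab → not (null (proj₂ ab)))) {xs = coprodPairs u} h
  ... | ab∈ , ne with b | ne | length-coproduct (∈-coprodPairs⁻ {u} ab∈)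
  ...   | y ∷ b′ | _ | e = subst (length a <_) (≡.trans (sym (+-suc (length a) (length b′))) (sym e)) (s≤s (m≤m+n (length a) (length b′)))

  -- `S` gives each word its own length as fuel, whereas the induction on fuel has to treat all
  -- words of `x` at once.
  antiFuel-fuel : ∀ m n u → length u ≤ m → length u ≤ n → antiFuel m u ≡ antiFuel n u
  antiFuel-fuel m       n       []      _ _ = refl
  antiFuel-fuel (suc m) (suc n) (x ∷ u) (s≤s hm) (s≤s hn) = cong (map (λ e → (⊖ proj₁ e , proj₂ e)) ∘ concat)
    (map-cong-local (All.tabulate λ {ab} h → cong (_⋆ G (proj₂ ab))
      (antiFuel-fuel m n (proj₁ ab) (≤-trans (≤-pred (nonTrivial-length {x ∷ u} h)) hm) (≤-trans (≤-pred (nonTrivial-length {x ∷ u} h)) hn))))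

  coeff-S : ∀ x w N → (∀ {e} → e ∈ x → length (proj₂ e) ≤ N) → coeff (S x) w ≈ ⟪ x , antiCoeff N w ⟫
  coeff-S x w N bounded = ≈-trans (coeff-concatMap _ x w) (∑-cong x (λ {e} e∈ →
    ≈-trans (coeff-scale (proj₁ e) (antiFuel (length (proj₂ e)) (proj₂ e)) w)
            (⊛-cong ≈-refl (≈-reflexive (cong (λ z → coeff z w) (antiFuel-fuel (length (proj₂ e)) N (proj₂ e) ≤-refl (bounded e∈)))))))

  S-invariant : ∀ x N → (∀ {e} → e ∈ x → length (proj₂ e) ≤ N) → WordInvariant (coeff x) → WordInvariant (coeff (S x))
  S-invariant x N bounded inv {w} sw = ≈-trans (coeff-S x _ N bounded)
    (≈-trans (antiCoeff-invariant N x inv sw) (≈-sym (coeff-S x w N bounded)))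

  InPQ-⋆ : ∀ x y → InPQ (x ⋆ y)
  InPQ-⋆ x y = Allₚ.concat⁺ (Allₚ.map⁺ (All.universal (λ e → Allₚ.concat⁺ (Allₚ.map⁺ (All.universal (λ f → Allₚ.map⁺
    (All.tabulate (λ {w} w∈ → Parking⇒IsPF w (InProduct.parking (∈-prodBasis⁻ {proj₂ e} {proj₂ f} w∈))))) y))) x))

  InPQ-antiFuel : ∀ n u → InPQ (antiFuel n u)
  InPQ-antiFuel n       []      = tt ∷ []
  InPQ-antiFuel zero    (x ∷ u) = []
  InPQ-antiFuel (suc n) (x ∷ u) = Allₚ.map⁺ (Allₚ.concat⁺ (Allₚ.map⁺ (All.universal
    (λ ab → InPQ-⋆ (antiFuel n (proj₁ ab)) (G (proj₂ ab))) (nonTrivial (x ∷ u)))))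

  InPQ-S : ∀ x → InPQ (S x)
  InPQ-S x = Allₚ.concat⁺ (Allₚ.map⁺ (All.universal (λ e → Allₚ.map⁺ (InPQ-antiFuel (length (proj₂ e)) (proj₂ e))) x))

-- Words with at most two columns

-- twoBlocks s t has the columns 1 … 1 (s letters) and 1 … 1 (t letters).
twoBlocks : ℕ → ℕ → Word
twoBlocks s t = replicate s 1 ++ replicate t (suc s)

length-twoBlocks : ∀ s t → length (twoBlocks s t) ≡ s + t
length-twoBlocks s t = ≡.trans (length-++ (replicate s 1)) (cong₂ _+_ (length-replicate s) (length-replicate t))

cnt-replicate-in : ∀ {o l a} n → InInterval o l a → cnt o l (replicate n a) ≡ n
cnt-replicate-in {a = a} n h = ≡.trans (cnt-all _ (Allₚ.replicate⁺ n h)) (length-replicate n)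

cnt-replicate-out : ∀ {o l a} n → ¬ InInterval o l a → cnt o l (replicate n a) ≡ 0
cnt-replicate-out n h = cnt-none _ (Allₚ.replicate⁺ n h)

module _ (s t : ℕ) where

  cnt-twoBlocks-low : ∀ i → 1 ≤ i → i ≤ s → cnt 0 i (twoBlocks s t) ≡ s
  cnt-twoBlocks-low i 1≤i i≤s = ≡.trans (cnt-++ 0 i (replicate s 1) _) (≡.trans (cong₂ _+_
    (cnt-replicate-in s (s≤s z≤n , 1≤i)) (cnt-replicate-out t (λ (_ , h) → <⇒≱ h i≤s))) (+-identityʳ s))

  cnt-twoBlocks-high : ∀ i → s < i → cnt 0 i (twoBlocks s t) ≡ s + t
  cnt-twoBlocks-high i s<i = ≡.trans (cnt-++ 0 i (replicate s 1) _) (cong₂ _+_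
    (cnt-replicate-in s (s≤s z≤n , ≤-trans (s≤s z≤n) s<i)) (cnt-replicate-in t (s≤s z≤n , s<i)))

  -- For i ≥ 1 the count takes no other values than s and s + t, and at a break it equals i.
  twoBlocks-breaks : ∀ i → Break (twoBlocks s t) i → i ≡ 0 ⊎ i ≡ s ⊎ i ≡ s + t
  twoBlocks-breaks zero    e = inj₁ refl
  twoBlocks-breaks (suc i) e with suc i ≤? s
  ... | yes h = inj₂ (inj₁ (≡.trans (sym e) (cnt-twoBlocks-low (suc i) (s≤s z≤n) h)))
  ... | no h  = inj₂ (inj₂ (≡.trans (sym e) (cnt-twoBlocks-high (suc i) (≰⇒> h))))

  twoBlocks-parking : Parking (twoBlocks s t)
  twoBlocks-parking = Allₚ.++⁺ (Allₚ.replicate⁺ s ≤-refl) (Allₚ.replicate⁺ t (s≤s z≤n)) , bound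
    where
    bound : ∀ i → i ≤ length (twoBlocks s t) → i ≤ cnt 0 i (twoBlocks s t)
    bound zero    _  = z≤n
    bound (suc i) i≤ with suc i ≤? s
    ... | yes h = subst (suc i ≤_) (sym (cnt-twoBlocks-low (suc i) (s≤s z≤n) h)) h
    ... | no h  = subst (suc i ≤_) (sym (cnt-twoBlocks-high (suc i) (≰⇒> h))) (subst (suc i ≤_) (length-twoBlocks s t) i≤)

  -- Three possible breaks leave a single exchange of nonempty intervals, that of the two columns.
  -- For t = 0 there is none; demanding largeness only when t ≥ 1 thus admits one-column words for
  -- every rank, ∞ included.
  twoBlocks-fixed : ∀ r → (1 ≤ t → ¬ (Small r s ⊎ Small r t)) →
    ∀ o p q → Swappable r (twoBlocks s t) o p q → map (blockSwap o p q) (twoBlocks s t) ≡ twoBlocks s t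
  twoBlocks-fixed r big o zero    q       sw = map-id-local (All.universal (blockSwap-zeroˡ o q) _)
  twoBlocks-fixed r big o (suc p) zero    sw = map-id-local (All.universal (blockSwap-zeroʳ o (suc p)) _)
  twoBlocks-fixed r big o (suc p) (suc q) sw = ⊥-elim
    (go (twoBlocks-breaks o break₀) (twoBlocks-breaks _ break₁) (twoBlocks-breaks _ break₂))
    where
    open Swappable sw
    m<m+suc : ∀ m n → m < m + suc n
    m<m+suc m n = subst (m <_) (sym (+-suc m n)) (s≤s (m≤m+n m n))
    le : ∀ {i} → i ≡ 0 ⊎ i ≡ s ⊎ i ≡ s + t → i ≤ s + t
    le (inj₁ refl)        = z≤n
    le (inj₂ (inj₁ refl)) = m≤m+n s t
    le (inj₂ (inj₂ refl)) = ≤-refl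
    go : o ≡ 0 ⊎ o ≡ s ⊎ o ≡ s + t → o + suc p ≡ 0 ⊎ o + suc p ≡ s ⊎ o + suc p ≡ s + t →
         o + suc p + suc q ≡ 0 ⊎ o + suc p + suc q ≡ s ⊎ o + suc p + suc q ≡ s + t → ⊥
    go _ (inj₁ e) _ = <⇒≱ (m<m+suc o p) (subst (_≤ o) (sym e) z≤n)
    go _ (inj₂ (inj₂ e)) c = <⇒≱ (m<m+suc (o + suc p) q) (subst (o + suc p + suc q ≤_) (sym e) (le c))
    go (inj₂ (inj₁ e)) (inj₂ (inj₁ e′)) _ = <⇒≢ (m<m+suc o p) (≡.trans e (sym e′))
    go (inj₂ (inj₂ e)) b c = <⇒≱ (m<m+suc o p) (subst (o + suc p ≤_) (sym e) (le b))
    go (inj₁ _) (inj₂ (inj₁ e)) (inj₁ e′) = <⇒≱ (m<m+suc (o + suc p) q) (subst (_≤ o + suc p) (sym e′) z≤n)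
    go (inj₁ _) (inj₂ (inj₁ e)) (inj₂ (inj₁ e′)) = <⇒≢ (m<m+suc (o + suc p) q) (≡.trans e (sym e′))
    go (inj₁ refl) (inj₂ (inj₁ refl)) (inj₂ (inj₂ e)) = big (subst (1 ≤_) q≡t (s≤s z≤n)) (Sum.map₂ (subst (Small r) q≡t) small)
      where
      q≡t : suc q ≡ t
      q≡t = +-cancelˡ-≡ (suc p) _ _ e

twoBlocks-++ : ∀ s t → twoBlocks s 0 ++ shift (length (twoBlocks s 0)) (twoBlocks t 0) ≡ twoBlocks s t
twoBlocks-++ s t = cong₂ _++_ (++-identityʳ (replicate s 1)) (begin
  shift (length (twoBlocks s 0)) (twoBlocks t 0)  ≡⟨ cong₂ shift (≡.trans (length-twoBlocks s 0) (+-identityʳ s)) (++-identityʳ (replicate t 1)) ⟩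
  map (s +_) (replicate t 1)  ≡⟨ map-replicate (s +_) t 1 ⟩
  replicate t (s + 1)  ≡⟨ cong (replicate t) (+-comm s 1) ⟩
  replicate t (suc s)  ∎)
  where open ≡-Reasoning

∈-shuffles-++ : ∀ a c → a ++ c ∈ shuffles a c
∈-shuffles-++ []      c       = here refl
∈-shuffles-++ (x ∷ a) []      = here (++-identityʳ (x ∷ a))
∈-shuffles-++ (x ∷ a) (y ∷ c) = ∈-++⁺ˡ (∈-map⁺ (x ∷_) (∈-shuffles-++ a (y ∷ c)))

-- Closure of the invariant subspaces, nesting, and witnesses of non(co)commutativity

module _ {c ℓ} (F : Field c ℓ) where

  open StructureConstants F
  open SetoidReasoning setoid

  module _ (r : Rank) (x : Elem) where
    open Closure F r using (WordInvariant; invariant⇒word; word⇒invariant)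

    PQr⇒word : PQr r x → WordInvariant (coeff x)
    PQr⇒word (_ , inv) = invariant⇒word x inv

    word⇒PQr : InPQ x → WordInvariant (coeff x) → PQr r x
    word⇒PQr h inv = h , word⇒invariant x inv

  -- Any common bound on the lengths will do; it fixes the size of `Orbits` and the fuel of the
  -- antipode.
  lengthBound : Elem → ℕ
  lengthBound x = sum (map (length ∘ proj₂) x)

  length≤bound : ∀ x {e} → e ∈ x → length (proj₂ e) ≤ lengthBound x
  length≤bound (e ∷ x) (here refl) = m≤m+n _ _
  length≤bound (e ∷ x) (there h)   = ≤-trans (length≤bound x h) (m≤n+m _ (length (proj₂ e)))

  gradedHopfSubalgebra : ∀ r → IsGradedHopfSubalgebra (PQr r)
  gradedHopfSubalgebra r =
      word⇒PQr r [] [] (λ _ → ≈-refl)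
    , (λ x y px py → word⇒PQr r (x ++ y) (Allₚ.++⁺ (proj₁ px) (proj₁ py)) (λ {u} sw →
         ≈-trans (coeff-++ x y _) (≈-trans (⊕-cong (PQr⇒word r x px sw) (PQr⇒word r y py sw)) (≈-sym (coeff-++ x y u)))))
    , (λ k x px → word⇒PQr r (scale k x) (Allₚ.map⁺ (proj₁ px)) (λ {u} sw →
         ≈-trans (coeff-scale k x _) (≈-trans (⊛-cong ≈-refl (PQr⇒word r x px sw)) (≈-sym (coeff-scale k x u)))))
    , (λ n x px → word⇒PQr r (homog n x) (Allₚ.filter⁺ (T? ∘ _) (proj₁ px)) (λ {u} {o} {p} {q} sw →
         ≈-trans (coeff-homog n x _) (≈-trans
           (⊛-cong (≈-reflexive (cong (λ l → 𝟙 (l ≡ᵇ n)) (length-map (blockSwap o p q) u))) (PQr⇒word r x px sw))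
           (≈-sym (coeff-homog n x u)))))
    , word⇒PQr r unitE (tt ∷ []) unit-invariant
    , (λ x y px py → word⇒PQr r (x ⋆ y) (InPQ-⋆ x y) (⋆-invariant x y (PQr⇒word r x px) (PQr⇒word r y py)))
    , (λ x px → let open Orbits F r (lengthBound x)
                    terms = tensorTerms x (PQr⇒word r x px) (length≤bound x)
                in terms
                 , Allₚ.map⁺ (All.universal (λ (z , y) →
                       word⇒PQr r (scale (coeff₂ (Δ x) z y) (orbitSum z)) (Allₚ.map⁺ (orbitSum-InPQ z)) (λ {u} sw →
                         ≈-trans (coeff-scale (coeff₂ (Δ x) z y) (orbitSum z) _) (≈-trans (⊛-cong ≈-refl (orbitSum-invariant z sw))
                           (≈-sym (coeff-scale (coeff₂ (Δ x) z y) (orbitSum z) u))))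
                     , word⇒PQr r (orbitSum y) (orbitSum-InPQ y) (orbitSum-invariant y)) (cartesianProduct basis basis))
                 , Δ≋terms x (PQr⇒word r x px) (length≤bound x))
    , (λ x px → word⇒PQr r (S x) (InPQ-S x) (S-invariant x (lengthBound x) (length≤bound x) (PQr⇒word r x px)))
    where
    open Closure F r using (⋆-invariant)
    open Antipode F r using (unit-invariant; InPQ-⋆; InPQ-S; S-invariant)

  -- An interval of length less than 1 is empty, and an exchange with it moves nothing.
  PQ₁-everything : ∀ x → InPQ x → PQr (fin 1) x
  PQ₁-everything x h = word⇒PQr (fin 1) x h (λ {u} {o} {p} {q} sw → ≈-reflexive (cong (coeff x) (identity u o p q (Swappable.small sw))))
    where
    identity : ∀ u o p q → p < 1 ⊎ q < 1 → map (blockSwap o p q) u ≡ u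
    identity u o zero    q       _                = map-id-local (All.universal (blockSwap-zeroˡ o q) u)
    identity u o (suc p) zero    _                = map-id-local (All.universal (blockSwap-zeroʳ o (suc p)) u)
    identity u o (suc p) (suc q) (inj₁ (s≤s ()))
    identity u o (suc p) (suc q) (inj₂ (s≤s ()))

  -- A weaker notion of smallness admits more exchanges and so demands more invariance.
  PQr-mono : ∀ r r′ → (∀ l → Small r l → Small r′ l) → ∀ x → PQr r′ x → PQr r x
  PQr-mono r r′ h x px = word⇒PQr r x (proj₁ px) (λ sw → PQr⇒word r′ x px (weaken sw))
    where
    weaken : ∀ {u o p q} → Swappable r u o p q → Swappable r′ u o p q
    weaken sw = record { parking = parking ; break₀ = break₀ ; break₁ = break₁ ; break₂ = break₂ ; small = Sum.map (h _) (h _) small }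
      where open Swappable sw

  -- The coefficients of `G u` form the indicator of `u`, so `u` has to be alone in its class. A
  -- word exchanged into `u` is recovered by the inverse exchange, which fixes `u`.
  fixed-basis : ∀ r u → Parking u → (∀ o p q → Swappable r u o p q → map (blockSwap o p q) u ≡ u) → PQr r (G u)
  fixed-basis r u pu fixed = word⇒PQr r (G u) (Parking⇒IsPF u pu ∷ []) (λ {v} {o} {p} {q} sw →
    ⊕-cong (≈-reflexive (cong (λ b → if b then 1# else 0#) (same {v} {o} {p} {q} sw))) ≈-refl)
    where
    same : ∀ {v o p q} → Swappable r v o p q → (u == map (blockSwap o p q) v) ≡ (u == v)
    same {v} {o} {p} {q} sw = T-ext (≡⇒== {u} {v} ∘ to ∘ ==⇒≡) (≡⇒== {u} ∘ from ∘ ==⇒≡ {u} {v})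
      where
      inverse : map (blockSwap o q p) (map (blockSwap o p q) v) ≡ v
      inverse = ≡.trans (sym (map-∘ v)) (map-id-local (All.universal (blockSwap-involutive o p q) v))
      to : u ≡ map (blockSwap o p q) v → u ≡ v
      to e = ≡.trans (sym (fixed o q p (subst (λ z → Swappable r z o q p) (sym e) (swappable-sym sw))))
        (≡.trans (cong (map (blockSwap o q p)) e) inverse)
      from : u ≡ v → u ≡ map (blockSwap o p q) v
      from refl = sym (fixed o p q sw)

  PQ∞-noncommutative : NonCommutative (PQr ∞)
  PQ∞-noncommutative = G (1 ∷ []) , G (1 ∷ 1 ∷ []) , single 1 , single 2 , different
    where
    single : ∀ s → PQr ∞ (G (twoBlocks s 0))
    single s = fixed-basis ∞ (twoBlocks s 0) (twoBlocks-parking s 0) (twoBlocks-fixed s 0 ∞ (λ ()))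
    different : ¬ ((G (1 ∷ []) ⋆ G (1 ∷ 1 ∷ [])) ≋ (G (1 ∷ 1 ∷ []) ⋆ G (1 ∷ [])))
    different h = Field.1≉0 F (begin
      1#  ≈⟨ ⊛-identityˡ 1# ⟨
      1# ⊛ 1#  ≈⟨ ⊕-identityʳ _ ⟨
      (1# ⊛ 1#) ⊕ 0#  ≈⟨ ≈-trans (⊕-identityˡ _) (≈-trans (⊕-identityˡ _) (⊕-identityˡ _)) ⟨
      -- Coefficients of 311. The first product consists of 111, 122, 211, 311, in this order; the
      -- second of 111, 112, 113, 221.
      0# ⊕ (0# ⊕ (0# ⊕ ((1# ⊛ 1#) ⊕ 0#)))  ≈⟨ h (3 ∷ 1 ∷ 1 ∷ []) ⟩
      0# ⊕ (0# ⊕ (0# ⊕ (0# ⊕ 0#)))  ≈⟨ ≈-trans (⊕-identityˡ _) (≈-trans (⊕-identityˡ _) (≈-trans (⊕-identityˡ _) (⊕-identityˡ _))) ⟩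
      0#  ∎)

  noncommutative : ∀ r → NonCommutative (PQr r)
  noncommutative r = let (x , y , px , py , ne) = PQ∞-noncommutative in
    x , y , PQr-mono r ∞ (λ _ _ → tt) x px , PQr-mono r ∞ (λ _ _ → tt) y py , ne

  coeff₂-flip : ∀ t a b → coeff₂ (flip₂ t) a b ≈ coeff₂ t b a
  coeff₂-flip t a b = ≈-trans (≈-reflexive (∑-map _ t _)) (∑-cong t (λ {e} _ →
    ≈-reflexive (cong (λ z → if z then proj₁ e else 0#) (∧-comm (proj₂ (proj₂ e) == a) _))))

  coeff₂-ΔG : ∀ u {a b} → Parking a → Parking b → coeff₂ (Δ (G u)) a b ≈ 𝟙 (isShuffle u a (shift (length a) b))
  coeff₂-ΔG u {a} {b} pa pb = ≈-trans (coeff₂-Δ (G u) a b)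
    (≈-trans (⊕-identityʳ _) (≈-trans (⊛-identityˡ _) (coprodPairs-count u pa pb)))

  -- The columns have lengths r and r + 1. Neither is less than r, so `G u` is invariant; and they
  -- differ, so the order of the factors shows in the number of ones: r in `u`, but r + 1 in every
  -- shuffle of `b` with the shifted `a`.
  noncocommutative : ∀ r .{{_ : NonZero r}} → NonCocommutative (PQr (fin r))
  noncocommutative r = G u , fixed-basis (fin r) u (twoBlocks-parking r (suc r)) (twoBlocks-fixed r (suc r) (fin r) (λ _ → not-small)) , different
    where
    1≤r : 1 ≤ r
    1≤r = >-nonZero⁻¹ r
    u a b : Word
    u = twoBlocks r (suc r)
    a = twoBlocks r 0
    b = twoBlocks (suc r) 0
    pa : Parking a
    pa = twoBlocks-parking r 0
    pb : Parking b
    pb = twoBlocks-parking (suc r) 0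
    not-small : ¬ (r < r ⊎ suc r < r)
    not-small (inj₁ h) = <-irrefl refl h
    not-small (inj₂ h) = <⇒≱ h (n≤1+n r)
    is-shuffle : T (isShuffle u a (shift (length a) b))
    is-shuffle = ∈⇒isShuffle a _ (subst (_∈ shuffles a (shift (length a) b)) (twoBlocks-++ r (suc r)) (∈-shuffles-++ a _))
    not-shuffle : ¬ T (isShuffle u b (shift (length b) a))
    not-shuffle h = <⇒≢ (n<1+n r) (≡.trans (sym (cnt-twoBlocks-low r (suc r) 1 ≤-refl 1≤r))
      (≡.trans (cnt-shuffle-low pb pa (isShuffle⇒∈ u b _ h) 1 (s≤s z≤n)) (cnt-twoBlocks-low (suc r) 0 1 ≤-refl (s≤s z≤n))))
    different : ¬ (Δ (G u) ≋₂ flip₂ (Δ (G u)))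
    different h = Field.1≉0 F (begin
      1#  ≡⟨ cong 𝟙 (T⇒true is-shuffle) ⟨
      𝟙 (isShuffle u a (shift (length a) b))  ≈⟨ coeff₂-ΔG u pa pb ⟨
      coeff₂ (Δ (G u)) a b  ≈⟨ h a b ⟩
      coeff₂ (flip₂ (Δ (G u))) a b  ≈⟨ coeff₂-flip (Δ (G u)) a b ⟩
      coeff₂ (Δ (G u)) b a  ≈⟨ coeff₂-ΔG u pb pa ⟩
      𝟙 (isShuffle u b (shift (length b) a))  ≡⟨ cong 𝟙 (¬T⇒false not-shuffle) ⟩
      0#  ∎)

  cocommutative : Cocommutative (PQr ∞)
  cocommutative x px a b = ≈-trans (symmetric (T? (isPF a)) (T? (isPF b))) (≈-sym (coeff₂-flip (Δ x) a b))
    where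
    symmetric : Dec (IsPF a) → Dec (IsPF b) → coeff₂ (Δ x) a b ≈ coeff₂ (Δ x) b a
    symmetric (no ¬a) _ = ≈-trans (coeff₂-Δ-zero x (λ _ h → ¬a (Parking⇒IsPF a (InCoproduct.parkingˡ h))))
                          (≈-sym (coeff₂-Δ-zero x (λ _ h → ¬a (Parking⇒IsPF a (InCoproduct.parkingʳ h)))))
    symmetric (yes _) (no ¬b) = ≈-trans (coeff₂-Δ-zero x (λ _ h → ¬b (Parking⇒IsPF b (InCoproduct.parkingʳ h))))
                          (≈-sym (coeff₂-Δ-zero x (λ _ h → ¬b (Parking⇒IsPF b (InCoproduct.parkingˡ h)))))
    symmetric (yes a′) (yes b′) = begin
      coeff₂ (Δ x) a b  ≈⟨ coeff₂-Δ-shuffles x pa pb ⟩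
      ∑ sh (coeff x)  ≈⟨ ∑-cong sh (λ u∈ → ≈-sym (PQr⇒word ∞ x px (shuffle-swappable-∞ pa pb u∈))) ⟩
      ∑ sh (coeff x ∘ map σ)  ≡⟨ ∑-map (map σ) sh (coeff x) ⟨
      ∑ (map (map σ) sh) (coeff x)  ≡⟨ cong (λ z → ∑ z (coeff x)) (map-shuffles σ a (shift (length a) b)) ⟩
      -- The exchange lifts `a` above the values of `b` and lowers the shifted `b` to `b`: these are
      -- the words of the opposite coefficient, listed in the other order.
      ∑ (shuffles (map σ a) (map σ (shift (length a) b))) (coeff x) ≡⟨ cong₂ (λ y z → ∑ (shuffles y z) (coeff x)) (map-swap-∞ˡ pa pb) (map-swap-∞ʳ pa pb) ⟩
      ∑ (shuffles (shift (length b) a) b) (coeff x)  ≈⟨ ∑-↭ (coeff x) (shuffles-comm (shift (length b) a) b) ⟩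
      ∑ (shuffles b (shift (length b) a)) (coeff x)  ≈⟨ coeff₂-Δ-shuffles x pb pa ⟨
      coeff₂ (Δ x) b a  ∎
      where
      pa : Parking a
      pa = IsPF⇒Parking a a′
      pb : Parking b
      pb = IsPF⇒Parking b b′
      σ = blockSwap 0 (length a) (length b)
      sh : List Word
      sh = shuffles a (shift (length a) b)

mainTheorem3 : ∀ {c ℓ} (F : Field c ℓ) → let open PQ F in
    (∀ r → IsGradedHopfSubalgebra (PQr r))
    × (∀ x → InPQ x → PQr (fin 1) x)
    × (∀ (r : ℕ) .{{_ : NonZero r}} x → PQr (fin (suc r)) x → PQr (fin r) x)
    × (∀ (r : ℕ) .{{_ : NonZero r}} x → PQr ∞ x → PQr (fin r) x)
    × (∀ r → NonCommutative (PQr r))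
    × (∀ (r : ℕ) .{{_ : NonZero r}} → NonCocommutative (PQr (fin r)))
    × Cocommutative (PQr ∞)
mainTheorem3 F =
    gradedHopfSubalgebra F
  , PQ₁-everything F
  , (λ r → PQr-mono F (fin r) (fin (suc r)) (λ _ → m≤n⇒m≤1+n))
  , (λ r → PQr-mono F (fin r) ∞ (λ _ _ → tt))
  , noncommutative F
  , (λ r → noncocommutative F r)
  , cocommutative F
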